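{- Let $p=\lfloor\frac{n-4-3l}{l+1}\rfloor$. Then the poset $(\mathcal{U}_{n,l}^{4},\preceq)$ has exactly $p+1$ minimal elements, namely $U_{n,l}^{4,0},U_{n,l}^{4,1},\dots,U_{n,l}^{4,p}$.
   Context: For a graph $G$ on $n$ vertices with Laplacian matrix $L(G)=D(G)-A(G)$, write $\det(\lambda I_n-L(G))=\sum_{k=0}^n(-1)^k c_k(G)\lambda^{n-k}$. For graphs $G,H$ of order $n$, $G\preceq H$ means $c_k(G)\le c_k(H)$ for all $0\le k\le n$, and $G\prec H$ means $G\preceq H$ and $c_k(G)<c_k(H)$ for some $k$. A minimal element of a set of graphs (up to isomorphism) is a graph $G$ in it with no $H$ in the set satisfying $H\prec G$. A leaf is a vertex of degree $1$. $\mathcal{U}_{n,l}^g$ is the set of connected unicyclic graphs with $n$ vertices, exactly $l$ leaves and girth $g$. The balanced starlike tree $BST_{m,l}$ is the tree of order $m$ with $l$ leaves obtained by identifying one end of each of $l$ paths, each of order $\lfloor\frac{m-1}{l}\rfloor+1$ or $\lceil\frac{m-1}{l}\rceil+1$, into a single vertex (its center). $U_{n,l}^{g,q}$ ($q\ge0$) is obtained from the cycle $C_g$ and a path $w_0w_1\cdots w_q$ by identifying $w_0$ with a cycle vertex and $w_q$ with the center of $BST_{n-q-g+1,l}$ (for $q=0$ the center is identified with the cycle vertex).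
   Formalization: The formal statement assumes l ≥ 2 and n ≥ 3l+4: for smaller n the number p is negative although the set can be nonempty (l=2, n=6), and for l=1 all the listed graphs coincide, so the stated count fails (n=9). -}

module Defs where

open import Data.Bool using (Bool; true; false; _∧_; _∨_; if_then_else_; T)
open import Data.Nat using (ℕ; zero; suc; _+_; _*_; _∸_; _≤_; _<_; _/_; _%_; _≡ᵇ_; _<ᵇ_)
open import Data.Fin using (Fin; toℕ; punchIn)
import Data.Fin as F
open import Data.Integer as Z using (ℤ; 0ℤ; 1ℤ)
open import Data.List using (List; []; _∷_; _++_; map; foldr; upTo; allFin)
open import Data.Nat.ListAction using (sum)
open import Data.Bool.ListAction using (any)
open import Data.Product using (Σ; Σ-syntax; ∃; ∃-syntax; _×_; _,_)
open import Data.Sum using (_⊎_)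
open import Relation.Binary.PropositionalEquality using (_≡_)
open import Relation.Nullary using (¬_)
open import Function.Definitions using (Injective)
open import Function.Bundles using (_↔_; Inverse)

Graph : ℕ → Set
Graph n = Fin n → Fin n → Bool

module _ {n : ℕ} (G : Graph n) where

  Symmetric : Set
  Symmetric = ∀ u v → G u v ≡ G v u

  Irreflexive : Set
  Irreflexive = ∀ u → G u u ≡ false

  deg : Fin n → ℕ
  deg u = sum (map (λ v → if G u v then 1 else 0) (allFin n))

  -- sum of all degrees = 2 |E|
  degSum : ℕ
  degSum = sum (map deg (allFin n))

  data Walk : Fin n → Fin n → Set where
    here : ∀ {u} → Walk u u
    step : ∀ {u v w} → T (G u v) → Walk v w → Walk u w

  Connected : Set
  Connected = ∀ u v → Walk u v

  Unicyclic : Set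
  Unicyclic = Connected × degSum ≡ 2 * n

  leaves : ℕ
  leaves = sum (map (λ v → if deg v ≡ᵇ 1 then 1 else 0) (allFin n))

  HasCycle : ℕ → Set
  HasCycle k = 3 ≤ k × Σ[ f ∈ (Fin k → Fin n) ] (Injective _≡_ _≡_ f ×
    (∀ i j → (suc (toℕ i) ≡ toℕ j ⊎ (suc (toℕ i) ≡ k × toℕ j ≡ 0)) → T (G (f i) (f j))))

  Girth : ℕ → Set
  Girth g = HasCycle g × (∀ k → k < g → ¬ HasCycle k)

UniSet : (n l g : ℕ) → Graph n → Set
UniSet n l g G = Symmetric G × Irreflexive G × Unicyclic G × leaves G ≡ l × Girth G g

Iso : ∀ {n} → Graph n → Graph n → Set
Iso {n} G H = Σ[ σ ∈ (Fin n ↔ Fin n) ] (∀ u v → G (Inverse.to σ u) (Inverse.to σ v) ≡ H u v)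

-- Polynomials over ℤ as coefficient lists (lowest degree first)

Poly : Set
Poly = List ℤ

padd : Poly → Poly → Poly
padd [] q = q
padd (a ∷ p) [] = a ∷ p
padd (a ∷ p) (b ∷ q) = (a Z.+ b) ∷ padd p q

pscale : ℤ → Poly → Poly
pscale c = map (c Z.*_)

pmul : Poly → Poly → Poly
pmul [] q = []
pmul (a ∷ p) q = padd (pscale a q) (0ℤ ∷ pmul p q)

coeff : Poly → ℕ → ℤ
coeff [] _ = 0ℤ
coeff (a ∷ p) zero = a
coeff (a ∷ p) (suc i) = coeff p i

sgn : ℕ → ℤ
sgn zero = 1ℤ
sgn (suc k) = Z.- sgn k

det : ∀ m → (Fin m → Fin m → Poly) → Poly
det zero M = 1ℤ ∷ []
det (suc m) M = foldr padd []
  (map (λ j → pscale (sgn (toℕ j)) (pmul (M F.zero j) (det m (λ i k → M (F.suc i) (punchIn j k)))))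
       (allFin (suc m)))

-- det(λ I - L(G)), L(G) = D(G) - A(G)
charPoly : ∀ {n} → Graph n → Poly
charPoly {n} G = det n (λ i j →
  if toℕ i ≡ᵇ toℕ j then (Z.- Z.+ (deg G i)) ∷ 1ℤ ∷ []
  else (if G i j then 1ℤ ∷ [] else 0ℤ ∷ []))

-- det(λI - L) = Σ_k (-1)^k c_k λ^{n-k}
c : ∀ {n} → Graph n → ℕ → ℤ
c {n} G k = sgn k Z.* coeff (charPoly G) (n ∸ k)

_≼_ : ∀ {n} → Graph n → Graph n → Set
_≼_ {n} G H = ∀ k → k ≤ n → c G k Z.≤ c H k

_≺_ : ∀ {n} → Graph n → Graph n → Set
_≺_ {n} G H = G ≼ H × ∃[ k ] (k ≤ n × c G k Z.< c H k)

Minimal : ∀ {n} → (Graph n → Set) → Graph n → Set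
Minimal S G = S G × ¬ (∃[ H ] (S H × H ≺ G))

-- The graphs U_{n,l}^{g,q}
-- cycle: 0,1,…,g-1 ; path w_0 = 0, w_i = g+i-1 (1 ≤ i ≤ q);
-- centre of BST = w_q ; the n-q-g remaining vertices g+q,…,n-1 form l arms.

Edges : Set
Edges = List (ℕ × ℕ)

chain : ℕ → ℕ → Edges
chain v zero = []
chain v (suc k) = (v , suc v) ∷ chain (suc v) k

cycleEdges : ℕ → Edges
cycleEdges g = (g ∸ 1 , 0) ∷ chain 0 (g ∸ 1)

pathEdges : ℕ → ℕ → Edges
pathEdges g zero = []
pathEdges g (suc k) = (0 , g) ∷ chain g k

centre : ℕ → ℕ → ℕ
centre g zero = 0
centre g (suc k) = g + k

armEdges : ℕ → ℕ → ℕ → Edges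
armEdges ct s zero = []
armEdges ct s (suc k) = (ct , s) ∷ chain s k

arms : ℕ → ℕ → List ℕ → Edges
arms ct s [] = []
arms ct s (a ∷ as) = armEdges ct s a ++ arms ct (s + a) as

-- l arm lengths (non-centre vertices), each ⌊total/l⌋ or ⌈total/l⌉, summing to total
armLengths : ℕ → ℕ → List ℕ
armLengths total zero = []
armLengths total (suc k) =
  map (λ j → total / suc k + (if j <ᵇ total % suc k then 1 else 0)) (upTo (suc k))

fromEdges : ∀ {n} → Edges → Graph n
fromEdges es u v = any (λ e → edgeIs e) es
  where
  edgeIs : ℕ × ℕ → Bool
  edgeIs (a , b) = ((a ≡ᵇ toℕ u) ∧ (b ≡ᵇ toℕ v)) ∨ ((b ≡ᵇ toℕ u) ∧ (a ≡ᵇ toℕ v))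

U : (n l g q : ℕ) → Graph n
U n l g q = fromEdges (cycleEdges g ++ pathEdges g q ++
  arms (centre g q) (g + q) (armLengths (n ∸ (q + g)) l))

{-# OPTIONS --safe #-}

-- For a rooted tree let R be det(xI + L) and Q the same determinant with the root deleted, so that
-- R / Q is an effective conductance to ground.  Pruning leaves reduces a unicyclic graph of girth 4
-- to a 4-cycle carrying rooted trees, and det(xI + L) = Σ cₖ xⁿ⁻ᵏ to a polynomial F in their Q and R
-- with coefficients in ℕ.  Comparing coefficients, F decreases when
--   * the trees at several cycle vertices are merged at one of them;
--   * the branches at two branch vertices are gathered at the one whose remaining branch has the
--     larger conductance (the linear terms shrink, the bilinear term disappears); this covers both
--     the removal of branch vertices and the balancing of two legs;
--   * the centre slides one step towards the cycle while some leg has at most q + 2 vertices.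
-- Each step lowers F(1), and the graphs admitting none are the U n l 4 q with q ≤ p.  For these, F at
-- q + 1 exceeds F at q by B · (Rʸ Qʰ - Qʸ Rʰ), where y is the 4-cycle with a stem and h a path with
-- more vertices than y.  At x = 1 this is positive, yet its coefficient of x² is negative, so that
-- for q ≤ p the graphs U n l 4 q are pairwise incomparable.
module Submission where

open import Defs
open import Data.Bool using (Bool; true; false; _∧_; _∨_; if_then_else_; T)
open import Data.Nat using (ℕ; zero; suc; _+_; _*_; _∸_; _≤_; _<_; _/_; _%_; _≡ᵇ_; _<ᵇ_; _⊔_; z≤n; s≤s; NonZero)
import Data.Nat as ℕ
import Data.Bool.Properties as Boolₚ
open import Data.Nat.Properties as ℕₚ using ()
open import Data.Nat.Solver using (module +-*-Solver)
open import Data.Integer as ℤ using (ℤ; 0ℤ; 1ℤ; -1ℤ) renaming (+_ to int)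
import Data.Integer.Properties as ℤₚ
import Data.Integer.Solver as ℤSolver
open import Data.Fin as F using (Fin; zero; suc; toℕ; punchIn; punchOut)
import Data.Fin.Properties as Fₚ
open import Data.List using (List; []; _∷_; _++_; map; foldr; upTo; length; replicate)
import Data.List.Properties as Lₚ
open import Data.Product using (Σ-syntax; ∃-syntax; ∃₂; _×_; _,_; proj₁; proj₂)
open import Data.Sum using (_⊎_; inj₁; inj₂)
open import Data.Empty using (⊥; ⊥-elim)
open import Data.Unit using (⊤; tt)
open import Function using (_∘_; id)
import Relation.Binary.Definitions as Tri
open import Relation.Nullary using (¬_; Dec; yes; no)
open import Relation.Nullary.Decidable using (toWitness)
open import Relation.Binary.PropositionalEquality using (_≡_; _≢_; refl; sym; trans; cong; cong₂; subst; subst₂; module ≡-Reasoning)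
import Algebra.Properties.CommutativeMonoid.Sum as CommutativeMonoidSum
import Algebra.Properties.Semiring.Sum as SemiringSum
open import Data.List.Relation.Binary.Permutation.Propositional as ↭ using (_↭_; ↭-refl; ↭-sym; ↭-trans; ↭-prep; ↭-swap)
import Data.List.Relation.Binary.Permutation.Propositional.Properties as ↭ₚ
open import Data.List.Relation.Unary.All as All using (All; []; _∷_)
import Data.List.Relation.Unary.All.Properties as Allₚ
import Data.Fin.Permutation as Perm
import Data.List.Relation.Unary.Any as Any
import Data.List.Relation.Unary.Any.Properties as Anyₚ
open import Data.List.Membership.Propositional using (_∈_)
open import Function.Bundles using (Inverse)
import Data.Nat.DivMod as DivMod
import Data.Nat.Divisibility as Divisibility
import Data.Nat.Induction as ℕᵢ
open import Data.Nat.ListAction using (sum)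
import Data.Nat.ListAction.Properties as Sumₚ

-- Polynomials are handled through their values at natural numbers x. The substitution of -x for λ
-- removes all signs, and comparing coefficients becomes the task of exhibiting the difference as a
-- polynomial over ℕ, that is, one semiring identity; a subtraction is avoided by adding the same
-- term to both sides. The reduction steps act on trees attached to a cycle and never return to
-- graphs: only the end result is realised, by pruning `U n l 4 q` itself. Labels record which
-- vertex of the graph each tree vertex is, so that equal shapes yield an isomorphism. The bound p
-- comes from the sliding step. It is blocked when q = 0 or when each of the l legs has at least q +
-- 3 vertices; then q + l (q + 3) + 4 ≤ n, that is, q (l + 1) + 4 + 3l ≤ n. The constant 3 reflects
-- that the 4-cycle conducts, coefficient by coefficient, at least as well as a path on four
-- vertices but not as well as one on five, where the linear coefficient of the cross difference is
-- negative. The same change of sign makes the canonical graphs incomparable.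

private variable
  A A′ A″ : Set

-- Polynomials and their values

evalℤ : Poly → ℤ → ℤ
evalℤ [] x = 0ℤ
evalℤ (a ∷ p) x = a ℤ.+ x ℤ.* evalℤ p x

evalℤ-padd : ∀ p q x → evalℤ (padd p q) x ≡ evalℤ p x ℤ.+ evalℤ q x
evalℤ-padd [] q x = sym (ℤₚ.+-identityˡ _)
evalℤ-padd (a ∷ p) [] x = sym (ℤₚ.+-identityʳ _)
evalℤ-padd (a ∷ p) (b ∷ q) x = trans (cong (λ z → (a ℤ.+ b) ℤ.+ x ℤ.* z) (evalℤ-padd p q x))
  (solve 5 (λ a b x y z → (a :+ b) :+ x :* (y :+ z) := (a :+ x :* y) :+ (b :+ x :* z)) refl a b x _ _)
  where open ℤSolver.+-*-Solver

evalℤ-pscale : ∀ k p x → evalℤ (pscale k p) x ≡ k ℤ.* evalℤ p x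
evalℤ-pscale k [] x = sym (ℤₚ.*-zeroʳ k)
evalℤ-pscale k (a ∷ p) x = trans (cong (λ z → k ℤ.* a ℤ.+ x ℤ.* z) (evalℤ-pscale k p x))
  (solve 4 (λ k a x y → k :* a :+ x :* (k :* y) := k :* (a :+ x :* y)) refl k a x _)
  where open ℤSolver.+-*-Solver

evalℤ-pmul : ∀ p q x → evalℤ (pmul p q) x ≡ evalℤ p x ℤ.* evalℤ q x
evalℤ-pmul [] q x = sym (ℤₚ.*-zeroˡ (evalℤ q x))
evalℤ-pmul (a ∷ p) q x = begin
  evalℤ (padd (pscale a q) (0ℤ ∷ pmul p q)) x
    ≡⟨ evalℤ-padd (pscale a q) (0ℤ ∷ pmul p q) x ⟩
  evalℤ (pscale a q) x ℤ.+ (0ℤ ℤ.+ x ℤ.* evalℤ (pmul p q) x)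
    ≡⟨ cong₂ (λ y z → y ℤ.+ (0ℤ ℤ.+ x ℤ.* z)) (evalℤ-pscale a q x) (evalℤ-pmul p q x) ⟩
  a ℤ.* evalℤ q x ℤ.+ (0ℤ ℤ.+ x ℤ.* (evalℤ p x ℤ.* evalℤ q x))
    ≡⟨ solve 4 (λ a x p q → a :* q :+ (con 0ℤ :+ x :* (p :* q)) := (a :+ x :* p) :* q) refl a x _ _ ⟩
  (a ℤ.+ x ℤ.* evalℤ p x) ℤ.* evalℤ q x ∎
  where
  open ≡-Reasoning
  open ℤSolver.+-*-Solver

coeff-padd : ∀ p q j → coeff (padd p q) j ≡ coeff p j ℤ.+ coeff q j
coeff-padd [] q j = sym (ℤₚ.+-identityˡ _)
coeff-padd (a ∷ p) [] j = sym (ℤₚ.+-identityʳ _)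
coeff-padd (a ∷ p) (b ∷ q) zero = refl
coeff-padd (a ∷ p) (b ∷ q) (suc j) = coeff-padd p q j

coeff-pscale : ∀ k p j → coeff (pscale k p) j ≡ k ℤ.* coeff p j
coeff-pscale k [] j = sym (ℤₚ.*-zeroʳ k)
coeff-pscale k (a ∷ p) zero = refl
coeff-pscale k (a ∷ p) (suc j) = coeff-pscale k p j

-- The constant term is a multiple of the evaluation point |a| + 1, hence 0.
vanishing : ∀ p → (∀ x → evalℤ p (int (suc x)) ≡ 0ℤ) → ∀ j → coeff p j ≡ 0ℤ
vanishing [] h j = refl
vanishing (a ∷ p) h = go
  where
  e : ℤ
  e = evalℤ p (int (suc ℤ.∣ a ∣))
  a≡ : a ≡ ℤ.- (int (suc ℤ.∣ a ∣) ℤ.* e)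
  a≡ = begin
    a ≡⟨ solve 2 (λ a y → a := (a :+ y) :+ (:- y)) refl a (int (suc ℤ.∣ a ∣) ℤ.* e) ⟩
    (a ℤ.+ int (suc ℤ.∣ a ∣) ℤ.* e) ℤ.+ ℤ.- (int (suc ℤ.∣ a ∣) ℤ.* e)
      ≡⟨ cong (λ z → z ℤ.+ ℤ.- (int (suc ℤ.∣ a ∣) ℤ.* e)) (h ℤ.∣ a ∣) ⟩
    0ℤ ℤ.+ ℤ.- (int (suc ℤ.∣ a ∣) ℤ.* e) ≡⟨ ℤₚ.+-identityˡ _ ⟩
    ℤ.- (int (suc ℤ.∣ a ∣) ℤ.* e) ∎
    where
    open ≡-Reasoning
    open ℤSolver.+-*-Solver
  ∣a∣≡ : ℤ.∣ a ∣ ≡ suc ℤ.∣ a ∣ * ℤ.∣ e ∣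
  ∣a∣≡ = trans (cong ℤ.∣_∣ a≡) (trans (ℤₚ.∣-i∣≡∣i∣ (int (suc ℤ.∣ a ∣) ℤ.* e)) (ℤₚ.abs-* (int (suc ℤ.∣ a ∣)) e))
  small : ∀ m k → m ≡ suc m * k → m ≡ 0
  small m zero eq = trans eq (ℕₚ.*-zeroʳ m)
  small m (suc k) eq = ⊥-elim (ℕₚ.<-irrefl refl (subst (suc m ≤_) (sym eq) (ℕₚ.m≤m*n (suc m) (suc k))))
  a≡0 : a ≡ 0ℤ
  a≡0 = ℤₚ.∣i∣≡0⇒i≡0 (small ℤ.∣ a ∣ ℤ.∣ e ∣ ∣a∣≡)
  tail : ∀ x → evalℤ p (int (suc x)) ≡ 0ℤ
  tail x with ℤₚ.i*j≡0⇒i≡0∨j≡0 (int (suc x)) (trans (sym (ℤₚ.+-identityˡ _))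
                (trans (cong (λ z → z ℤ.+ (int (suc x) ℤ.* evalℤ p (int (suc x)))) (sym a≡0)) (h x)))
  ... | inj₂ eq = eq
  go : ∀ j → coeff (a ∷ p) j ≡ 0ℤ
  go zero = a≡0
  go (suc j) = vanishing p tail j

coeff-unique : ∀ p q → (∀ x → evalℤ p (int (suc x)) ≡ evalℤ q (int (suc x))) → ∀ j → coeff p j ≡ coeff q j
coeff-unique p q h j = ℤₚ.i-j≡0⇒i≡j (coeff p j) (coeff q j) (trans (sym diff-coeff) (vanishing (padd p (pscale -1ℤ q)) diff-eval j))
  where
  diff-coeff : coeff (padd p (pscale -1ℤ q)) j ≡ coeff p j ℤ.- coeff q j
  diff-coeff = trans (coeff-padd p (pscale -1ℤ q) j)
    (cong (λ z → coeff p j ℤ.+ z) (trans (coeff-pscale -1ℤ q j) (ℤₚ.-1*i≡-i (coeff q j))))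
  diff-eval : ∀ x → evalℤ (padd p (pscale -1ℤ q)) (int (suc x)) ≡ 0ℤ
  diff-eval x = trans (evalℤ-padd p (pscale -1ℤ q) (int (suc x)))
    (trans (cong₂ ℤ._+_ (h x) (trans (evalℤ-pscale -1ℤ q (int (suc x))) (ℤₚ.-1*i≡-i _)))
           (ℤₚ.+-inverseʳ (evalℤ q (int (suc x)))))

-- Polynomials with coefficients in ℕ

evalℕ : List ℕ → ℕ → ℕ
evalℕ [] x = 0
evalℕ (a ∷ p) x = a + x * evalℕ p x

coeffℕ : List ℕ → ℕ → ℕ
coeffℕ [] j = 0
coeffℕ (a ∷ p) zero = a
coeffℕ (a ∷ p) (suc j) = coeffℕ p j

addℕ : List ℕ → List ℕ → List ℕ
addℕ [] q = q
addℕ (a ∷ p) [] = a ∷ p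
addℕ (a ∷ p) (b ∷ q) = (a + b) ∷ addℕ p q

mulℕ : List ℕ → List ℕ → List ℕ
mulℕ [] q = []
mulℕ (a ∷ p) q = addℕ (map (a *_) q) (0 ∷ mulℕ p q)

eval-addℕ : ∀ p q x → evalℕ (addℕ p q) x ≡ evalℕ p x + evalℕ q x
eval-addℕ [] q x = refl
eval-addℕ (a ∷ p) [] x = sym (ℕₚ.+-identityʳ _)
eval-addℕ (a ∷ p) (b ∷ q) x = trans (cong (λ z → (a + b) + x * z) (eval-addℕ p q x))
  (solve 5 (λ a b x y z → (a :+ b) :+ x :* (y :+ z) := (a :+ x :* y) :+ (b :+ x :* z)) refl a b x _ _)
  where open +-*-Solver

eval-scaleℕ : ∀ k p x → evalℕ (map (k *_) p) x ≡ k * evalℕ p x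
eval-scaleℕ k [] x = sym (ℕₚ.*-zeroʳ k)
eval-scaleℕ k (a ∷ p) x = trans (cong (λ z → k * a + x * z) (eval-scaleℕ k p x))
  (solve 4 (λ k a x y → k :* a :+ x :* (k :* y) := k :* (a :+ x :* y)) refl k a x _)
  where open +-*-Solver

eval-mulℕ : ∀ p q x → evalℕ (mulℕ p q) x ≡ evalℕ p x * evalℕ q x
eval-mulℕ [] q x = refl
eval-mulℕ (a ∷ p) q x = trans (eval-addℕ (map (a *_) q) (0 ∷ mulℕ p q) x)
  (trans (cong₂ (λ y z → y + x * z) (eval-scaleℕ a q x) (eval-mulℕ p q x))
    (solve 4 (λ a x p q → a :* q :+ x :* (p :* q) := (a :+ x :* p) :* q) refl a x _ _))
  where open +-*-Solver

coeff-addℕ : ∀ p q j → coeffℕ (addℕ p q) j ≡ coeffℕ p j + coeffℕ q j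
coeff-addℕ [] q j = refl
coeff-addℕ (a ∷ p) [] j = sym (ℕₚ.+-identityʳ _)
coeff-addℕ (a ∷ p) (b ∷ q) zero = refl
coeff-addℕ (a ∷ p) (b ∷ q) (suc j) = coeff-addℕ p q j

length-addℕ : ∀ {d} p q → length p ≤ d → length q ≤ d → length (addℕ p q) ≤ d
length-addℕ [] q hp hq = hq
length-addℕ (a ∷ p) [] hp hq = hp
length-addℕ (a ∷ p) (b ∷ q) (s≤s hp) (s≤s hq) = s≤s (length-addℕ p q hp hq)

length-mulℕ : ∀ d {e} p q → length p ≤ suc d → length q ≤ suc e → length (mulℕ p q) ≤ suc (d + e)
length-mulℕ d [] q hp hq = z≤n
length-mulℕ d {e} (a ∷ p) q (s≤s hp) hq = length-addℕ (map (a *_) q) (0 ∷ mulℕ p q)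
  (ℕₚ.≤-trans (ℕₚ.≤-reflexive (Lₚ.length-map (a *_) q)) (ℕₚ.≤-trans hq (s≤s (ℕₚ.m≤n+m e d))))
  (tail d p hp)
  where
  tail : ∀ d p → length p ≤ d → suc (length (mulℕ p q)) ≤ suc (d + e)
  tail zero [] hp = s≤s z≤n
  tail (suc d) p hp = s≤s (length-mulℕ d p q hp hq)

coeffℕ-beyond : ∀ p j → length p ≤ j → coeffℕ p j ≡ 0
coeffℕ-beyond [] j h = refl
coeffℕ-beyond (a ∷ p) (suc j) (s≤s h) = coeffℕ-beyond p j h

evalℤ-embed : ∀ p x → evalℤ (map int p) (int x) ≡ int (evalℕ p x)
evalℤ-embed [] x = refl
evalℤ-embed (a ∷ p) x = cong (λ z → int a ℤ.+ z) (trans (cong (λ z → int x ℤ.* z) (evalℤ-embed p x)) (sym (ℤₚ.pos-* x (evalℕ p x))))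

coeff-embed : ∀ p j → coeff (map int p) j ≡ int (coeffℕ p j)
coeff-embed [] j = refl
coeff-embed (a ∷ p) zero = refl
coeff-embed (a ∷ p) (suc j) = coeff-embed p j

coeffℕ-unique : ∀ p q → (∀ x → evalℕ p x ≡ evalℕ q x) → ∀ j → coeffℕ p j ≡ coeffℕ q j
coeffℕ-unique p q h j = ℤₚ.+-injective (trans (sym (coeff-embed p j)) (trans
  (coeff-unique (map int p) (map int q)
    (λ x → trans (evalℤ-embed p (suc x)) (trans (cong int (h (suc x))) (sym (evalℤ-embed q (suc x))))) j)
  (coeff-embed q j)))

eval-1-monotone : ∀ p q → (∀ j → coeffℕ p j ≤ coeffℕ q j) → evalℕ p 1 ≤ evalℕ q 1
eval-1-monotone [] q h = z≤n
eval-1-monotone (a ∷ p) [] h = ℕₚ.+-mono-≤ (h 0) (ℕₚ.+-mono-≤ (eval-1-monotone p [] (λ j → h (suc j))) z≤n)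
eval-1-monotone (a ∷ p) (b ∷ q) h = ℕₚ.+-mono-≤ (h 0) (ℕₚ.+-mono-≤ (eval-1-monotone p q (λ j → h (suc j))) z≤n)

positive-coefficient : ∀ p → 0 < evalℕ p 1 → ∃[ j ] 0 < coeffℕ p j
positive-coefficient (zero ∷ p) h with positive-coefficient p (subst (0 <_) (ℕₚ.+-identityʳ _) h)
... | j , hj = suc j , hj
positive-coefficient (suc a ∷ p) h = 0 , s≤s z≤n

-- Since `≼` compares only the coefficients with index up to n, the degree bound is what controls
-- the remaining ones.
record PolyFun (d : ℕ) (f : ℕ → ℕ) : Set where
  constructor polyFun
  field
    coeffs   : List ℕ
    degree≤  : length coeffs ≤ suc d
    evaluate : ∀ x → evalℕ coeffs x ≡ f x
open PolyFun public

poly-const : ∀ k → PolyFun 0 (λ _ → k)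
poly-const k = polyFun (k ∷ []) (s≤s z≤n) (λ x → trans (cong (k +_) (ℕₚ.*-zeroʳ x)) (ℕₚ.+-identityʳ k))

poly-id : PolyFun 1 id
poly-id = polyFun (0 ∷ 1 ∷ []) (s≤s (s≤s z≤n)) (λ x → trans (cong (λ z → x * (1 + z)) (ℕₚ.*-zeroʳ x)) (ℕₚ.*-identityʳ x))

poly-≤ : ∀ {d e f} → d ≤ e → PolyFun d f → PolyFun e f
poly-≤ h p = polyFun (coeffs p) (ℕₚ.≤-trans (degree≤ p) (s≤s h)) (evaluate p)

poly-+ : ∀ {d f g} → PolyFun d f → PolyFun d g → PolyFun d (λ x → f x + g x)
poly-+ p q = polyFun (addℕ (coeffs p) (coeffs q)) (length-addℕ (coeffs p) (coeffs q) (degree≤ p) (degree≤ q))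
  (λ x → trans (eval-addℕ (coeffs p) (coeffs q) x) (cong₂ _+_ (evaluate p x) (evaluate q x)))

poly-* : ∀ {d e f g} → PolyFun d f → PolyFun e g → PolyFun (d + e) (λ x → f x * g x)
poly-* {d} p q = polyFun (mulℕ (coeffs p) (coeffs q)) (length-mulℕ d (coeffs p) (coeffs q) (degree≤ p) (degree≤ q))
  (λ x → trans (eval-mulℕ (coeffs p) (coeffs q) x) (cong₂ _*_ (evaluate p x) (evaluate q x)))

IsPoly : (ℕ → ℕ) → Set
IsPoly f = ∃[ d ] PolyFun d f

is-const : ∀ k → IsPoly (λ _ → k)
is-const k = 0 , poly-const k

is-id : IsPoly id
is-id = 1 , poly-id

is-+ : ∀ {f g} → IsPoly f → IsPoly g → IsPoly (λ x → f x + g x)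
is-+ (d , p) (e , q) = d ⊔ e , poly-+ (poly-≤ (ℕₚ.m≤m⊔n d e) p) (poly-≤ (ℕₚ.m≤n⊔m d e) q)

is-* : ∀ {f g} → IsPoly f → IsPoly g → IsPoly (λ x → f x * g x)
is-* (d , p) (e , q) = d + e , poly-* p q

-- The coefficientwise order

infix 4 _⊑_

-- An inequality between all values would say nothing about single coefficients. With the difference
-- a polynomial over ℕ, a pointwise identity is enough, because a polynomial is determined by its
-- values; the relation is then compatible with sums and with products by polynomials over ℕ.
_⊑_ : (ℕ → ℕ) → (ℕ → ℕ) → Set
f ⊑ g = Σ[ h ∈ (ℕ → ℕ) ] (IsPoly h × (∀ x → f x + h x ≡ g x))

⊑-refl : ∀ {f} → f ⊑ f
⊑-refl = (λ _ → 0) , is-const 0 , λ x → ℕₚ.+-identityʳ _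

⊑-trans : ∀ {f g h} → f ⊑ g → g ⊑ h → f ⊑ h
⊑-trans (k , pk , ek) (m , pm , em) = (λ x → k x + m x) , is-+ pk pm ,
  λ x → trans (sym (ℕₚ.+-assoc _ (k x) (m x))) (trans (cong (_+ m x) (ek x)) (em x))

⊑-≗ : ∀ {f g f′ g′} → (∀ x → f x ≡ f′ x) → (∀ x → g x ≡ g′ x) → f ⊑ g → f′ ⊑ g′
⊑-≗ ef eg (h , ph , eh) = h , ph , λ x → trans (cong (_+ h x) (sym (ef x))) (trans (eh x) (eg x))

⊑-+ : ∀ {f g f′ g′} → f ⊑ g → f′ ⊑ g′ → (λ x → f x + f′ x) ⊑ (λ x → g x + g′ x)
⊑-+ {f} {g} {f′} (h , ph , eh) (h′ , ph′ , eh′) = (λ x → h x + h′ x) , is-+ ph ph′ , λ x →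
  trans (solve 4 (λ a b c d → (a :+ b) :+ (c :+ d) := (a :+ c) :+ (b :+ d)) refl (f x) (f′ x) (h x) (h′ x))
        (cong₂ _+_ (eh x) (eh′ x))
  where open +-*-Solver

⊑-*ˡ : ∀ {f g k} → IsPoly k → f ⊑ g → (λ x → k x * f x) ⊑ (λ x → k x * g x)
⊑-*ˡ {f} {g} {k} pk (h , ph , eh) = (λ x → k x * h x) , is-* pk ph , λ x →
  trans (sym (ℕₚ.*-distribˡ-+ (k x) (f x) (h x))) (cong (k x *_) (eh x))

⊑-*ʳ : ∀ {f g k} → IsPoly k → f ⊑ g → (λ x → f x * k x) ⊑ (λ x → g x * k x)
⊑-*ʳ {f} {g} {k} pk le = ⊑-≗ (λ x → ℕₚ.*-comm (k x) (f x)) (λ x → ℕₚ.*-comm (k x) (g x)) (⊑-*ˡ pk le)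

⊑⇒≤ : ∀ {f g} → f ⊑ g → ∀ x → f x ≤ g x
⊑⇒≤ (h , ph , eh) x = subst (_ ≤_) (eh x) (ℕₚ.m≤m+n _ (h x))

⊑⇒coeffs : ∀ {d e f g} (pf : PolyFun d f) (pg : PolyFun e g) → (le : f ⊑ g) → ∀ j →
  coeffℕ (coeffs pf) j + coeffℕ (coeffs (proj₂ (proj₁ (proj₂ le)))) j ≡ coeffℕ (coeffs pg) j
⊑⇒coeffs pf pg (h , (_ , ph) , eh) j = trans (sym (coeff-addℕ (coeffs pf) (coeffs ph) j))
  (coeffℕ-unique (addℕ (coeffs pf) (coeffs ph)) (coeffs pg)
    (λ x → trans (eval-addℕ (coeffs pf) (coeffs ph) x)
      (trans (cong₂ _+_ (evaluate pf x) (evaluate ph x)) (trans (eh x) (sym (evaluate pg x))))) j)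

-- Determinants over ℤ

module ℕΣ = CommutativeMonoidSum ℕₚ.+-0-commutativeMonoid
module ℤΣ = SemiringSum ℤₚ.+-*-semiring

Mat : ℕ → Set
Mat n = Fin n → Fin n → ℤ

detℤ : ∀ m → Mat m → ℤ
detℤ zero M = 1ℤ
detℤ (suc m) M = ℤΣ.sum (λ j → sgn (toℕ j) ℤ.* (M zero j ℤ.* detℤ m (λ i k → M (suc i) (punchIn j k))))

detℤ-cong : ∀ m {M N : Mat m} → (∀ i j → M i j ≡ N i j) → detℤ m M ≡ detℤ m N
detℤ-cong zero h = refl
detℤ-cong (suc m) h = ℤΣ.sum-cong-≗ (λ j → cong (λ z → sgn (toℕ j) ℤ.* z)
  (cong₂ ℤ._*_ (h zero j) (detℤ-cong m (λ i k → h (suc i) (punchIn j k)))))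

evalℤ-sum : ∀ {A : Set} n (f : A → Poly) (g : Fin n → A) x →
  evalℤ (foldr padd [] (map f (Data.List.tabulate g))) x ≡ ℤΣ.sum (λ i → evalℤ (f (g i)) x)
evalℤ-sum zero f g x = refl
evalℤ-sum (suc n) f g x = trans (evalℤ-padd (f (g zero)) (foldr padd [] (map f (Data.List.tabulate (g ∘ F.suc)))) x)
  (cong (λ z → evalℤ (f (g zero)) x ℤ.+ z) (evalℤ-sum n f (g ∘ F.suc) x))

evalℤ-det : ∀ m M x → evalℤ (det m M) x ≡ detℤ m (λ i j → evalℤ (M i j) x)
evalℤ-det zero M x = trans (cong (λ z → 1ℤ ℤ.+ z) (ℤₚ.*-zeroʳ x)) refl
evalℤ-det (suc m) M x = trans (evalℤ-sum (suc m) (λ j → pscale (sgn (toℕ j)) (pmul (M zero j) (det m (N j)))) id x)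
  (ℤΣ.sum-cong-≗ (λ j →
    trans (evalℤ-pscale (sgn (toℕ j)) (pmul (M zero j) (det m (N j))) x) (cong (λ z → sgn (toℕ j) ℤ.* z)
      (trans (evalℤ-pmul (M zero j) (det m (N j)) x) (cong (λ z → evalℤ (M zero j) x ℤ.* z) (evalℤ-det m (N j) x))))))
  where
  N : Fin (suc m) → Fin m → Fin m → Poly
  N j i k = M (suc i) (punchIn j k)

private
  swap-factors : ∀ s t a b d → (ℤ.- s) ℤ.* (a ℤ.* (t ℤ.* (b ℤ.* d))) ≡ (ℤ.- t) ℤ.* (b ℤ.* (s ℤ.* (a ℤ.* d)))
  swap-factors = solve 5 (λ s t a b d → (:- s) :* (a :* (t :* (b :* d))) := (:- t) :* (b :* (s :* (a :* d)))) refl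
    where open ℤSolver.+-*-Solver

  distrib₂ : ∀ n s a (f : Fin n → ℤ) → s ℤ.* (a ℤ.* ℤΣ.sum f) ≡ ℤΣ.sum (λ i → s ℤ.* (a ℤ.* f i))
  distrib₂ n s a f = trans (cong (λ z → s ℤ.* z) (ℤΣ.*-distribˡ-sum a f)) (ℤΣ.*-distribˡ-sum s (λ i → a ℤ.* f i))

-- Expanding along row 0 and then each minor along column 0 gives a double sum over the minors
-- `D i j` with two rows and two columns removed. Exchanging the sums is the same computation in the
-- other order.
column-expansion : ∀ m (M : Mat (suc m)) →
  detℤ (suc m) M ≡ ℤΣ.sum (λ i → sgn (toℕ i) ℤ.* (M i zero ℤ.* detℤ m (λ r s → M (punchIn i r) (suc s))))
column-expansion zero M = refl
column-expansion (suc m) M = cong (λ z → 1ℤ ℤ.* (M zero zero ℤ.* detℤ (suc m) (λ r s → M (suc r) (suc s))) ℤ.+ z) (begin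
  ℤΣ.sum (λ j → (ℤ.- sgn (toℕ j)) ℤ.* (M zero (suc j) ℤ.* detℤ (suc m) (λ i k → M (suc i) (punchIn (suc j) k))))
    ≡⟨ ℤΣ.sum-cong-≗ (λ j → trans (cong (λ z → (ℤ.- sgn (toℕ j)) ℤ.* (M zero (suc j) ℤ.* z))
         (column-expansion m (λ i k → M (suc i) (punchIn (suc j) k))))
         (distrib₂ (suc m) (ℤ.- sgn (toℕ j)) (M zero (suc j)) (λ i → sgn (toℕ i) ℤ.* (M (suc i) zero ℤ.* D i j)))) ⟩
  ℤΣ.sum (λ j → ℤΣ.sum (λ i → (ℤ.- sgn (toℕ j)) ℤ.* (M zero (suc j) ℤ.* (sgn (toℕ i) ℤ.* (M (suc i) zero ℤ.* D i j)))))
    ≡⟨ ℤΣ.∑-comm (λ j i → (ℤ.- sgn (toℕ j)) ℤ.* (M zero (suc j) ℤ.* (sgn (toℕ i) ℤ.* (M (suc i) zero ℤ.* D i j)))) ⟩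
  ℤΣ.sum (λ i → ℤΣ.sum (λ j → (ℤ.- sgn (toℕ j)) ℤ.* (M zero (suc j) ℤ.* (sgn (toℕ i) ℤ.* (M (suc i) zero ℤ.* D i j)))))
    ≡⟨ ℤΣ.sum-cong-≗ (λ i → trans
         (ℤΣ.sum-cong-≗ (λ j → swap-factors (sgn (toℕ j)) (sgn (toℕ i)) (M zero (suc j)) (M (suc i) zero) (D i j)))
         (sym (distrib₂ (suc m) (ℤ.- sgn (toℕ i)) (M (suc i) zero) (λ j → sgn (toℕ j) ℤ.* (M zero (suc j) ℤ.* D i j))))) ⟩
  ℤΣ.sum (λ i → (ℤ.- sgn (toℕ i)) ℤ.* (M (suc i) zero ℤ.* detℤ (suc m) (λ r s → M (punchIn (suc i) r) (suc s)))) ∎)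
  where
  open ≡-Reasoning
  D : Fin (suc m) → Fin (suc m) → ℤ
  D i j = detℤ m (λ r s → M (suc (punchIn i r)) (suc (punchIn j s)))

detℤ-transpose : ∀ m (M : Mat m) → detℤ m (λ i j → M j i) ≡ detℤ m M
detℤ-transpose zero M = refl
detℤ-transpose (suc m) M = trans
  (ℤΣ.sum-cong-≗ (λ j → cong (λ z → sgn (toℕ j) ℤ.* (M j zero ℤ.* z)) (detℤ-transpose m (λ r s → M (punchIn j r) (suc s)))))
  (sym (column-expansion m M))

swap₀₁ : ∀ {m} → Fin (suc (suc m)) → Fin (suc (suc m))
swap₀₁ zero = suc zero
swap₀₁ (suc zero) = zero
swap₀₁ (suc (suc i)) = suc (suc i)

-- In the expansion along column 0 the first two terms trade places, and their signs are opposite.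
-- In every other term rows 0 and 1 survive in the minor, where induction applies.
detℤ-swap₀₁ : ∀ m (M : Mat (suc (suc m))) → detℤ (suc (suc m)) (λ i j → M (swap₀₁ i) j) ≡ ℤ.- detℤ (suc (suc m)) M
detℤ-swap₀₁ m M = trans (column-expansion (suc m) (λ i j → M (swap₀₁ i) j))
  (trans (cong₂ (λ y z → 1ℤ ℤ.* (M₁ ℤ.* y) ℤ.+ z) (detℤ-cong (suc m) (λ r s → cong (λ i → M i (suc s)) (row₀ r)))
           (cong₂ (λ y z → -1ℤ ℤ.* (M₀ ℤ.* y) ℤ.+ z) (detℤ-cong (suc m) (λ r s → cong (λ i → M i (suc s)) (row₁ r)))
             (others m M)))
  (trans (solve 5 (λ a b p q r → con 1ℤ :* (b :* q) :+ (con -1ℤ :* (a :* p) :+ (:- r)) := :- (con 1ℤ :* (a :* p) :+ (con -1ℤ :* (b :* q) :+ r))) refl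
           M₀ M₁ _ _ _)
  (cong ℤ.-_ (sym (column-expansion (suc m) M)))))
  where
  open ℤSolver.+-*-Solver
  M₀ M₁ : ℤ
  M₀ = M zero zero
  M₁ = M (suc zero) zero
  row₀ : ∀ {m} (r : Fin (suc m)) → swap₀₁ (suc r) ≡ punchIn (suc zero) r
  row₀ zero = refl
  row₀ (suc r) = refl
  row₁ : ∀ {m} (r : Fin (suc m)) → swap₀₁ (punchIn (suc zero) r) ≡ suc r
  row₁ zero = refl
  row₁ (suc r) = refl
  row₂ : ∀ {m} (i : Fin (suc m)) r → swap₀₁ (punchIn (suc (suc i)) r) ≡ punchIn (suc (suc i)) (swap₀₁ r)
  row₂ i zero = refl
  row₂ i (suc zero) = refl
  row₂ i (suc (suc r)) = refl
  others : ∀ m (M : Mat (suc (suc m))) →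
    ℤΣ.sum (λ i → sgn (toℕ (suc (suc i))) ℤ.* (M (suc (suc i)) zero ℤ.* detℤ (suc m) (λ r s → M (swap₀₁ (punchIn (suc (suc i)) r)) (suc s))))
    ≡ ℤ.- ℤΣ.sum (λ i → sgn (toℕ (suc (suc i))) ℤ.* (M (suc (suc i)) zero ℤ.* detℤ (suc m) (λ r s → M (punchIn (suc (suc i)) r) (suc s))))
  others zero M = refl
  others (suc m) M = trans (ℤΣ.sum-cong-≗ (λ i → trans
      (cong (λ z → sgn (toℕ (suc (suc i))) ℤ.* (M (suc (suc i)) zero ℤ.* z))
        (trans (detℤ-cong (suc (suc m)) (λ r s → cong (λ k → M k (suc s)) (row₂ i r)))
               (detℤ-swap₀₁ m (λ r s → M (punchIn (suc (suc i)) r) (suc s)))))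
      (solve 3 (λ s a d → s :* (a :* (:- d)) := con -1ℤ :* (s :* (a :* d))) refl (sgn (toℕ (suc (suc i)))) (M (suc (suc i)) zero) (D i))))
    (trans (sym (ℤΣ.*-distribˡ-sum -1ℤ (λ i → sgn (toℕ (suc (suc i))) ℤ.* (M (suc (suc i)) zero ℤ.* D i)))) (ℤₚ.-1*i≡-i _))
    where
    D : Fin (suc m) → ℤ
    D i = detℤ (suc (suc m)) (λ r s → M (punchIn (suc (suc i)) r) (suc s))

-- The cycle that brings index `v` to the top and keeps the order of the others. It is a product of
-- `v` swaps of neighbours, hence the sign (-1)^v below.
insert-at : ∀ {n} → Fin (suc n) → Fin (suc n) → Fin (suc n)
insert-at v zero = v
insert-at v (suc i) = punchIn v i

lift-index : ∀ {n} → (Fin n → Fin n) → Fin (suc n) → Fin (suc n)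
lift-index f zero = zero
lift-index f (suc i) = suc (f i)

detℤ-lift : ∀ m (f : Fin m → Fin m) ε → (∀ M → detℤ m (λ i j → M (f i) j) ≡ ε ℤ.* detℤ m M) →
  ∀ M → detℤ (suc m) (λ i j → M (lift-index f i) j) ≡ ε ℤ.* detℤ (suc m) M
detℤ-lift m f ε h M = trans (ℤΣ.sum-cong-≗ (λ j → trans
    (cong (λ z → sgn (toℕ j) ℤ.* (M zero j ℤ.* z)) (h (λ i k → M (suc i) (punchIn j k))))
    (solve 4 (λ s a e d → s :* (a :* (e :* d)) := e :* (s :* (a :* d))) refl (sgn (toℕ j)) (M zero j) ε (D j))))
  (sym (ℤΣ.*-distribˡ-sum ε (λ j → sgn (toℕ j) ℤ.* (M zero j ℤ.* D j))))
  where
  open ℤSolver.+-*-Solver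
  D : Fin (suc m) → ℤ
  D j = detℤ m (λ i k → M (suc i) (punchIn j k))

detℤ-insert-row : ∀ m v (M : Mat (suc m)) → detℤ (suc m) (λ i j → M (insert-at v i) j) ≡ sgn (toℕ v) ℤ.* detℤ (suc m) M
detℤ-insert-row m zero M = trans (detℤ-cong (suc m) (λ i j → cong (λ k → M k j) (eq i))) (sym (ℤₚ.*-identityˡ _))
  where
  eq : ∀ {n} (i : Fin (suc n)) → insert-at zero i ≡ i
  eq zero = refl
  eq (suc i) = refl
detℤ-insert-row (suc m) (suc v) M = begin
  detℤ (suc (suc m)) (λ i j → M (insert-at (suc v) i) j)
    ≡⟨ detℤ-cong (suc (suc m)) (λ i j → cong (λ k → M k j) (eq v i)) ⟩
  detℤ (suc (suc m)) (λ i j → M (lift-index (insert-at v) (swap₀₁ i)) j)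
    ≡⟨ detℤ-swap₀₁ m (λ i j → M (lift-index (insert-at v) i) j) ⟩
  ℤ.- detℤ (suc (suc m)) (λ i j → M (lift-index (insert-at v) i) j)
    ≡⟨ cong ℤ.-_ (detℤ-lift (suc m) (insert-at v) (sgn (toℕ v)) (detℤ-insert-row m v) M) ⟩
  ℤ.- (sgn (toℕ v) ℤ.* detℤ (suc (suc m)) M)
    ≡⟨ ℤₚ.neg-distribˡ-* (sgn (toℕ v)) (detℤ (suc (suc m)) M) ⟩
  (ℤ.- sgn (toℕ v)) ℤ.* detℤ (suc (suc m)) M ∎
  where
  open ≡-Reasoning
  eq : ∀ {n} (v : Fin (suc n)) i → insert-at (suc v) i ≡ lift-index (insert-at v) (swap₀₁ i)
  eq v zero = refl
  eq v (suc zero) = refl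
  eq v (suc (suc i)) = refl

sgn-square : ∀ k → sgn k ℤ.* sgn k ≡ 1ℤ
sgn-square zero = refl
sgn-square (suc k) = trans (solve 1 (λ s → (:- s) :* (:- s) := s :* s) refl (sgn k)) (sgn-square k)
  where open ℤSolver.+-*-Solver

cancel-sign : ∀ ε → ε ℤ.* ε ≡ 1ℤ → ∀ z → ε ℤ.* (ε ℤ.* z) ≡ z
cancel-sign ε h z = trans (sym (ℤₚ.*-assoc ε ε z)) (trans (cong (λ y → y ℤ.* z) h) (ℤₚ.*-identityˡ z))

row-expansion : ∀ m v (M : Mat (suc m)) → detℤ (suc m) M ≡
  sgn (toℕ v) ℤ.* ℤΣ.sum (λ j → sgn (toℕ j) ℤ.* (M v j ℤ.* detℤ m (λ i k → M (punchIn v i) (punchIn j k))))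
row-expansion m v M = trans (sym (cancel-sign (sgn (toℕ v)) (sgn-square (toℕ v)) (detℤ (suc m) M)))
  (cong (λ z → sgn (toℕ v) ℤ.* z) (sym (detℤ-insert-row m v M)))

-- Rows and columns contribute the same sign, and its square is 1.
detℤ-reindex : ∀ m (f : Fin m → Fin m) ε → ε ℤ.* ε ≡ 1ℤ → (∀ M → detℤ m (λ i j → M (f i) j) ≡ ε ℤ.* detℤ m M) →
  ∀ M → detℤ m (λ i j → M (f i) (f j)) ≡ detℤ m M
detℤ-reindex m f ε sq h M = begin
  detℤ m (λ i j → M (f i) (f j)) ≡⟨ h (λ i j → M i (f j)) ⟩
  ε ℤ.* detℤ m (λ i j → M i (f j)) ≡⟨ cong (λ z → ε ℤ.* z) (sym (detℤ-transpose m (λ i j → M i (f j)))) ⟩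
  ε ℤ.* detℤ m (λ i j → M j (f i)) ≡⟨ cong (λ z → ε ℤ.* z) (h (λ i j → M j i)) ⟩
  ε ℤ.* (ε ℤ.* detℤ m (λ i j → M j i)) ≡⟨ cancel-sign ε sq (detℤ m (λ i j → M j i)) ⟩
  detℤ m (λ i j → M j i) ≡⟨ detℤ-transpose m M ⟩
  detℤ m M ∎
  where open ≡-Reasoning

-- An injection of a finite set into itself splits into the cycle bringing `f zero` to the top and a
-- smaller injection on the remaining indices. Only the square of the sign matters later, because
-- rows and columns are permuted together.
injection-sign : ∀ m (f : Fin m → Fin m) → (∀ {i j} → f i ≡ f j → i ≡ j) →
  Σ[ ε ∈ ℤ ] (ε ℤ.* ε ≡ 1ℤ × (∀ M → detℤ m (λ i j → M (f i) j) ≡ ε ℤ.* detℤ m M))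
injection-sign zero f inj = 1ℤ , refl , λ M → refl
injection-sign (suc m) f inj = sgn (toℕ v) ℤ.* ε , square , rows
  where
  v : Fin (suc m)
  v = f zero
  v≢ : ∀ i → v ≢ f (suc i)
  v≢ i eq with inj eq
  ... | ()
  f′ : Fin m → Fin m
  f′ i = punchOut (v≢ i)
  f′-injective : ∀ {i j} → f′ i ≡ f′ j → i ≡ j
  f′-injective {i} {j} eq = Fₚ.suc-injective (inj (Fₚ.punchOut-injective (v≢ i) (v≢ j) eq))
  rec = injection-sign m f′ f′-injective
  ε : ℤ
  ε = proj₁ rec
  square : (sgn (toℕ v) ℤ.* ε) ℤ.* (sgn (toℕ v) ℤ.* ε) ≡ 1ℤ
  square = trans (solve 2 (λ s e → (s :* e) :* (s :* e) := (s :* s) :* (e :* e)) refl (sgn (toℕ v)) ε)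
    (cong₂ ℤ._*_ (sgn-square (toℕ v)) (proj₁ (proj₂ rec)))
    where open ℤSolver.+-*-Solver
  eq : ∀ i → f i ≡ insert-at v (lift-index f′ i)
  eq zero = refl
  eq (suc i) = sym (Fₚ.punchIn-punchOut (v≢ i))
  rows : ∀ M → detℤ (suc m) (λ i j → M (f i) j) ≡ (sgn (toℕ v) ℤ.* ε) ℤ.* detℤ (suc m) M
  rows M = begin
    detℤ (suc m) (λ i j → M (f i) j) ≡⟨ detℤ-cong (suc m) (λ i j → cong (λ k → M k j) (eq i)) ⟩
    detℤ (suc m) (λ i j → M (insert-at v (lift-index f′ i)) j)
      ≡⟨ detℤ-lift m f′ ε (proj₂ (proj₂ rec)) (λ i j → M (insert-at v i) j) ⟩
    ε ℤ.* detℤ (suc m) (λ i j → M (insert-at v i) j) ≡⟨ cong (λ z → ε ℤ.* z) (detℤ-insert-row m v M) ⟩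
    ε ℤ.* (sgn (toℕ v) ℤ.* detℤ (suc m) M)
      ≡⟨ solve 3 (λ e s d → e :* (s :* d) := (s :* e) :* d) refl ε (sgn (toℕ v)) _ ⟩
    (sgn (toℕ v) ℤ.* ε) ℤ.* detℤ (suc m) M ∎
    where
    open ≡-Reasoning
    open ℤSolver.+-*-Solver

detℤ-permute : ∀ m (f : Fin m → Fin m) → (∀ {i j} → f i ≡ f j → i ≡ j) →
  ∀ M → detℤ m (λ i j → M (f i) (f j)) ≡ detℤ m M
detℤ-permute m f inj with injection-sign m f inj
... | ε , sq , h = detℤ-reindex m f ε sq h

ℤsum-zero : ∀ n (f : Fin n → ℤ) → (∀ i → f i ≡ 0ℤ) → ℤΣ.sum f ≡ 0ℤ
ℤsum-zero n f h = trans (ℤΣ.sum-cong-≗ h) (ℤΣ.sum-replicate-zero n)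

ℤsum-single : ∀ n (u : Fin (suc n)) (f : Fin (suc n) → ℤ) → (∀ j → j ≢ u → f j ≡ 0ℤ) → ℤΣ.sum f ≡ f u
ℤsum-single n u f h = trans (ℤΣ.sum-remove {i = u} f)
  (trans (cong (λ z → f u ℤ.+ z) (ℤsum-zero n _ (λ i → h (punchIn u i) (Fₚ.punchInᵢ≢i u i)))) (ℤₚ.+-identityʳ _))

-- Row u + 1 of M is multiplied by M₀₀ and M_{u+1,0} times row 0 is subtracted; this clears column 0.
pivot₀ : ∀ n (M : Mat (suc (suc n))) (u : Fin (suc n)) (M′ : Mat (suc n)) →
  (∀ w → w ≢ u → M zero (suc w) ≡ 0ℤ) → (∀ w → w ≢ u → M (suc w) zero ≡ 0ℤ) →
  (∀ i j → i ≢ u → M′ i j ≡ M (suc i) (suc j)) →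
  (∀ j → j ≢ u → M′ u j ≡ M zero zero ℤ.* M (suc u) (suc j)) →
  M′ u u ≡ M zero zero ℤ.* M (suc u) (suc u) ℤ.- M (suc u) zero ℤ.* M zero (suc u) →
  detℤ (suc (suc n)) M ≡ detℤ (suc n) M′
pivot₀ n M u M′ row col rest off diag = trans expand-M (sym expand-M′)
  where
  open ≡-Reasoning
  open ℤSolver.+-*-Solver
  d a b D s : ℤ
  d = M zero zero
  a = M (suc u) zero
  b = M zero (suc u)
  D = detℤ n (λ r k → M (suc (punchIn u r)) (suc (punchIn u k)))
  s = sgn (toℕ u)
  N : Mat (suc n)
  N i j = M (suc i) (suc j)
  L : Fin (suc n) → ℤ
  L j = detℤ (suc n) (λ i k → M (suc i) (punchIn (suc j) k))
  m : Fin (suc n) → ℤ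
  m j = detℤ n (λ i k → N (punchIn u i) (punchIn j k))

  cofactor : detℤ (suc n) (λ i k → M (suc i) (punchIn (suc u) k)) ≡ s ℤ.* (a ℤ.* D)
  cofactor = trans (column-expansion n (λ i k → M (suc i) (punchIn (suc u) k)))
    (ℤsum-single n u (λ j → sgn (toℕ j) ℤ.* (M (suc j) zero ℤ.* K j)) (λ j j≢u → trans (cong (λ z → sgn (toℕ j) ℤ.* (z ℤ.* K j)) (col j j≢u))
      (ℤₚ.*-zeroʳ (sgn (toℕ j)))))
    where
    K : Fin (suc n) → ℤ
    K j = detℤ n (λ r k → M (suc (punchIn j r)) (suc (punchIn u k)))

  expand-M : detℤ (suc (suc n)) M ≡ d ℤ.* detℤ (suc n) N ℤ.- a ℤ.* b ℤ.* D
  expand-M = begin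
    detℤ (suc (suc n)) M
      ≡⟨ cong (λ z → 1ℤ ℤ.* (d ℤ.* detℤ (suc n) N) ℤ.+ z) (ℤsum-single n u (λ j → (ℤ.- sgn (toℕ j)) ℤ.* (M zero (suc j) ℤ.* L j))
           (λ j j≢u → trans (cong (λ z → (ℤ.- sgn (toℕ j)) ℤ.* (z ℤ.* L j)) (row j j≢u)) (ℤₚ.*-zeroʳ (ℤ.- sgn (toℕ j))))) ⟩
    1ℤ ℤ.* (d ℤ.* detℤ (suc n) N) ℤ.+ (ℤ.- s) ℤ.* (b ℤ.* detℤ (suc n) (λ i k → M (suc i) (punchIn (suc u) k)))
      ≡⟨ cong (λ z → 1ℤ ℤ.* (d ℤ.* detℤ (suc n) N) ℤ.+ (ℤ.- s) ℤ.* (b ℤ.* z)) cofactor ⟩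
    1ℤ ℤ.* (d ℤ.* detℤ (suc n) N) ℤ.+ (ℤ.- s) ℤ.* (b ℤ.* (s ℤ.* (a ℤ.* D)))
      ≡⟨ solve 6 (λ d e s a b D → con 1ℤ :* (d :* e) :+ (:- s) :* (b :* (s :* (a :* D))) := d :* e :- (s :* s) :* (a :* b :* D)) refl
           d (detℤ (suc n) N) s a b D ⟩
    d ℤ.* detℤ (suc n) N ℤ.- (s ℤ.* s) ℤ.* (a ℤ.* b ℤ.* D)
      ≡⟨ cong (λ z → d ℤ.* detℤ (suc n) N ℤ.- z ℤ.* (a ℤ.* b ℤ.* D)) (sgn-square (toℕ u)) ⟩
    d ℤ.* detℤ (suc n) N ℤ.- 1ℤ ℤ.* (a ℤ.* b ℤ.* D)
      ≡⟨ cong (λ z → d ℤ.* detℤ (suc n) N ℤ.- z) (ℤₚ.*-identityˡ _) ⟩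
    d ℤ.* detℤ (suc n) N ℤ.- a ℤ.* b ℤ.* D ∎

  -- Row `u` of `M′` is `d` times that of `N` except on the diagonal, where `a * b` is subtracted.
  -- `δ` isolates this term, so that the rest of the sum is a row expansion of `N`.
  δ : Fin (suc n) → ℤ
  δ j with j F.≟ u
  ... | yes _ = s ℤ.* (a ℤ.* b ℤ.* D)
  ... | no _ = 0ℤ
  δ-u : δ u ≡ s ℤ.* (a ℤ.* b ℤ.* D)
  δ-u with u F.≟ u
  ... | yes _ = refl
  ... | no u≢u = ⊥-elim (u≢u refl)
  δ-≢ : ∀ j → j ≢ u → δ j ≡ 0ℤ
  δ-≢ j j≢u with j F.≟ u
  ... | yes j≡u = ⊥-elim (j≢u j≡u)
  ... | no _ = refl

  term : ∀ j → sgn (toℕ j) ℤ.* (M′ u j ℤ.* detℤ n (λ i k → M′ (punchIn u i) (punchIn j k)))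
             ≡ d ℤ.* (sgn (toℕ j) ℤ.* (N u j ℤ.* m j)) ℤ.+ -1ℤ ℤ.* δ j
  term j = trans (cong (λ z → sgn (toℕ j) ℤ.* (M′ u j ℤ.* z))
             (detℤ-cong n (λ i k → rest (punchIn u i) (punchIn j k) (Fₚ.punchInᵢ≢i u i)))) (helper j)
    where
    helper : ∀ j → sgn (toℕ j) ℤ.* (M′ u j ℤ.* m j) ≡ d ℤ.* (sgn (toℕ j) ℤ.* (N u j ℤ.* m j)) ℤ.+ -1ℤ ℤ.* δ j
    helper j with j F.≟ u
    ... | yes refl = trans (cong (λ z → s ℤ.* (z ℤ.* D)) diag)
      (solve 6 (λ s d N a b D → s :* ((d :* N :- a :* b) :* D) := d :* (s :* (N :* D)) :+ con -1ℤ :* (s :* (a :* b :* D))) refl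
         s d (N u u) a b D)
    ... | no j≢u = trans (cong (λ z → sgn (toℕ j) ℤ.* (z ℤ.* m j)) (off j j≢u))
      (solve 4 (λ s d N m → s :* ((d :* N) :* m) := d :* (s :* (N :* m)) :+ con -1ℤ :* con 0ℤ) refl
         (sgn (toℕ j)) d (N u j) (m j))

  expand-M′ : detℤ (suc n) M′ ≡ d ℤ.* detℤ (suc n) N ℤ.- a ℤ.* b ℤ.* D
  expand-M′ = begin
    detℤ (suc n) M′ ≡⟨ row-expansion n u M′ ⟩
    s ℤ.* ℤΣ.sum (λ j → sgn (toℕ j) ℤ.* (M′ u j ℤ.* detℤ n (λ i k → M′ (punchIn u i) (punchIn j k))))
      ≡⟨ cong (λ z → s ℤ.* z) (ℤΣ.sum-cong-≗ term) ⟩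
    s ℤ.* ℤΣ.sum (λ j → d ℤ.* (sgn (toℕ j) ℤ.* (N u j ℤ.* m j)) ℤ.+ -1ℤ ℤ.* δ j)
      ≡⟨ cong (λ z → s ℤ.* z) (ℤΣ.∑-distrib-+ (λ j → d ℤ.* (sgn (toℕ j) ℤ.* (N u j ℤ.* m j))) (λ j → -1ℤ ℤ.* δ j)) ⟩
    s ℤ.* (ℤΣ.sum (λ j → d ℤ.* (sgn (toℕ j) ℤ.* (N u j ℤ.* m j))) ℤ.+ ℤΣ.sum (λ j → -1ℤ ℤ.* δ j))
      ≡⟨ cong₂ (λ y z → s ℤ.* (y ℤ.+ z)) (sym (ℤΣ.*-distribˡ-sum d (λ j → sgn (toℕ j) ℤ.* (N u j ℤ.* m j))))
           (trans (ℤsum-single n u (λ j → -1ℤ ℤ.* δ j) (λ j j≢u → cong (λ z → -1ℤ ℤ.* z) (δ-≢ j j≢u))) (cong (λ z → -1ℤ ℤ.* z) δ-u)) ⟩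
    s ℤ.* (d ℤ.* Σm ℤ.+ -1ℤ ℤ.* (s ℤ.* (a ℤ.* b ℤ.* D)))
      ≡⟨ solve 6 (λ s d S a b D → s :* (d :* S :+ con -1ℤ :* (s :* (a :* b :* D))) := d :* (s :* S) :- (s :* s) :* (a :* b :* D)) refl
           s d Σm a b D ⟩
    d ℤ.* (s ℤ.* Σm) ℤ.- (s ℤ.* s) ℤ.* (a ℤ.* b ℤ.* D)
      ≡⟨ cong₂ (λ y z → d ℤ.* y ℤ.- z ℤ.* (a ℤ.* b ℤ.* D)) (sym (row-expansion n u N)) (sgn-square (toℕ u)) ⟩
    d ℤ.* detℤ (suc n) N ℤ.- 1ℤ ℤ.* (a ℤ.* b ℤ.* D)
      ≡⟨ cong (λ z → d ℤ.* detℤ (suc n) N ℤ.- z) (ℤₚ.*-identityˡ _) ⟩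
    d ℤ.* detℤ (suc n) N ℤ.- a ℤ.* b ℤ.* D ∎
    where
    Σm : ℤ
    Σm = ℤΣ.sum (λ j → sgn (toℕ j) ℤ.* (N u j ℤ.* m j))

pivot : ∀ n (M : Mat (suc (suc n))) (v : Fin (suc (suc n))) (u : Fin (suc n)) (M′ : Mat (suc n)) →
  (∀ w → w ≢ u → M v (punchIn v w) ≡ 0ℤ) → (∀ w → w ≢ u → M (punchIn v w) v ≡ 0ℤ) →
  (∀ i j → i ≢ u → M′ i j ≡ M (punchIn v i) (punchIn v j)) →
  (∀ j → j ≢ u → M′ u j ≡ M v v ℤ.* M (punchIn v u) (punchIn v j)) →
  M′ u u ≡ M v v ℤ.* M (punchIn v u) (punchIn v u) ℤ.- M (punchIn v u) v ℤ.* M v (punchIn v u) →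
  detℤ (suc (suc n)) M ≡ detℤ (suc n) M′
pivot n M v u M′ row col rest off diag = trans
  (sym (detℤ-reindex (suc (suc n)) (insert-at v) (sgn (toℕ v)) (sgn-square (toℕ v)) (detℤ-insert-row (suc n) v) M))
  (pivot₀ n (λ i j → M (insert-at v i) (insert-at v j)) u M′ row col rest off diag)

-- Rooted trees and gathering of branches

infixl 6 _⋉_

-- t ⋉ c is t with the root of c attached to the root of t by a new edge.
data Tree (A : Set) : Set where
  leaf : A → Tree A
  _⋉_  : Tree A → Tree A → Tree A

root : Tree A → A
root (leaf a) = a
root (t ⋉ c) = root t

edges : Tree A → ℕ
edges (leaf a) = 0
edges (t ⋉ c) = suc (edges t + edges c)

-- rootedLeaves does not count the root; hungLeaves counts it when it is the only vertex.
rootedLeaves hungLeaves : Tree A → ℕ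
rootedLeaves (leaf a) = 0
rootedLeaves (t ⋉ c) = rootedLeaves t + hungLeaves c
hungLeaves (leaf a) = 1
hungLeaves (t ⋉ c) = rootedLeaves t + hungLeaves c

-- R t is det(xI + L(t)), Q t the same determinant with the root row and column deleted, and
-- P t the one with 1 added to the root's diagonal entry; R t / Q t is an effective conductance.
P Q R : Tree A → ℕ → ℕ
P t x = Q t x + R t x
Q (leaf a) x = 1
Q (t ⋉ c) x = Q t x * P c x
R (leaf a) x = x
R (t ⋉ c) x = R t x * P c x + Q t x * R c x

-- This is R - xQ, the determinant det(xI + L(t)) with the x in the root's diagonal entry replaced
-- by 0. When roots are identified, B / Q is additive, whereas R / Q would count the x of the common
-- vertex once for each tree.
B : Tree A → ℕ → ℕ
B (leaf a) x = 0
B (t ⋉ c) x = B t x * P c x + Q t x * R c x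

R-split : (t : Tree A) → ∀ x → R t x ≡ x * Q t x + B t x
R-split (leaf a) x = solve 1 (λ x → x := x :* con 1 :+ con 0) refl x
  where open +-*-Solver
R-split (t ⋉ c) x = trans (cong (λ z → z * P c x + Q t x * R c x) (R-split t x))
  (solve 5 (λ x q b p r → (x :* q :+ b) :* p :+ q :* r := x :* (q :* p) :+ (b :* p :+ q :* r)) refl x (Q t x) (B t x) (P c x) (R c x))
  where open +-*-Solver

Q-poly : (t : Tree A) → PolyFun (edges t) (Q t)
R-poly : (t : Tree A) → PolyFun (suc (edges t)) (R t)
P-poly : (t : Tree A) → PolyFun (suc (edges t)) (P t)
Q-poly (leaf a) = poly-const 1
Q-poly (t ⋉ c) = poly-≤ (ℕₚ.≤-reflexive (ℕₚ.+-suc (edges t) (edges c))) (poly-* (Q-poly t) (P-poly c))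
R-poly (leaf a) = poly-id
R-poly (t ⋉ c) = poly-+
  (poly-≤ (s≤s (ℕₚ.≤-reflexive (ℕₚ.+-suc (edges t) (edges c)))) (poly-* (R-poly t) (P-poly c)))
  (poly-≤ (ℕₚ.m≤n⇒m≤1+n (ℕₚ.≤-reflexive (ℕₚ.+-suc (edges t) (edges c)))) (poly-* (Q-poly t) (R-poly c)))
P-poly t = poly-+ (poly-≤ (ℕₚ.n≤1+n _) (Q-poly t)) (R-poly t)

B-poly : (t : Tree A) → PolyFun (edges t) (B t)
B-poly (leaf a) = poly-const 0
B-poly (t ⋉ c) = poly-≤ (ℕₚ.≤-reflexive (ℕₚ.+-suc (edges t) (edges c)))
  (poly-+ (poly-* (B-poly t) (P-poly c)) (poly-* (Q-poly t) (R-poly c)))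

is-Q : (t : Tree A) → IsPoly (Q t)
is-Q t = _ , Q-poly t
is-R : (t : Tree A) → IsPoly (R t)
is-R t = _ , R-poly t
is-P : (t : Tree A) → IsPoly (P t)
is-P t = _ , P-poly t
is-B : (t : Tree A) → IsPoly (B t)
is-B t = _ , B-poly t

*-positive : ∀ {m n} → 0 < m → 0 < n → 0 < m * n
*-positive = ℕₚ.*-mono-<

+-positiveˡ : ∀ {m} n → 0 < m → 0 < m + n
+-positiveˡ n h = ℕₚ.≤-trans h (ℕₚ.m≤m+n _ n)

+-positiveʳ : ∀ m {n} → 0 < n → 0 < m + n
+-positiveʳ m h = ℕₚ.≤-trans h (ℕₚ.m≤n+m _ m)

Q-positive : (t : Tree A) → 0 < Q t 1
Q-positive (leaf a) = s≤s z≤n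
Q-positive (t ⋉ c) = *-positive (Q-positive t) (+-positiveˡ (R c 1) (Q-positive c))

P-positive : (t : Tree A) → 0 < P t 1
P-positive t = +-positiveˡ (R t 1) (Q-positive t)

R-positive : (t : Tree A) → 0 < R t 1
R-positive (leaf a) = s≤s z≤n
R-positive (t ⋉ c) = +-positiveˡ (Q t 1 * R c 1) (*-positive (R-positive t) (P-positive c))

B-positive : (t c : Tree A) → 0 < B (t ⋉ c) 1
B-positive t c = +-positiveʳ (B t 1 * P c 1) (*-positive (Q-positive t) (R-positive c))

*-monoˡ-<′ : ∀ {m n} k → 0 < k → m < n → m * k < n * k
*-monoˡ-<′ (suc k) h = ℕₚ.*-monoˡ-< (suc k)

*-monoʳ-<′ : ∀ {m n} k → 0 < k → m < n → k * m < k * n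
*-monoʳ-<′ (suc k) h = ℕₚ.*-monoʳ-< (suc k)

-- Reductions and equality of invariants

infix 4 _◁_

-- Q and R of a larger tree are polynomials over ℕ in those of its parts, so a bound on both is
-- inherited by every surrounding tree. Both leaf counts are kept, since a host contributes
-- `rootedLeaves` and a branch `hungLeaves`. One strict inequality at 1 propagates because the
-- cofactors are positive there.
record _◁_ (t′ t : Tree A) : Set where
  constructor reduction
  field
    edges≡        : edges t′ ≡ edges t
    rootedLeaves≡ : rootedLeaves t′ ≡ rootedLeaves t
    hungLeaves≡   : hungLeaves t′ ≡ hungLeaves t
    Q⊑            : Q t′ ⊑ Q t
    R⊑            : R t′ ⊑ R t
    Q<            : Q t′ 1 < Q t 1
open _◁_ public

P⊑ : {t′ t : Tree A} → t′ ◁ t → P t′ ⊑ P t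
P⊑ r = ⊑-+ (Q⊑ r) (R⊑ r)

◁-host : {t′ t : Tree A} (c : Tree A) → t′ ◁ t → t′ ⋉ c ◁ t ⋉ c
◁-host c r = reduction
  (cong (λ z → suc (z + edges c)) (edges≡ r))
  (cong (λ z → z + hungLeaves c) (rootedLeaves≡ r))
  (cong (λ z → z + hungLeaves c) (rootedLeaves≡ r))
  (⊑-*ʳ (is-P c) (Q⊑ r))
  (⊑-+ (⊑-*ʳ (is-P c) (R⊑ r)) (⊑-*ʳ (is-R c) (Q⊑ r)))
  (*-monoˡ-<′ (P c 1) (P-positive c) (Q< r))

◁-branch : (t : Tree A) {c′ c : Tree A} → c′ ◁ c → t ⋉ c′ ◁ t ⋉ c
◁-branch t r = reduction
  (cong (λ z → suc (edges t + z)) (edges≡ r))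
  (cong (λ z → rootedLeaves t + z) (hungLeaves≡ r))
  (cong (λ z → rootedLeaves t + z) (hungLeaves≡ r))
  (⊑-*ˡ (is-Q t) (P⊑ r))
  (⊑-+ (⊑-*ˡ (is-R t) (P⊑ r)) (⊑-*ˡ (is-Q t) (R⊑ r)))
  (*-monoʳ-<′ (Q t 1) (Q-positive t) (ℕₚ.+-mono-<-≤ (Q< r) (⊑⇒≤ (R⊑ r) 1)))

infix 4 _≅_

-- Agreement of invariants, weaker than isomorphism, so that the label types may differ. `B` is
-- compared because `F` is written in Q and B, and R follows from these.
record _≅_ {A A′ : Set} (t′ : Tree A) (t : Tree A′) : Set where
  constructor sameInvariants
  field
    edges≅        : edges t′ ≡ edges t
    rootedLeaves≅ : rootedLeaves t′ ≡ rootedLeaves t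
    hungLeaves≅   : hungLeaves t′ ≡ hungLeaves t
    Q≅            : ∀ x → Q t′ x ≡ Q t x
    B≅            : ∀ x → B t′ x ≡ B t x
open _≅_ public

R≅ : {t′ : Tree A} {t : Tree A′} → t′ ≅ t → ∀ x → R t′ x ≡ R t x
R≅ {t′ = t′} {t} e x = trans (R-split t′ x) (trans (cong₂ (λ y z → x * y + z) (Q≅ e x) (B≅ e x)) (sym (R-split t x)))

P≅ : {t′ : Tree A} {t : Tree A′} → t′ ≅ t → ∀ x → P t′ x ≡ P t x
P≅ e x = cong₂ _+_ (Q≅ e x) (R≅ e x)

≅-refl : {t : Tree A} → t ≅ t
≅-refl = sameInvariants refl refl refl (λ x → refl) (λ x → refl)

≅-trans : {s : Tree A} {t : Tree A′} {u : Tree A″} → s ≅ t → t ≅ u → s ≅ u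
≅-trans e f = sameInvariants (trans (edges≅ e) (edges≅ f)) (trans (rootedLeaves≅ e) (rootedLeaves≅ f))
  (trans (hungLeaves≅ e) (hungLeaves≅ f)) (λ x → trans (Q≅ e x) (Q≅ f x)) (λ x → trans (B≅ e x) (B≅ f x))

≅-⋉ : {t′ c′ : Tree A} {t c : Tree A′} → t′ ≅ t → c′ ≅ c → t′ ⋉ c′ ≅ t ⋉ c
≅-⋉ e f = sameInvariants
  (cong₂ (λ y z → suc (y + z)) (edges≅ e) (edges≅ f))
  (cong₂ _+_ (rootedLeaves≅ e) (hungLeaves≅ f))
  (cong₂ _+_ (rootedLeaves≅ e) (hungLeaves≅ f))
  (λ x → cong₂ _*_ (Q≅ e x) (P≅ f x))
  (λ x → cong₂ _+_ (cong₂ _*_ (B≅ e x) (P≅ f x)) (cong₂ _*_ (Q≅ e x) (R≅ f x)))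

⋉-swap : (t c d : Tree A) → t ⋉ c ⋉ d ≅ t ⋉ d ⋉ c
⋉-swap t c d = sameInvariants
  (solve 3 (λ t c d → con 1 :+ ((con 1 :+ (t :+ c)) :+ d) := con 1 :+ ((con 1 :+ (t :+ d)) :+ c)) refl (edges t) (edges c) (edges d))
  leaves-swap leaves-swap
  (λ x → solve 3 (λ q c d → q :* c :* d := q :* d :* c) refl (Q t x) (P c x) (P d x))
  (λ x → solve 6 (λ q b pc rc pd rd → (b :* pc :+ q :* rc) :* pd :+ (q :* pc) :* rd := (b :* pd :+ q :* rd) :* pc :+ (q :* pd) :* rc)
           refl (Q t x) (B t x) (P c x) (R c x) (P d x) (R d x))
  where
  open +-*-Solver
  leaves-swap : rootedLeaves t + hungLeaves c + hungLeaves d ≡ rootedLeaves t + hungLeaves d + hungLeaves c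
  leaves-swap = solve 3 (λ t c d → t :+ c :+ d := t :+ d :+ c) refl (rootedLeaves t) (hungLeaves c) (hungLeaves d)

◁-≅ : {t′ t u : Tree A} → t′ ◁ t → t ≅ u → t′ ◁ u
◁-≅ r e = reduction (trans (edges≡ r) (edges≅ e)) (trans (rootedLeaves≡ r) (rootedLeaves≅ e))
  (trans (hungLeaves≡ r) (hungLeaves≅ e))
  (⊑-≗ (λ x → refl) (Q≅ e) (Q⊑ r)) (⊑-≗ (λ x → refl) (R≅ e) (R⊑ r)) (subst (_ <_) (Q≅ e 1) (Q< r))

stem : List A → Tree A → Tree A
stem [] t = t
stem (a ∷ as) t = leaf a ⋉ stem as t

◁-stem : (as : List A) {t′ t : Tree A} → t′ ◁ t → stem as t′ ◁ stem as t
◁-stem [] r = r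
◁-stem (a ∷ as) r = ◁-branch (leaf a) (◁-stem as r)

leaf-≅ : {a : A} {b : A′} → leaf a ≅ leaf b
leaf-≅ = sameInvariants refl refl refl (λ x → refl) (λ x → refl)

≅-stem : (as : List A) (bs : List A′) {t′ : Tree A} {t : Tree A′} → length as ≡ length bs → t′ ≅ t → stem as t′ ≅ stem bs t
≅-stem [] [] eq e = e
≅-stem (a ∷ as) (b ∷ bs) eq e = ≅-⋉ leaf-≅ (≅-stem as bs (ℕₚ.suc-injective eq) e)

edges-stem : (as : List A) (t : Tree A) → edges (stem as t) ≡ length as + edges t
edges-stem [] t = refl
edges-stem (a ∷ as) t = cong suc (edges-stem as t)

rootedLeaves-stem : (as : List A) (t c : Tree A) → rootedLeaves (stem as (t ⋉ c)) ≡ rootedLeaves t + hungLeaves c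
hungLeaves-stem : (as : List A) (t c : Tree A) → hungLeaves (stem as (t ⋉ c)) ≡ rootedLeaves t + hungLeaves c
rootedLeaves-stem [] t c = refl
rootedLeaves-stem (a ∷ as) t c = hungLeaves-stem as t c
hungLeaves-stem [] t c = refl
hungLeaves-stem (a ∷ as) t c = hungLeaves-stem as t c

-- A stem with d vertices acts on (P , R) by the matrix ((xβ + δ , β) , (xβ , δ)).
β δ : ℕ → ℕ → ℕ
β zero x = 0
β (suc d) x = (1 + x) * β d x + δ d x
δ zero x = 1
δ (suc d) x = x * β d x + δ d x

is-β : ∀ d → IsPoly (β d)
is-δ : ∀ d → IsPoly (δ d)
is-β zero = is-const 0
is-β (suc d) = is-+ (is-* (is-+ (is-const 1) is-id) (is-β d)) (is-δ d)
is-δ zero = is-const 1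
is-δ (suc d) = is-+ (is-* is-id (is-β d)) (is-δ d)

δ-positive : ∀ d → 0 < δ d 1
δ-positive zero = s≤s z≤n
δ-positive (suc d) = +-positiveʳ (1 * β d 1) (δ-positive d)

P-stem : (as : List A) (t : Tree A) → ∀ x → let d = length as in
  P (stem as t) x ≡ (x * β d x + δ d x) * P t x + β d x * R t x
R-stem : (as : List A) (t : Tree A) → ∀ x → let d = length as in
  R (stem as t) x ≡ x * β d x * P t x + δ d x * R t x
P-stem [] t x = solve 3 (λ x p r → p := (x :* con 0 :+ con 1) :* p :+ con 0 :* r) refl x (P t x) (R t x)
  where open +-*-Solver
P-stem (a ∷ as) t x = trans (cong₂ (λ p r → 1 * p + (x * p + 1 * r)) (P-stem as t x) (R-stem as t x))
  (solve 5 (λ x b d p r →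
     let P = (x :* b :+ d) :* p :+ b :* r ; R = x :* b :* p :+ d :* r ; b′ = (con 1 :+ x) :* b :+ d ; d′ = x :* b :+ d in
     con 1 :* P :+ (x :* P :+ con 1 :* R) := (x :* b′ :+ d′) :* p :+ b′ :* r) refl x (β (length as) x) (δ (length as) x) (P t x) (R t x))
  where open +-*-Solver
R-stem [] t x = solve 3 (λ x p r → r := x :* con 0 :* p :+ con 1 :* r) refl x (P t x) (R t x)
  where open +-*-Solver
R-stem (a ∷ as) t x = trans (cong₂ (λ p r → x * p + 1 * r) (P-stem as t x) (R-stem as t x))
  (solve 5 (λ x b d p r →
     let P = (x :* b :+ d) :* p :+ b :* r ; R = x :* b :* p :+ d :* r ; b′ = (con 1 :+ x) :* b :+ d ; d′ = x :* b :+ d in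
     x :* P :+ con 1 :* R := x :* b′ :* p :+ d′ :* r) refl x (β (length as) x) (δ (length as) x) (P t x) (R t x))
  where open +-*-Solver

merge : Tree A → Tree A → Tree A
merge t (leaf b) = t
merge t (u ⋉ c) = merge t u ⋉ c

Q-merge : (t u : Tree A) → ∀ x → Q (merge t u) x ≡ Q t x * Q u x
Q-merge t (leaf b) x = sym (ℕₚ.*-identityʳ _)
Q-merge t (u ⋉ c) x = trans (cong (_* P c x) (Q-merge t u x)) (ℕₚ.*-assoc (Q t x) (Q u x) (P c x))

B-merge : (t u : Tree A) → ∀ x → B (merge t u) x ≡ B t x * Q u x + Q t x * B u x
B-merge t (leaf b) x = solve 2 (λ b q → b := b :* con 1 :+ q :* con 0) refl (B t x) (Q t x)
  where open +-*-Solver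
B-merge t (u ⋉ c) x = trans (cong₂ (λ y z → y * P c x + z * R c x) (B-merge t u x) (Q-merge t u x))
  (solve 6 (λ qt bt qu bu p r → (bt :* qu :+ qt :* bu) :* p :+ qt :* qu :* r := bt :* (qu :* p) :+ qt :* (bu :* p :+ qu :* r))
     refl (Q t x) (B t x) (Q u x) (B u x) (P c x) (R c x))
  where open +-*-Solver

edges-merge : (t u : Tree A) → edges (merge t u) ≡ edges t + edges u
edges-merge t (leaf b) = sym (ℕₚ.+-identityʳ _)
edges-merge t (u ⋉ c) = trans (cong (λ z → suc (z + edges c)) (edges-merge t u))
  (solve 3 (λ t u c → con 1 :+ (t :+ u :+ c) := t :+ (con 1 :+ (u :+ c))) refl (edges t) (edges u) (edges c))
  where open +-*-Solver

rootedLeaves-merge : (t u : Tree A) → rootedLeaves (merge t u) ≡ rootedLeaves t + rootedLeaves u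
rootedLeaves-merge t (leaf b) = sym (ℕₚ.+-identityʳ _)
rootedLeaves-merge t (u ⋉ c) = trans (cong (_+ hungLeaves c) (rootedLeaves-merge t u))
  (ℕₚ.+-assoc (rootedLeaves t) (rootedLeaves u) (hungLeaves c))

infix 4 _≽_

-- The conductance R u / Q u dominates R y / Q y after cross-multiplication.
_≽_ : Tree A → Tree A → Set
u ≽ y = (λ x → Q u x * R y x) ⊑ (λ x → R u x * Q y x)

module Gather (Z V u y : Tree A) (as : List A) (a : A) (u≽y : u ≽ y) where

  -- Each of the two sources carries Z at one branch vertex and V at another; gathering both at the
  -- vertex next to u makes the linear terms smaller and removes the term bilinear in Z and V.
  gathered source₁ source₂ : Tree A
  gathered = merge Z V ⋉ u ⋉ stem as (leaf a ⋉ y)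
  source₁ = Z ⋉ u ⋉ stem as (V ⋉ y)
  source₂ = Z ⋉ y ⋉ stem as (V ⋉ u)

  private
    w : ℕ → ℕ
    w = proj₁ u≽y
    is-w : IsPoly w
    is-w = proj₁ (proj₂ u≽y)
    d : ℕ
    d = length as
    -- The action of the stem in terms of Q and R at its far end: P = α Q + κ R and R = γ Q + α R.
    α κ γ : ℕ → ℕ
    γ x = x * β d x
    α x = x * β d x + δ d x
    κ x = (x * β d x + δ d x) + β d x
    is-κ : IsPoly κ
    is-κ = is-+ (is-+ (is-* is-id (is-β d)) (is-δ d)) (is-β d)
    κ-positive : 0 < κ 1
    κ-positive = +-positiveˡ (β d 1) (+-positiveʳ (1 * β d 1) (δ-positive d))

    -- Adding R u * R y to both sides of the domination turns each Q into P, the form in which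
    -- branches enter a product.
    w-eq : ∀ x → P u x * R y x + w x ≡ R u x * P y x
    w-eq x = trans (solve 4 (λ qu ru ry w → (qu :+ ru) :* ry :+ w := (qu :* ry :+ w) :+ ru :* ry) refl (Q u x) (R u x) (R y x) (w x))
      (trans (cong (_+ R u x * R y x) (proj₂ (proj₂ u≽y) x))
        (sym (ℕₚ.*-distribˡ-+ (R u x) (Q y x) (R y x))))
      where open +-*-Solver

    -- Linear in Q V and B V: the coefficient of Q V belongs to the hub without V, and that of B V
    -- is the cost of having V there.
    P-hub : ∀ (V y : Tree A) x → P (stem as (V ⋉ y)) x ≡
      Q V x * (α x * P y x + κ x * (x * P y x + R y x)) + B V x * P y x * κ x
    P-hub V y x = trans (P-stem as (V ⋉ y) x) (trans
      (cong (λ r → α x * (Q V x * P y x + (r * P y x + Q V x * R y x)) + β d x * (r * P y x + Q V x * R y x)) (R-split V x))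
      (solve 7 (λ x q b p r al be → al :* (q :* p :+ ((x :* q :+ b) :* p :+ q :* r)) :+ be :* ((x :* q :+ b) :* p :+ q :* r)
         := q :* (al :* p :+ (al :+ be) :* (x :* p :+ r)) :+ b :* p :* (al :+ be))
         refl x (Q V x) (B V x) (P y x) (R y x) (α x) (β d x)))
      where open +-*-Solver

    R-hub : ∀ (V y : Tree A) x → R (stem as (V ⋉ y)) x ≡
      Q V x * (γ x * P y x + α x * (x * P y x + R y x)) + B V x * P y x * α x
    R-hub V y x = trans (R-stem as (V ⋉ y) x) (trans
      (cong (λ r → γ x * (Q V x * P y x + (r * P y x + Q V x * R y x)) + δ d x * (r * P y x + Q V x * R y x)) (R-split V x))
      (solve 7 (λ x q b p r ga de → ga :* (q :* p :+ ((x :* q :+ b) :* p :+ q :* r)) :+ de :* ((x :* q :+ b) :* p :+ q :* r)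
         := q :* (ga :* p :+ (ga :+ de) :* (x :* p :+ r)) :+ b :* p :* (ga :+ de))
         refl x (Q V x) (B V x) (P y x) (R y x) (γ x) (δ d x)))
      where open +-*-Solver

    Ph Rh : ℕ → ℕ
    Ph x = α x * P y x + κ x * (x * P y x + R y x)
    Rh x = γ x * P y x + α x * (x * P y x + R y x)

    Q-gathered : ∀ x → Q gathered x ≡ Q Z x * Q V x * P u x * Ph x
    Q-gathered x = cong₂ (λ q p → q * P u x * p) (Q-merge Z V x)
      (trans (P-hub (leaf a) y x) (solve 3 (λ p y k → con 1 :* p :+ con 0 :* y :* k := p) refl (Ph x) (P y x) (κ x)))
      where open +-*-Solver

    R-gathered : ∀ x → R gathered x ≡
      ((x * (Q Z x * Q V x) + (B Z x * Q V x + Q Z x * B V x)) * P u x + Q Z x * Q V x * R u x) * Ph x + Q Z x * Q V x * P u x * Rh x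
    R-gathered x = trans (cong₂ (λ p r → (R (merge Z V) x * P u x + Q (merge Z V) x * R u x) * p + Q (merge Z V) x * P u x * r)
        (trans (P-hub (leaf a) y x) (solve 3 (λ p y k → con 1 :* p :+ con 0 :* y :* k := p) refl (Ph x) (P y x) (κ x)))
        (trans (R-hub (leaf a) y x) (solve 3 (λ p y k → con 1 :* p :+ con 0 :* y :* k := p) refl (Rh x) (P y x) (α x))))
      (cong₂ (λ r q → (r * P u x + q * R u x) * Ph x + q * P u x * Rh x)
        (trans (R-split (merge Z V) x) (cong₂ (λ q b → x * q + b) (Q-merge Z V x) (B-merge Z V x)))
        (Q-merge Z V x))
      where open +-*-Solver

    edges-gathered : edges gathered ≡ suc (suc (edges Z + edges V + edges u) + (d + suc (edges y)))
    edges-gathered = cong₂ (λ m s → suc (suc (m + edges u) + s)) (edges-merge Z V) (edges-stem as (leaf a ⋉ y))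

    leaves-gathered : rootedLeaves gathered ≡ rootedLeaves Z + rootedLeaves V + hungLeaves u + hungLeaves y
    leaves-gathered = cong₂ (λ m s → m + hungLeaves u + s) (rootedLeaves-merge Z V) (hungLeaves-stem as (leaf a) y)

  Q-drop₁ Q-drop₂ : ℕ → ℕ
  Q-drop₁ x = Q Z x * P u x * B V x * P y x * κ x
  Q-drop₂ x = Q Z x * κ x * (Q V x * w x + B V x * P y x * P u x)

  -- V moves from the vertex next to y to the one next to u, where Z already is. The drop in Q is
  -- the term with B V. In R the term linear in B V leaves `w` behind, and the term with B Z * B V
  -- disappears.
  gather₁ : 0 < B V 1 → gathered ◁ source₁
  gather₁ BV>0 = reduction
    (trans edges-gathered (trans (solve 5 (λ z v u y d → con 1 :+ ((con 1 :+ (z :+ v :+ u)) :+ (d :+ (con 1 :+ y)))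
        := con 1 :+ ((con 1 :+ (z :+ u)) :+ (d :+ (con 1 :+ (v :+ y))))) refl (edges Z) (edges V) (edges u) (edges y) d)
      (cong (λ s → suc (suc (edges Z + edges u) + s)) (sym (edges-stem as (V ⋉ y))))))
    leaves-eq leaves-eq
    (Q-drop₁ , is-* (is-* (is-* (is-* (is-Q Z) (is-P u)) (is-B V)) (is-P y)) is-κ , Q-eq)
    (R-drop , is-+ (is-* (is-* (is-* (is-* (is-B Z) (is-P u)) (is-B V)) (is-P y)) is-κ) (is-* (is-* (is-* (is-Q Z) (is-B V)) is-κ) is-w) , R-eq)
    (subst (_<_ (Q gathered 1)) (Q-eq 1)
      (ℕₚ.m<m+n (Q gathered 1) (*-positive (*-positive (*-positive (*-positive (Q-positive Z) (P-positive u)) BV>0) (P-positive y)) κ-positive)))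
    where
    open +-*-Solver
    leaves-eq : rootedLeaves gathered ≡ rootedLeaves source₁
    leaves-eq = trans leaves-gathered (trans (solve 4 (λ z v u y → z :+ v :+ u :+ y := z :+ u :+ (v :+ y)) refl
        (rootedLeaves Z) (rootedLeaves V) (hungLeaves u) (hungLeaves y))
      (cong (λ s → rootedLeaves Z + hungLeaves u + s) (sym (hungLeaves-stem as V y))))
    R-drop : ℕ → ℕ
    R-drop x = B Z x * P u x * B V x * P y x * κ x + Q Z x * B V x * κ x * w x
    Q-eq : ∀ x → Q gathered x + Q-drop₁ x ≡ Q source₁ x
    Q-eq x = trans (cong (_+ Q-drop₁ x) (Q-gathered x))
      (trans (solve 7 (λ z v b u y k h → z :* v :* u :* h :+ z :* u :* b :* y :* k := z :* u :* (v :* h :+ b :* y :* k)) refl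
          (Q Z x) (Q V x) (B V x) (P u x) (P y x) (κ x) (Ph x))
        (cong (λ p → Q Z x * P u x * p) (sym (P-hub V y x))))
    R-eq : ∀ x → R gathered x + R-drop x ≡ R source₁ x
    -- Both sides receive the term with P u * R y; `w-eq` then accounts for R u * P y without a
    -- subtraction.
    R-eq x = sym (ℕₚ.+-cancelʳ-≡ (Q Z x * B V x * κ x * (P u x * R y x)) _ _ (begin
      R source₁ x + Q Z x * B V x * κ x * (P u x * R y x)
        ≡⟨ cong (_+ Q Z x * B V x * κ x * (P u x * R y x)) (trans
             (cong₂ (λ p r → (R Z x * P u x + Q Z x * R u x) * p + Q Z x * P u x * r) (P-hub V y x) (R-hub V y x))
             (cong (λ z → (z * P u x + Q Z x * R u x) * (Q V x * Ph x + B V x * P y x * κ x) + Q Z x * P u x * (Q V x * Rh x + B V x * P y x * α x)) (R-split Z x))) ⟩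
      ((x * Q Z x + B Z x) * P u x + Q Z x * R u x) * (Q V x * Ph x + B V x * P y x * κ x) + Q Z x * P u x * (Q V x * Rh x + B V x * P y x * α x)
        + Q Z x * B V x * κ x * (P u x * R y x)
        ≡⟨ solve 12 (λ x qz bz qv bv pu ru py ry k al rh → let ph = al :* py :+ k :* (x :* py :+ ry) in
             ((x :* qz :+ bz) :* pu :+ qz :* ru) :* (qv :* ph :+ bv :* py :* k) :+ qz :* pu :* (qv :* rh :+ bv :* py :* al) :+ qz :* bv :* k :* (pu :* ry)
             := ((x :* (qz :* qv) :+ (bz :* qv :+ qz :* bv)) :* pu :+ qz :* qv :* ru) :* ph :+ qz :* qv :* pu :* rh
                :+ bz :* pu :* bv :* py :* k :+ qz :* bv :* k :* (ru :* py)) refl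
             x (Q Z x) (B Z x) (Q V x) (B V x) (P u x) (R u x) (P y x) (R y x) (κ x) (α x) (Rh x) ⟩
      G + B Z x * P u x * B V x * P y x * κ x + Q Z x * B V x * κ x * (R u x * P y x)
        ≡⟨ cong₂ (λ g z → g + B Z x * P u x * B V x * P y x * κ x + Q Z x * B V x * κ x * z) (sym (R-gathered x)) (sym (w-eq x)) ⟩
      R gathered x + B Z x * P u x * B V x * P y x * κ x + Q Z x * B V x * κ x * (P u x * R y x + w x)
        ≡⟨ solve 5 (λ g e k m w → g :+ e :+ k :* (m :+ w) := g :+ (e :+ k :* w) :+ k :* m) refl
             (R gathered x) (B Z x * P u x * B V x * P y x * κ x) (Q Z x * B V x * κ x) (P u x * R y x) (w x) ⟩
      R gathered x + R-drop x + Q Z x * B V x * κ x * (P u x * R y x) ∎))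
      where
      open ≡-Reasoning
      G : ℕ
      G = ((x * (Q Z x * Q V x) + (B Z x * Q V x + Q Z x * B V x)) * P u x + Q Z x * Q V x * R u x) * Ph x + Q Z x * Q V x * P u x * Rh x

  -- Seen from the root, u and V come over to Z, and y takes their place at the far end. Every drop
  -- in R has the factor B Z, because for trivial Z the two trees differ only in the choice of the
  -- root. The hypothesis admits a trivial V, for which strictness rests on `w` at 1.
  gather₂ : 0 < Q V 1 * w 1 + B V 1 * P y 1 * P u 1 → gathered ◁ source₂
  gather₂ drop>0 = reduction
    (trans edges-gathered (trans (solve 5 (λ z v u y d → con 1 :+ ((con 1 :+ (z :+ v :+ u)) :+ (d :+ (con 1 :+ y)))
        := con 1 :+ ((con 1 :+ (z :+ y)) :+ (d :+ (con 1 :+ (v :+ u))))) refl (edges Z) (edges V) (edges u) (edges y) d)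
      (cong (λ s → suc (suc (edges Z + edges y) + s)) (sym (edges-stem as (V ⋉ u))))))
    leaves-eq leaves-eq
    (Q-drop₂ , is-* (is-* (is-Q Z) is-κ) is-drop , Q-eq)
    ((λ x → B Z x * κ x * (Q V x * w x + B V x * P y x * P u x)) , is-* (is-* (is-B Z) is-κ) is-drop , R-eq)
    (subst (_<_ (Q gathered 1)) (Q-eq 1) (ℕₚ.m<m+n (Q gathered 1) (*-positive (*-positive (Q-positive Z) κ-positive) drop>0)))
    where
    open +-*-Solver
    is-drop : IsPoly (λ x → Q V x * w x + B V x * P y x * P u x)
    is-drop = is-+ (is-* (is-Q V) is-w) (is-* (is-* (is-B V) (is-P y)) (is-P u))
    leaves-eq : rootedLeaves gathered ≡ rootedLeaves source₂
    leaves-eq = trans leaves-gathered (trans (solve 4 (λ z v u y → z :+ v :+ u :+ y := z :+ y :+ (v :+ u)) refl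
        (rootedLeaves Z) (rootedLeaves V) (hungLeaves u) (hungLeaves y))
      (cong (λ s → rootedLeaves Z + hungLeaves y + s) (sym (hungLeaves-stem as V u))))
    Ph′ Rh′ : ℕ → ℕ
    Ph′ x = α x * P u x + κ x * (x * P u x + R u x)
    Rh′ x = γ x * P u x + α x * (x * P u x + R u x)
    Q-eq : ∀ x → Q gathered x + Q-drop₂ x ≡ Q source₂ x
    Q-eq x = sym (ℕₚ.+-cancelʳ-≡ (Q Z x * Q V x * κ x * (P u x * R y x)) _ _ (begin
      Q source₂ x + Q Z x * Q V x * κ x * (P u x * R y x)
        ≡⟨ cong (λ p → Q Z x * P y x * p + Q Z x * Q V x * κ x * (P u x * R y x)) (P-hub V u x) ⟩
      Q Z x * P y x * (Q V x * Ph′ x + B V x * P u x * κ x) + Q Z x * Q V x * κ x * (P u x * R y x)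
        ≡⟨ solve 10 (λ x qz qv bv pu ru py ry k al →
             qz :* py :* (qv :* (al :* pu :+ k :* (x :* pu :+ ru)) :+ bv :* pu :* k) :+ qz :* qv :* k :* (pu :* ry)
             := qz :* qv :* pu :* (al :* py :+ k :* (x :* py :+ ry)) :+ (qz :* k :* (bv :* py :* pu) :+ qz :* qv :* k :* (ru :* py))) refl
             x (Q Z x) (Q V x) (B V x) (P u x) (R u x) (P y x) (R y x) (κ x) (α x) ⟩
      Q Z x * Q V x * P u x * Ph x + (Q Z x * κ x * (B V x * P y x * P u x) + Q Z x * Q V x * κ x * (R u x * P y x))
        ≡⟨ cong₂ (λ g z → g + (Q Z x * κ x * (B V x * P y x * P u x) + Q Z x * Q V x * κ x * z)) (sym (Q-gathered x)) (sym (w-eq x)) ⟩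
      Q gathered x + (Q Z x * κ x * (B V x * P y x * P u x) + Q Z x * Q V x * κ x * (P u x * R y x + w x))
        ≡⟨ solve 7 (λ g z v k e m w → g :+ (z :* k :* e :+ z :* v :* k :* (m :+ w)) := g :+ z :* k :* (v :* w :+ e) :+ z :* v :* k :* m) refl
             (Q gathered x) (Q Z x) (Q V x) (κ x) (B V x * P y x * P u x) (P u x * R y x) (w x) ⟩
      Q gathered x + Q-drop₂ x + Q Z x * Q V x * κ x * (P u x * R y x) ∎))
      where open ≡-Reasoning
    R-eq : ∀ x → R gathered x + B Z x * κ x * (Q V x * w x + B V x * P y x * P u x) ≡ R source₂ x
    R-eq x = sym (ℕₚ.+-cancelʳ-≡ (B Z x * Q V x * κ x * (P u x * R y x) + x * Q Z x * Q V x * κ x * (R u x * P y x)) _ _ (begin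
      R source₂ x + (B Z x * Q V x * κ x * (P u x * R y x) + x * Q Z x * Q V x * κ x * (R u x * P y x))
        ≡⟨ cong (_+ (B Z x * Q V x * κ x * (P u x * R y x) + x * Q Z x * Q V x * κ x * (R u x * P y x))) (trans
             (cong₂ (λ p r → (R Z x * P y x + Q Z x * R y x) * p + Q Z x * P y x * r) (P-hub V u x) (R-hub V u x))
             (cong (λ z → (z * P y x + Q Z x * R y x) * (Q V x * Ph′ x + B V x * P u x * κ x) + Q Z x * P y x * (Q V x * Rh′ x + B V x * P u x * α x)) (R-split Z x))) ⟩
      ((x * Q Z x + B Z x) * P y x + Q Z x * R y x) * (Q V x * Ph′ x + B V x * P u x * κ x) + Q Z x * P y x * (Q V x * Rh′ x + B V x * P u x * α x)
        + (B Z x * Q V x * κ x * (P u x * R y x) + x * Q Z x * Q V x * κ x * (R u x * P y x))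
        ≡⟨ solve 12 (λ x qz bz qv bv pu ru py ry k al ga →
             let ph = al :* py :+ k :* (x :* py :+ ry) ; rh = ga :* py :+ al :* (x :* py :+ ry)
                 ph′ = al :* pu :+ k :* (x :* pu :+ ru) ; rh′ = ga :* pu :+ al :* (x :* pu :+ ru) in
             ((x :* qz :+ bz) :* py :+ qz :* ry) :* (qv :* ph′ :+ bv :* pu :* k) :+ qz :* py :* (qv :* rh′ :+ bv :* pu :* al)
               :+ (bz :* qv :* k :* (pu :* ry) :+ x :* qz :* qv :* k :* (ru :* py))
             := ((x :* (qz :* qv) :+ (bz :* qv :+ qz :* bv)) :* pu :+ qz :* qv :* ru) :* ph :+ qz :* qv :* pu :* rh
                :+ (bz :* k :* (bv :* py :* pu) :+ bz :* qv :* k :* (ru :* py)) :+ x :* qz :* qv :* k :* (ru :* py)) refl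
             x (Q Z x) (B Z x) (Q V x) (B V x) (P u x) (R u x) (P y x) (R y x) (κ x) (α x) (γ x) ⟩
      G + (B Z x * κ x * (B V x * P y x * P u x) + B Z x * Q V x * κ x * (R u x * P y x)) + X
        ≡⟨ cong₂ (λ g z → g + (B Z x * κ x * (B V x * P y x * P u x) + B Z x * Q V x * κ x * z) + X) (sym (R-gathered x)) (sym (w-eq x)) ⟩
      R gathered x + (B Z x * κ x * (B V x * P y x * P u x) + B Z x * Q V x * κ x * (P u x * R y x + w x)) + X
        ≡⟨ solve 8 (λ g z v k e m w X → g :+ (z :* k :* e :+ z :* v :* k :* (m :+ w)) :+ X := g :+ z :* k :* (v :* w :+ e) :+ (z :* v :* k :* m :+ X)) refl
             (R gathered x) (B Z x) (Q V x) (κ x) (B V x * P y x * P u x) (P u x * R y x) (w x) X ⟩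
      R gathered x + B Z x * κ x * (Q V x * w x + B V x * P y x * P u x) + (B Z x * Q V x * κ x * (P u x * R y x) + X) ∎))
      where
      open ≡-Reasoning
      X G : ℕ
      X = x * Q Z x * Q V x * κ x * (R u x * P y x)
      G = ((x * (Q Z x * Q V x) + (B Z x * Q V x + Q Z x * B V x)) * P u x + Q Z x * Q V x * R u x) * Ph x + Q Z x * Q V x * P u x * Rh x

-- Paths, brooms and the shape of a tree

Leg : Set → Set
Leg A = A × List A

nodes : Leg A → ℕ
nodes (a , bs) = suc (length bs)

path : A → List A → Tree A
path a [] = leaf a
path a (b ∷ bs) = leaf a ⋉ path b bs

legs : A → List (Leg A) → Tree A
legs v [] = leaf v
legs v ((a , bs) ∷ Ls) = legs v Ls ⋉ path a bs

-- A lower bound on the height along the branch attached last, which is the one to follow in paths,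
-- stems and legs.
data Tall {A : Set} : Tree A → ℕ → Set where
  tall-zero : ∀ {t} → Tall t 0
  tall-suc  : ∀ {t c k} → Tall c k → Tall (t ⋉ c) (suc k)

tall-path : (a : A) (bs : List A) → Tall (path a bs) (length bs)
tall-path a [] = tall-zero
tall-path a (b ∷ bs) = tall-suc (tall-path b bs)

tall-stem : (as : List A) {t : Tree A} {k : ℕ} → Tall t k → Tall (stem as t) (length as + k)
tall-stem [] h = h
tall-stem (a ∷ as) h = tall-suc (tall-stem as h)

tall-≤ : {t : Tree A} {j k : ℕ} → j ≤ k → Tall t k → Tall t j
tall-≤ z≤n h = tall-zero
tall-≤ (s≤s le) (tall-suc h) = tall-suc (tall-≤ le h)

-- Rayleigh monotonicity, coefficient by coefficient: a tree conducts at least as well as a path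
-- from its root that it contains. An edge put in series preserves domination, and the other
-- branches at the root add the term with B t.
tall-≽-path : {u : Tree A} (a : A) (bs : List A) → Tall u (length bs) → u ≽ path a bs
tall-≽-path {u = u} a [] h = B u , is-B u , λ x →
  trans (solve 3 (λ x q b → q :* x :+ b := (x :* q :+ b) :* con 1) refl x (Q u x) (B u x))
        (cong (_* 1) (sym (R-split u x)))
  where open +-*-Solver
tall-≽-path a (b ∷ bs) (tall-suc {t} {c} h) with tall-≽-path b bs h
... | w , is-w , eq =
  (λ x → B t x * P c x * P y x + Q t x * w x) , is-+ (is-* (is-* (is-B t) (is-P c)) (is-P y)) (is-* (is-Q t) is-w) , λ x →
  let open ≡-Reasoning in begin
  Q t x * P c x * (x * P y x + 1 * R y x) + (B t x * P c x * P y x + Q t x * w x)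
    ≡⟨ solve 8 (λ x qt bt qc rc qy ry w → qt :* (qc :+ rc) :* (x :* (qy :+ ry) :+ con 1 :* ry) :+ (bt :* (qc :+ rc) :* (qy :+ ry) :+ qt :* w)
        := (x :* qt :+ bt) :* (qc :+ rc) :* (con 1 :* (qy :+ ry)) :+ qt :* (qc :* ry :+ w) :+ qt :* (rc :* ry)) refl
        x (Q t x) (B t x) (Q c x) (R c x) (Q y x) (R y x) (w x) ⟩
  (x * Q t x + B t x) * P c x * (1 * P y x) + Q t x * (Q c x * R y x + w x) + Q t x * (R c x * R y x)
    ≡⟨ cong₂ (λ r z → r * P c x * (1 * P y x) + Q t x * z + Q t x * (R c x * R y x)) (sym (R-split t x)) (eq x) ⟩
  R t x * P c x * (1 * P y x) + Q t x * (R c x * Q y x) + Q t x * (R c x * R y x)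
    ≡⟨ solve 6 (λ rt pc qt rc qy ry → rt :* pc :* (con 1 :* (qy :+ ry)) :+ qt :* (rc :* qy) :+ qt :* (rc :* ry)
        := (rt :* pc :+ qt :* rc) :* (con 1 :* (qy :+ ry))) refl (R t x) (P c x) (Q t x) (R c x) (Q y x) (R y x) ⟩
  (R t x * P c x + Q t x * R c x) * (1 * P y x) ∎
  where
  open +-*-Solver
  y = path b bs

-- In terms of the two paths without their first vertices, both sides are one common expression plus
-- one of the products compared by induction.
longer-path : (a : A) (bs : List A) (c : A) (ds : List A) → length bs < length ds →
  Q (path c ds) 1 * R (path a bs) 1 < R (path c ds) 1 * Q (path a bs) 1
longer-path a [] c (d ∷ ds) lt = subst (1 * P y 1 * 1 <_)
  (solve 2 (λ p r → con 1 :* p :* con 1 :+ r := (con 1 :* p :+ con 1 :* r) :* con 1) refl (P y 1) (R y 1))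
  (ℕₚ.m<m+n (1 * P y 1 * 1) (R-positive y))
  where
  open +-*-Solver
  y = path d ds
longer-path a (b ∷ bs) c (d ∷ ds) (s≤s lt) = subst₂ _<_
  (solve 4 (λ qu ru qy ry → (qu :* qy :+ qu :* ry :+ ru :* qy :+ con 2 :* ru :* ry) :+ qu :* ry
      := con 1 :* (qu :+ ru) :* (con 1 :* (qy :+ ry) :+ con 1 :* ry)) refl (Q u 1) (R u 1) (Q y 1) (R y 1))
  (solve 4 (λ qu ru qy ry → (qu :* qy :+ qu :* ry :+ ru :* qy :+ con 2 :* ru :* ry) :+ ru :* qy
      := (con 1 :* (qu :+ ru) :+ con 1 :* ru) :* (con 1 :* (qy :+ ry))) refl (Q u 1) (R u 1) (Q y 1) (R y 1))
  (ℕₚ.+-monoʳ-< (Q u 1 * Q y 1 + Q u 1 * R y 1 + R u 1 * Q y 1 + 2 * R u 1 * R y 1) (longer-path b bs d ds lt))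
  where
  open +-*-Solver
  u = path d ds
  y = path b bs

≅-path : (a : A) (bs : List A) (c : A′) (ds : List A′) → length bs ≡ length ds → path a bs ≅ path c ds
≅-path a [] c [] eq = leaf-≅
≅-path a (b ∷ bs) c (d ∷ ds) eq = ≅-⋉ leaf-≅ (≅-path b bs d ds (ℕₚ.suc-injective eq))

-- Trees to which gathering applies

Reducible : Tree A → Set
Reducible t = ∃[ t′ ] t′ ◁ t

reducible-≅ : {t u : Tree A} → t ≅ u → Reducible t → Reducible u
reducible-≅ e (t′ , r) = t′ , ◁-≅ r e

-- Of the leg `b`, `bs` and the leg `l` at the hub, the longer plays the role of `u`, and everything
-- is gathered beside it. The second leg `l′` at the hub makes B V positive.
fork-reducible : (Z : Tree A) (b : A) (bs as : List A) (v : A) (l l′ : Leg A) (Ls : List (Leg A)) →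
  Reducible (Z ⋉ path b bs ⋉ stem as (legs v (l ∷ l′ ∷ Ls)))
fork-reducible Z b bs as v (a , ls) (a′ , ls′) Ls with ℕₚ.≤-total (length ls) (length bs)
... | inj₁ le = gathered , gather₁ (B-positive (legs v Ls) (path a′ ls′))
  where open Gather Z (legs v ((a′ , ls′) ∷ Ls)) (path b bs) (path a ls) as v (tall-≽-path a ls (tall-≤ le (tall-path b bs)))
... | inj₂ le = gathered , gather₂ (+-positiveʳ (Q V 1 * _)
    (*-positive (*-positive (B-positive (legs v Ls) (path a′ ls′)) (P-positive (path b bs))) (P-positive (path a ls))))
  where
  V = legs v ((a′ , ls′) ∷ Ls)
  open Gather Z V (path a ls) (path b bs) as v (tall-≽-path b bs (tall-≤ le (tall-path a ls)))

-- Here `u` is a whole broom and `y` a leg of the other one. Taking `y` from the broom whose first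
-- leg is shorter ensures that `u` contains a path at least as long; the other legs of that broom
-- then move to the root.
two-brooms-reducible : (a : A) (as : List A) (v : A) (l l′ : Leg A) (Ls : List (Leg A))
  (as′ : List A) (v′ : A) (m m′ : Leg A) (Ms : List (Leg A)) →
  Reducible (leaf a ⋉ stem as (legs v (l ∷ l′ ∷ Ls)) ⋉ stem as′ (legs v′ (m ∷ m′ ∷ Ms)))
two-brooms-reducible a as v (b , bs) l′ Ls as′ v′ (c , cs) m′ Ms with ℕₚ.≤-total (length bs) (length cs)
... | inj₁ le = reducible-≅ (⋉-swap (leaf a) _ _) (gathered , gather₁ (B-positive (legs v Ls) (path (proj₁ l′) (proj₂ l′))))
  where
  open Gather (leaf a) (legs v (l′ ∷ Ls)) (stem as′ (legs v′ ((c , cs) ∷ m′ ∷ Ms))) (path b bs) as v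
    (tall-≽-path b bs (tall-≤ (ℕₚ.≤-trans (ℕₚ.m≤n⇒m≤1+n le) (ℕₚ.m≤n+m _ (length as′))) (tall-stem as′ (tall-suc (tall-path c cs)))))
... | inj₂ le = gathered , gather₁ (B-positive (legs v′ Ms) (path (proj₁ m′) (proj₂ m′)))
  where
  open Gather (leaf a) (legs v′ (m′ ∷ Ms)) (stem as (legs v ((b , bs) ∷ l′ ∷ Ls))) (path c cs) as′ v
    (tall-≽-path c cs (tall-≤ (ℕₚ.≤-trans (ℕₚ.m≤n⇒m≤1+n le) (ℕₚ.m≤n+m _ (length as))) (tall-stem as (tall-suc (tall-path b bs)))))

-- When the search finds nothing to gather, there is at most one branching point: the tree is a path
-- from its root or a stem ending in at least two legs. A broom may still be reducible by balancing.
data Shape {A : Set} : Tree A → Set where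
  is-path      : ∀ a bs → Shape (path a bs)
  is-broom     : ∀ as v l l′ Ls → Shape (stem as (legs v (l ∷ l′ ∷ Ls)))
  is-reducible : ∀ {t} → Reducible t → Shape t

shape : (t : Tree A) → Shape t
shape (leaf a) = is-path a []
shape (t ⋉ c) with shape t | shape c
... | is-reducible (t′ , r) | _ = is-reducible (t′ ⋉ c , ◁-host c r)
... | is-path _ _ | is-reducible (c′ , r) = is-reducible (t ⋉ c′ , ◁-branch t r)
... | is-broom _ _ _ _ _ | is-reducible (c′ , r) = is-reducible (t ⋉ c′ , ◁-branch t r)
... | is-path a [] | is-path b bs = is-path a (b ∷ bs)
... | is-path a [] | is-broom as v l l′ Ls = is-broom (a ∷ as) v l l′ Ls
... | is-path a (b ∷ bs) | is-path d ds = is-broom [] a (d , ds) (b , bs) []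
... | is-path a (b ∷ bs) | is-broom as v l l′ Ls = is-reducible (fork-reducible (leaf a) b bs as v l l′ Ls)
... | is-broom [] w (k , ks) k′ Ks | is-path d ds = is-broom [] w (d , ds) (k , ks) (k′ ∷ Ks)
... | is-broom [] w (k , ks) k′ Ks | is-broom as v l l′ Ls = is-reducible (fork-reducible (legs w (k′ ∷ Ks)) k ks as v l l′ Ls)
... | is-broom (a ∷ as) w k k′ Ks | is-path d ds =
  is-reducible (reducible-≅ (⋉-swap (leaf a) (path d ds) _) (fork-reducible (leaf a) d ds as w k k′ Ks))
... | is-broom (a ∷ as) w k k′ Ks | is-broom as′ v l l′ Ls =
  is-reducible (two-brooms-reducible a as w k k′ Ks as′ v l l′ Ls)

legs-↭ : (v : A) {Ls Ms : List (Leg A)} → Ls ↭ Ms → legs v Ls ≅ legs v Ms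
legs-↭ v ↭.refl = ≅-refl
legs-↭ v (↭.prep l p) = ≅-⋉ (legs-↭ v p) ≅-refl
legs-↭ v (↭.swap {xs = Ls} (a , as) (b , bs) p) =
  ≅-trans (⋉-swap (legs v Ls) (path b bs) (path a as)) (≅-⋉ (≅-⋉ (legs-↭ v p) ≅-refl) ≅-refl)
legs-↭ v (↭.trans p q) = ≅-trans (legs-↭ v p) (legs-↭ v q)

-- One vertex passes from the longer leg to the shorter. The vertex `b` next to the centre acts as
-- the second hub with trivial V, and gathering exchanges the rest of the long leg with the short
-- one. As B V is 0, strictness comes from the difference of the lengths.
unbalanced-reducible : (v a b : A) (as bs : List A) (Ls : List (Leg A)) → 2 + length as ≤ length bs →
  Reducible (legs v ((b , bs) ∷ (a , as) ∷ Ls))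
unbalanced-reducible v a b as (b′ ∷ bs) Ls (s≤s lt) = gathered , gather₂
  (+-positiveˡ _ (ℕₚ.<-≤-trans w>0 (ℕₚ.≤-reflexive (sym (ℕₚ.*-identityˡ _)))))
  where
  dom = tall-≽-path a as (tall-≤ (ℕₚ.<⇒≤ lt) (tall-path b′ bs))
  open Gather (legs v Ls) (leaf b) (path b′ bs) (path a as) [] v dom
  w>0 : 0 < proj₁ dom 1
  w>0 = ℕₚ.+-cancelˡ-< (Q (path b′ bs) 1 * R (path a as) 1) 0 _
    (subst₂ _<_ (sym (ℕₚ.+-identityʳ _)) (sym (proj₂ (proj₂ dom) 1)) (longer-path a as b′ bs lt))

-- Length 0 adds nothing, in agreement with `armEdges`, so that lists of arm lengths may contain
-- zeros.
addLeg : Tree ⊤ → ℕ → Tree ⊤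
addLeg t zero = t
addLeg t (suc k) = t ⋉ path tt (replicate k tt)

spider : ℕ → List ℕ → Tree ⊤
spider q ns = stem (replicate q tt) (foldr (λ k t → addLeg t k) (leaf tt) ns)

legs-≅-spider : (v : A) (Ls : List (Leg A)) → legs v Ls ≅ foldr (λ k t → addLeg t k) (leaf tt) (map nodes Ls)
legs-≅-spider v [] = leaf-≅
legs-≅-spider v ((a , bs) ∷ Ls) = ≅-⋉ (legs-≅-spider v Ls) (≅-path a bs tt _ (sym (Lₚ.length-replicate (length bs))))

broom-≅-spider : (as : List A) (v : A) (Ls : List (Leg A)) → stem as (legs v Ls) ≅ spider (length as) (map nodes Ls)
broom-≅-spider as v Ls = ≅-stem as _ (sym (Lₚ.length-replicate (length as))) (legs-≅-spider v Ls)

addLeg-swap : (t : Tree ⊤) (j k : ℕ) → addLeg (addLeg t j) k ≅ addLeg (addLeg t k) j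
addLeg-swap t zero k = ≅-refl
addLeg-swap t (suc j) zero = ≅-refl
addLeg-swap t (suc j) (suc k) = ⋉-swap t _ _

addLeg-≅ : {t u : Tree ⊤} (k : ℕ) → t ≅ u → addLeg t k ≅ addLeg u k
addLeg-≅ zero e = e
addLeg-≅ (suc k) e = ≅-⋉ e ≅-refl

fan-↭ : {ms ns : List ℕ} → ms ↭ ns →
  foldr (λ k t → addLeg t k) (leaf tt) ms ≅ foldr (λ k t → addLeg t k) (leaf tt) ns
fan-↭ ↭.refl = ≅-refl
fan-↭ (↭.prep k p) = addLeg-≅ k (fan-↭ p)
fan-↭ (↭.swap {xs = ms} j k p) = ≅-trans (addLeg-swap (foldr (λ k t → addLeg t k) (leaf tt) ms) k j) (addLeg-≅ k (addLeg-≅ j (fan-↭ p)))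
fan-↭ (↭.trans p q) = ≅-trans (fan-↭ p) (fan-↭ q)

spider-↭ : (q : ℕ) {ms ns : List ℕ} → ms ↭ ns → spider q ms ≅ spider q ns
spider-↭ q p = ≅-stem (replicate q tt) (replicate q tt) refl (fan-↭ p)

edges-legs : (v : A) (Ls : List (Leg A)) → edges (legs v Ls) ≡ sum (map nodes Ls)
edges-legs v [] = refl
edges-legs v ((a , bs) ∷ Ls) = trans (cong₂ (λ y z → suc (y + z)) (edges-legs v Ls) (edges-path a bs))
  (trans (sym (ℕₚ.+-suc (sum (map nodes Ls)) (length bs))) (ℕₚ.+-comm (sum (map nodes Ls)) (suc (length bs))))
  where
  edges-path : (a : A) (bs : List A) → edges (path a bs) ≡ length bs
  edges-path a [] = refl
  edges-path a (b ∷ bs) = cong suc (edges-path b bs)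

hungLeaves-path : (a : A) (bs : List A) → hungLeaves (path a bs) ≡ 1
hungLeaves-path a [] = refl
hungLeaves-path a (b ∷ bs) = hungLeaves-path b bs

rootedLeaves-path≤1 : (a : A) (bs : List A) → rootedLeaves (path a bs) ≤ 1
rootedLeaves-path≤1 a [] = z≤n
rootedLeaves-path≤1 a (b ∷ bs) = ℕₚ.≤-reflexive (hungLeaves-path b bs)

rootedLeaves-legs : (v : A) (Ls : List (Leg A)) → rootedLeaves (legs v Ls) ≡ length Ls
rootedLeaves-legs v [] = refl
rootedLeaves-legs v ((a , bs) ∷ Ls) = trans (cong₂ _+_ (rootedLeaves-legs v Ls) (hungLeaves-path a bs)) (ℕₚ.+-comm (length Ls) 1)

rootedLeaves-broom : (as : List A) (v : A) (l : Leg A) (Ls : List (Leg A)) → rootedLeaves (stem as (legs v (l ∷ Ls))) ≡ suc (length Ls)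
rootedLeaves-broom as v (a , bs) Ls = trans (rootedLeaves-stem as (legs v Ls) (path a bs)) (rootedLeaves-legs v ((a , bs) ∷ Ls))

-- A 4-cycle with trees attached

-- SC, RC and QC are the quantities R - xQ, R and Q of the 4-cycle rooted at one of its vertices.
QC SC RC : ℕ → ℕ
QC x = (x + 2) * (x * x + 4 * x + 2)
SC x = x * (x + 2) * (2 * x + 6)
RC x = x * QC x + SC x

-- The analogues of Q and R for the 4-cycle extended by a stem of j edges and rooted at its far end.
upQ upR : ℕ → ℕ → ℕ
upQ zero = QC
upQ (suc j) x = upQ j x + upR j x
upR zero = RC
upR (suc j) x = x * upQ (suc j) x + upR j x

-- det(xI + L) after identifying the root of `t` with that of a structure whose invariants are `q`
-- and `r`; using B for `t` counts the x of the common vertex once.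
glue : (ℕ → ℕ) → (ℕ → ℕ) → Tree A → ℕ → ℕ
glue q r t x = r x * Q t x + q x * B t x

glue-≅ : ∀ q r {t : Tree A} {u : Tree A′} → t ≅ u → ∀ x → glue q r t x ≡ glue q r u x
glue-≅ q r e x = cong₂ (λ y z → r x * y + q x * z) (Q≅ e x) (B≅ e x)

is-QC : PolyFun 3 QC
is-QC = poly-* (poly-+ poly-id (poly-≤ z≤n (poly-const 2)))
  (poly-+ (poly-+ (poly-* poly-id poly-id) (poly-≤ (s≤s z≤n) (poly-* (poly-const 4) poly-id))) (poly-≤ z≤n (poly-const 2)))

is-SC : PolyFun 3 SC
is-SC = poly-* (poly-* poly-id (poly-+ poly-id (poly-≤ z≤n (poly-const 2))))
  (poly-+ (poly-* (poly-const 2) poly-id) (poly-≤ z≤n (poly-const 6)))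

is-RC : PolyFun 4 RC
is-RC = poly-+ (poly-* poly-id is-QC) (poly-≤ (ℕₚ.n≤1+n 3) is-SC)

is-upQ : ∀ j → IsPoly (upQ j)
is-upR : ∀ j → IsPoly (upR j)
is-upQ zero = _ , is-QC
is-upQ (suc j) = is-+ (is-upQ j) (is-upR j)
is-upR zero = _ , is-RC
is-upR (suc j) = is-+ (is-* is-id (is-upQ (suc j))) (is-upR j)

glue-split : (t : Tree A) → ∀ x → SC x * Q t x + QC x * R t x ≡ glue QC RC t x
glue-split t x = trans (cong (λ z → SC x * Q t x + QC x * z) (R-split t x))
  (solve 5 (λ x s c q b → s :* q :+ c :* (x :* q :+ b) := (x :* c :+ s) :* q :+ c :* b) refl x (SC x) (QC x) (Q t x) (B t x))
  where open +-*-Solver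

-- A reduction controls Q and R rather than B. Rewritten in these two, `glue` keeps coefficients
-- over ℕ because SC = RC - xQC is such a polynomial.
glue-⊑ : {t′ t : Tree A} → t′ ◁ t → glue QC RC t′ ⊑ glue QC RC t
glue-⊑ {t′ = t′} {t} r = ⊑-≗ (glue-split t′) (glue-split t) (⊑-+ (⊑-*ˡ (_ , is-SC) (Q⊑ r)) (⊑-*ˡ (_ , is-QC) (R⊑ r)))

glue-< : {t′ t : Tree A} → t′ ◁ t → glue QC RC t′ 1 < glue QC RC t 1
glue-< {t′ = t′} {t} r = subst₂ _<_ (glue-split t′ 1) (glue-split t 1)
  (ℕₚ.+-mono-<-≤ (ℕₚ.*-monoʳ-< (SC 1) (Q< r)) (ℕₚ.*-monoʳ-≤ (QC 1) (⊑⇒≤ (R⊑ r) 1)))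

-- The vertex at which the graph is cut into two parts can be moved along the stem, which turns a
-- stem of the tree into a stem of the cycle.
glue-stem : ∀ j (as : List A) (t : Tree A) x →
  glue (upQ j) (upR j) (stem as t) x ≡ glue (upQ (length as + j)) (upR (length as + j)) t x
glue-stem j [] t x = refl
glue-stem j (a ∷ as) t x = trans
  (trans (cong (λ z → upR j x * (1 * P u x) + upQ j x * (0 * P u x + 1 * z)) (R-split u x))
    (trans (cong (λ z → upR j x * (1 * (Q u x + z)) + upQ j x * (0 * P u x + 1 * (x * Q u x + B u x))) (R-split u x))
    (solve 6 (λ x q r qc bc p → r :* (con 1 :* (qc :+ (x :* qc :+ bc))) :+ q :* (con 0 :* p :+ con 1 :* (x :* qc :+ bc))
        := (x :* (q :+ r) :+ r) :* qc :+ (q :+ r) :* bc) refl x (upQ j x) (upR j x) (Q u x) (B u x) (P u x))))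
  (trans (glue-stem (suc j) as t x) (cong (λ k → glue (upQ k) (upR k) t x) (ℕₚ.+-suc (length as) j)))
  where
  open +-*-Solver
  u = stem as t

-- The effect of moving the branches Z one step along the stem; terms are placed so that no subtraction occurs.
slide : ∀ j (Z y : Tree A) (a : A) x →
  glue (upQ (suc j)) (upR (suc j)) (Z ⋉ y) x + B Z x * (upQ j x * R (leaf a ⋉ y) x)
  ≡ glue (upQ j) (upR j) (Z ⋉ (leaf a ⋉ y)) x + B Z x * (upR j x * Q (leaf a ⋉ y) x)
slide j Z y a x = solve 7 (λ x q r qz bz qy ry → let py = qy :+ ry ; rh = x :* py :+ con 1 :* ry ; qh = con 1 :* py in
    (x :* (q :+ r) :+ r) :* (qz :* py) :+ (q :+ r) :* (bz :* py :+ qz :* ry) :+ bz :* (q :* rh)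
    := r :* (qz :* (qh :+ rh)) :+ q :* (bz :* (qh :+ rh) :+ qz :* rh) :+ bz :* (r :* qh)) refl
    x (upQ j x) (upR j x) (Q Z x) (B Z x) (Q y x) (R y x)
  where open +-*-Solver

-- Prolonging a structure by one vertex acts on (Q , R) by the matrix ((1 , 1) , (x , x + 1)) of
-- determinant 1, so the cross difference of two structures is unchanged when both are prolonged.
slide-cross : ∀ j x qc rc w → upQ j x * rc + w ≡ upR j x * qc →
  upQ (suc j) x * (x * (qc + rc) + 1 * rc) + w ≡ upR (suc j) x * (1 * (qc + rc))
slide-cross j x qc rc w eq = trans
  (solve 6 (λ x q r qc rc w → (q :+ r) :* (x :* (qc :+ rc) :+ con 1 :* rc) :+ w := (q :* rc :+ w) :+ (x :* (q :+ r) :* (qc :+ rc) :+ r :* rc)) refl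
    x (upQ j x) (upR j x) qc rc w)
  (trans (cong (_+ (x * (upQ j x + upR j x) * (qc + rc) + upR j x * rc)) eq)
  (solve 5 (λ x q r qc rc → r :* qc :+ (x :* (q :+ r) :* (qc :+ rc) :+ r :* rc) := (x :* (q :+ r) :+ r) :* (con 1 :* (qc :+ rc))) refl
    x (upQ j x) (upR j x) qc rc))
  where open +-*-Solver

-- The path may have as many vertices as the cycle with its stem. Stripping one vertex from both
-- sides leads to a path that is a single vertex or to the bare cycle against at most four vertices.
-- The witnesses for the cycle are the differences RC Q - QC R; their linear coefficients 12, 8, 4,
-- 0 show that a fifth vertex would fail.
up-≽-path : ∀ j (a : A) (bs : List A) → length bs ≤ j + 3 →
  (λ x → upQ j x * R (path a bs) x) ⊑ (λ x → upR j x * Q (path a bs) x)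
up-≽-path zero a [] le = SC , (_ , is-SC) ,
  λ x → solve 3 (λ x c s → c :* x :+ s := (x :* c :+ s) :* con 1) refl x (QC x) (SC x)
  where open +-*-Solver
up-≽-path zero a (b ∷ []) le = (λ x → x * (x + 2) * (x + 2) * (x + 2)) ,
  is-* (is-* (is-* is-id (is-+ is-id (is-const 2))) (is-+ is-id (is-const 2))) (is-+ is-id (is-const 2)) ,
  λ x → solve 1 (λ x → let qc = (x :+ con 2) :* (x :* x :+ con 4 :* x :+ con 2)
                           rc = x :* qc :+ x :* (x :+ con 2) :* (con 2 :* x :+ con 6) in
     qc :* (x :* (con 1 :+ x) :+ con 1 :* x) :+ x :* (x :+ con 2) :* (x :+ con 2) :* (x :+ con 2) := rc :* (con 1 :* (con 1 :+ x))) refl x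
  where open +-*-Solver
up-≽-path zero a (b ∷ b′ ∷ []) le = (λ x → x * (x + 2) * (x * x * x + 6 * (x * x) + 10 * x + 2)) ,
  is-* (is-* is-id (is-+ is-id (is-const 2)))
    (is-+ (is-+ (is-+ (is-* (is-* is-id is-id) is-id) (is-* (is-const 6) (is-* is-id is-id))) (is-* (is-const 10) is-id)) (is-const 2)) ,
  λ x → solve 1 (λ x → let qc = (x :+ con 2) :* (x :* x :+ con 4 :* x :+ con 2)
                           rc = x :* qc :+ x :* (x :+ con 2) :* (con 2 :* x :+ con 6)
                           q₂ = con 1 :* (con 1 :+ x) ; r₂ = x :* (con 1 :+ x) :+ con 1 :* x in
     qc :* (x :* (q₂ :+ r₂) :+ con 1 :* r₂) :+ x :* (x :+ con 2) :* (x :* x :* x :+ con 6 :* (x :* x) :+ con 10 :* x :+ con 2)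
       := rc :* (con 1 :* (q₂ :+ r₂))) refl x
  where open +-*-Solver
up-≽-path zero a (b ∷ b′ ∷ b″ ∷ []) le = (λ x → x * (x + 2) * (x + 2) * (x * x * x + 6 * (x * x) + 9 * x)) ,
  is-* (is-* (is-* is-id (is-+ is-id (is-const 2))) (is-+ is-id (is-const 2)))
    (is-+ (is-+ (is-* (is-* is-id is-id) is-id) (is-* (is-const 6) (is-* is-id is-id))) (is-* (is-const 9) is-id)) ,
  λ x → solve 1 (λ x → let qc = (x :+ con 2) :* (x :* x :+ con 4 :* x :+ con 2)
                           rc = x :* qc :+ x :* (x :+ con 2) :* (con 2 :* x :+ con 6)
                           q₂ = con 1 :* (con 1 :+ x) ; r₂ = x :* (con 1 :+ x) :+ con 1 :* x
                           q₃ = con 1 :* (q₂ :+ r₂) ; r₃ = x :* (q₂ :+ r₂) :+ con 1 :* r₂ in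
     qc :* (x :* (q₃ :+ r₃) :+ con 1 :* r₃) :+ x :* (x :+ con 2) :* (x :+ con 2) :* (x :* x :* x :+ con 6 :* (x :* x) :+ con 9 :* x)
       := rc :* (con 1 :* (q₃ :+ r₃))) refl x
  where open +-*-Solver
up-≽-path zero a (b ∷ b′ ∷ b″ ∷ b‴ ∷ bs) (s≤s (s≤s (s≤s ())))
up-≽-path (suc j) a [] le = upR j , is-upR j ,
  λ x → solve 3 (λ x c s → c :* x :+ s := (x :* c :+ s) :* con 1) refl x (upQ (suc j) x) (upR j x)
  where open +-*-Solver
up-≽-path (suc j) a (b ∷ bs) (s≤s le) with up-≽-path j b bs le
... | w , is-w , eq = w , is-w , λ x → slide-cross j x (Q (path b bs) x) (R (path b bs) x) (w x) (eq x)

R-path≤2Q : (a : A) (bs : List A) → R (path a bs) 1 ≤ 2 * Q (path a bs) 1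
R-path≤2Q a [] = s≤s z≤n
R-path≤2Q a (b ∷ bs) = subst₂ _≤_
  (solve 2 (λ q r → q :+ con 2 :* r := con 1 :* (q :+ r) :+ con 1 :* r) refl (Q y 1) (R y 1))
  (solve 2 (λ q r → q :+ con 2 :* r :+ q := con 2 :* (con 1 :* (q :+ r))) refl (Q y 1) (R y 1))
  (ℕₚ.m≤m+n (Q y 1 + 2 * R y 1) (Q y 1))
  where
  open +-*-Solver
  y = path b bs

-- At x = 1 paths of every length are dominated: their R / Q stays at most 2, while the cycle has RC
-- 1 = 45 and QC 1 = 21. Stripping vertices from both sides reduces to this or to a single vertex.
up>path : ∀ j (a : A) (bs : List A) → upQ j 1 * R (path a bs) 1 < upR j 1 * Q (path a bs) 1
up>path zero a bs = ℕₚ.≤-<-trans (ℕₚ.*-monoʳ-≤ 21 (R-path≤2Q a bs))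
  (subst (_< 45 * Q (path a bs) 1) (ℕₚ.*-assoc 21 2 (Q (path a bs) 1))
    (*-monoˡ-<′ (Q (path a bs) 1) (Q-positive (path a bs)) (ℕₚ.m≤m+n 43 2)))
up>path (suc j) a [] = subst₂ _<_ (sym (ℕₚ.*-identityʳ _)) (sym (ℕₚ.*-identityʳ _))
  (subst (upQ (suc j) 1 <_) (cong (_+ upR j 1) (sym (ℕₚ.*-identityˡ (upQ (suc j) 1)))) (ℕₚ.m<m+n (upQ (suc j) 1) (upR-positive j)))
  where
  upR-positive : ∀ j → 0 < upR j 1
  upR-positive zero = s≤s z≤n
  upR-positive (suc j) = +-positiveʳ (1 * upQ (suc j) 1) (upR-positive j)
up>path (suc j) a (b ∷ bs) = subst (upQ (suc j) 1 * (1 * P y 1 + 1 * R y 1) <_)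
  (slide-cross j 1 (Q y 1) (R y 1) _ (ℕₚ.m+[n∸m]≡n (ℕₚ.<⇒≤ (up>path j b bs))))
  (ℕₚ.m<m+n _ (ℕₚ.m<n⇒0<n∸m (up>path j b bs)))
  where
  y = path b bs

record Cyclic (A : Set) : Set where
  constructor cyclic
  field
    t₀ t₁ t₂ t₃ : Tree A
open Cyclic public

turn : Cyclic A → Cyclic A
turn (cyclic a b d e) = cyclic b d e a

order leafCount : Cyclic A → ℕ
order (cyclic a b d e) = 4 + (edges a + edges b + edges d + edges e)
leafCount (cyclic a b d e) = rootedLeaves a + rootedLeaves b + rootedLeaves d + rootedLeaves e

-- The coefficients are the principal minors of xI + L(C₄).
cycleForm : (x q₀ q₁ q₂ q₃ b₀ b₁ b₂ b₃ : ℕ) → ℕ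
cycleForm x q₀ q₁ q₂ q₃ b₀ b₁ b₂ b₃ =
  (RC x * (q₀ * q₁ * q₂ * q₃) + QC x * (b₀ * q₁ * q₂ * q₃ + q₀ * b₁ * q₂ * q₃ + q₀ * q₁ * b₂ * q₃ + q₀ * q₁ * q₂ * b₃))
  + ((x + 1) * (x + 3) * (b₀ * b₁ * q₂ * q₃ + q₀ * b₁ * b₂ * q₃ + q₀ * q₁ * b₂ * b₃ + b₀ * q₁ * q₂ * b₃)
     + (x + 2) * (x + 2) * (b₀ * q₁ * b₂ * q₃ + q₀ * b₁ * q₂ * b₃)
     + (x + 2) * (b₀ * b₁ * b₂ * q₃ + b₀ * b₁ * q₂ * b₃ + b₀ * q₁ * b₂ * b₃ + q₀ * b₁ * b₂ * b₃)
     + b₀ * b₁ * b₂ * b₃)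

F : Cyclic A → ℕ → ℕ
F (cyclic a b d e) x = cycleForm x (Q a x) (Q b x) (Q d x) (Q e x) (B a x) (B b x) (B d x) (B e x)

F-turn : (X : Cyclic A) → ∀ x → F (turn X) x ≡ F X x
F-turn (cyclic a b d e) x = solve 11
  (λ R Q x q₀ q₁ q₂ q₃ b₀ b₁ b₂ b₃ →
     (R :* (q₁ :* q₂ :* q₃ :* q₀) :+ Q :* (b₁ :* q₂ :* q₃ :* q₀ :+ q₁ :* b₂ :* q₃ :* q₀ :+ q₁ :* q₂ :* b₃ :* q₀ :+ q₁ :* q₂ :* q₃ :* b₀))
     :+ ((x :+ con 1) :* (x :+ con 3) :* (b₁ :* b₂ :* q₃ :* q₀ :+ q₁ :* b₂ :* b₃ :* q₀ :+ q₁ :* q₂ :* b₃ :* b₀ :+ b₁ :* q₂ :* q₃ :* b₀)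
     :+ (x :+ con 2) :* (x :+ con 2) :* (b₁ :* q₂ :* b₃ :* q₀ :+ q₁ :* b₂ :* q₃ :* b₀)
     :+ (x :+ con 2) :* (b₁ :* b₂ :* b₃ :* q₀ :+ b₁ :* b₂ :* q₃ :* b₀ :+ b₁ :* q₂ :* b₃ :* b₀ :+ q₁ :* b₂ :* b₃ :* b₀)
     :+ b₁ :* b₂ :* b₃ :* b₀)
     :=
     (R :* (q₀ :* q₁ :* q₂ :* q₃) :+ Q :* (b₀ :* q₁ :* q₂ :* q₃ :+ q₀ :* b₁ :* q₂ :* q₃ :+ q₀ :* q₁ :* b₂ :* q₃ :+ q₀ :* q₁ :* q₂ :* b₃))
     :+ ((x :+ con 1) :* (x :+ con 3) :* (b₀ :* b₁ :* q₂ :* q₃ :+ q₀ :* b₁ :* b₂ :* q₃ :+ q₀ :* q₁ :* b₂ :* b₃ :+ b₀ :* q₁ :* q₂ :* b₃)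
     :+ (x :+ con 2) :* (x :+ con 2) :* (b₀ :* q₁ :* b₂ :* q₃ :+ q₀ :* b₁ :* q₂ :* b₃)
     :+ (x :+ con 2) :* (b₀ :* b₁ :* b₂ :* q₃ :+ b₀ :* b₁ :* q₂ :* b₃ :+ b₀ :* q₁ :* b₂ :* b₃ :+ q₀ :* b₁ :* b₂ :* b₃)
     :+ b₀ :* b₁ :* b₂ :* b₃)) refl
  (RC x) (QC x) x (Q a x) (Q b x) (Q d x) (Q e x) (B a x) (B b x) (B d x) (B e x)
  where open +-*-Solver

F-single : (t : Tree A) (b d e : A) → ∀ x → F (cyclic t (leaf b) (leaf d) (leaf e)) x ≡ glue QC RC t x
F-single t b d e x = solve 5
  (λ R Q x q b →
     (R :* (q :* con 1 :* con 1 :* con 1) :+ Q :* (b :* con 1 :* con 1 :* con 1 :+ q :* con 0 :* con 1 :* con 1 :+ q :* con 1 :* con 0 :* con 1 :+ q :* con 1 :* con 1 :* con 0))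
     :+ ((x :+ con 1) :* (x :+ con 3) :* (b :* con 0 :* con 1 :* con 1 :+ q :* con 0 :* con 0 :* con 1 :+ q :* con 1 :* con 0 :* con 0 :+ b :* con 1 :* con 1 :* con 0)
     :+ (x :+ con 2) :* (x :+ con 2) :* (b :* con 1 :* con 0 :* con 1 :+ q :* con 0 :* con 1 :* con 0)
     :+ (x :+ con 2) :* (b :* con 0 :* con 0 :* con 1 :+ b :* con 0 :* con 1 :* con 0 :+ b :* con 1 :* con 0 :* con 0 :+ q :* con 0 :* con 0 :* con 0)
     :+ b :* con 0 :* con 0 :* con 0)
     := R :* q :+ Q :* b) refl (RC x) (QC x) x (Q t x) (B t x)
  where open +-*-Solver

module _ {A : Set} (a b d e : Tree A) (label : A) where

  private
    merged : Tree A
    merged = merge (merge (merge a b) d) e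
    X X′ : Cyclic A
    X = cyclic a b d e
    X′ = cyclic merged (leaf label) (leaf label) (leaf label)

    -- All terms of degree at least 2 in the four values of B. The Q and B of the merged tree
    -- reproduce the constant and the linear terms of F exactly, so this is the whole difference.
    bilinear : ℕ → ℕ
    bilinear x = (x + 1) * (x + 3) * (B a x * B b x * Q d x * Q e x + Q a x * B b x * B d x * Q e x + Q a x * Q b x * B d x * B e x + B a x * Q b x * Q d x * B e x)
      + (x + 2) * (x + 2) * (B a x * Q b x * B d x * Q e x + Q a x * B b x * Q d x * B e x)
      + (x + 2) * (B a x * B b x * B d x * Q e x + B a x * B b x * Q d x * B e x + B a x * Q b x * B d x * B e x + Q a x * B b x * B d x * B e x)
      + B a x * B b x * B d x * B e x

    four : ∀ {f g h k} → IsPoly f → IsPoly g → IsPoly h → IsPoly k → IsPoly (λ x → f x * g x * h x * k x)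
    four f g h k = is-* (is-* (is-* f g) h) k

    is-x+ : ∀ k → IsPoly (λ x → x + k)
    is-x+ k = is-+ is-id (is-const k)

    is-bilinear : IsPoly bilinear
    is-bilinear = is-+ (is-+ (is-+
      (is-* (is-* (is-x+ 1) (is-x+ 3)) (is-+ (is-+ (is-+ (four (is-B a) (is-B b) (is-Q d) (is-Q e)) (four (is-Q a) (is-B b) (is-B d) (is-Q e)))
        (four (is-Q a) (is-Q b) (is-B d) (is-B e))) (four (is-B a) (is-Q b) (is-Q d) (is-B e))))
      (is-* (is-* (is-x+ 2) (is-x+ 2)) (is-+ (four (is-B a) (is-Q b) (is-B d) (is-Q e)) (four (is-Q a) (is-B b) (is-Q d) (is-B e)))))
      (is-* (is-x+ 2) (is-+ (is-+ (is-+ (four (is-B a) (is-B b) (is-B d) (is-Q e)) (four (is-B a) (is-B b) (is-Q d) (is-B e)))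
        (four (is-B a) (is-Q b) (is-B d) (is-B e))) (four (is-Q a) (is-B b) (is-B d) (is-B e)))))
      (four (is-B a) (is-B b) (is-B d) (is-B e))

    Q-merged : ∀ x → Q merged x ≡ Q a x * Q b x * Q d x * Q e x
    Q-merged x = trans (Q-merge (merge (merge a b) d) e x) (cong (_* Q e x)
      (trans (Q-merge (merge a b) d x) (cong (_* Q d x) (Q-merge a b x))))

    B-merged : ∀ x → B merged x ≡ B a x * Q b x * Q d x * Q e x + Q a x * B b x * Q d x * Q e x + Q a x * Q b x * B d x * Q e x + Q a x * Q b x * Q d x * B e x
    B-merged x = trans (B-merge (merge (merge a b) d) e x) (trans
      (cong₂ (λ y z → y * Q e x + z * B e x) (B-merge (merge a b) d x) (Q-merge (merge a b) d x))
      (trans (cong₂ (λ y z → (y * Q d x + z * B d x) * Q e x + z * Q d x * B e x) (B-merge a b x) (Q-merge a b x))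
      (solve 8 (λ qa qb qd qe ba bb bd be → ((ba :* qb :+ qa :* bb) :* qd :+ qa :* qb :* bd) :* qe :+ qa :* qb :* qd :* be
         := ba :* qb :* qd :* qe :+ qa :* bb :* qd :* qe :+ qa :* qb :* bd :* qe :+ qa :* qb :* qd :* be) refl
         (Q a x) (Q b x) (Q d x) (Q e x) (B a x) (B b x) (B d x) (B e x))))
      where open +-*-Solver

    F-merged : ∀ x → F X′ x + bilinear x ≡ F X x
    F-merged x = cong (_+ bilinear x) (trans (F-single merged label label label x)
      (cong₂ (λ y z → RC x * y + QC x * z) (Q-merged x) (B-merged x)))

  merge-cycle : 0 < bilinear 1 → Σ[ X′ ∈ Cyclic A ] (order X′ ≡ order X × leafCount X′ ≡ leafCount X × F X′ ⊑ F X × F X′ 1 < F X 1)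
  merge-cycle pos = X′ ,
    cong (λ z → 4 + z) (trans (solve 1 (λ m → m :+ con 0 :+ con 0 :+ con 0 := m) refl (edges merged))
      (trans (edges-merge (merge (merge a b) d) e) (cong (_+ edges e) (trans (edges-merge (merge a b) d) (cong (_+ edges d) (edges-merge a b)))))) ,
    trans (solve 1 (λ m → m :+ con 0 :+ con 0 :+ con 0 := m) refl (rootedLeaves merged))
      (trans (rootedLeaves-merge (merge (merge a b) d) e)
        (cong (_+ rootedLeaves e) (trans (rootedLeaves-merge (merge a b) d) (cong (_+ rootedLeaves d) (rootedLeaves-merge a b))))) ,
    (bilinear , is-bilinear , F-merged) ,
    subst (F X′ 1 <_) (F-merged 1) (ℕₚ.m<m+n (F X′ 1) pos)
    where open +-*-Solver

  private
    *⁴ : ∀ {i j k l} → 0 < i → 0 < j → 0 < k → 0 < l → 0 < i * j * k * l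
    *⁴ p q r s = *-positive (*-positive (*-positive p q) r) s

  merge-adjacent : 0 < B a 1 → 0 < B b 1 → Σ[ X′ ∈ Cyclic A ] (order X′ ≡ order X × leafCount X′ ≡ leafCount X × F X′ ⊑ F X × F X′ 1 < F X 1)
  merge-adjacent pa pb = merge-cycle (+-positiveˡ _ (+-positiveˡ _ (+-positiveˡ _ (*-positive {8} (s≤s z≤n)
    (+-positiveˡ _ (+-positiveˡ _ (+-positiveˡ _ (*⁴ pa pb (Q-positive d) (Q-positive e)))))))))

  merge-opposite : 0 < B a 1 → 0 < B d 1 → Σ[ X′ ∈ Cyclic A ] (order X′ ≡ order X × leafCount X′ ≡ leafCount X × F X′ ⊑ F X × F X′ 1 < F X 1)
  merge-opposite pa pd = merge-cycle (+-positiveˡ _ (+-positiveˡ _ (+-positiveʳ ((1 + 1) * (1 + 3) * (B a 1 * B b 1 * Q d 1 * Q e 1 + Q a 1 * B b 1 * B d 1 * Q e 1 + Q a 1 * Q b 1 * B d 1 * B e 1 + B a 1 * Q b 1 * Q d 1 * B e 1))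
    (*-positive {9} (s≤s z≤n)
    (+-positiveˡ (Q a 1 * B b 1 * Q d 1 * B e 1) (*⁴ pa (Q-positive b) pd (Q-positive e)))))))

-- Canonical structures

-- The largest q with 4 + q + l (q + 3) ≤ n: four cycle vertices, q further vertices up to the
-- centre, and l legs with at least q + 3 vertices each.
bound : ℕ → ℕ → ℕ
bound n l = (n ∸ (4 + 3 * l)) / suc l

bound-intro : ∀ n l q → q * suc l + (4 + 3 * l) ≤ n → q ≤ bound n l
bound-intro n l q le = subst (_≤ bound n l) (DivMod.m*n/n≡m q (suc l))
  (DivMod./-monoˡ-≤ (suc l) (subst (_≤ n ∸ (4 + 3 * l)) (ℕₚ.m+n∸n≡m (q * suc l) (4 + 3 * l)) (ℕₚ.∸-monoˡ-≤ (4 + 3 * l) le)))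

bound-elim : ∀ n l q → 3 * l + 4 ≤ n → q ≤ bound n l → q * suc l + (4 + 3 * l) ≤ n
bound-elim n l q le h = ℕₚ.≤-trans
  (ℕₚ.+-monoˡ-≤ (4 + 3 * l) (ℕₚ.≤-trans (ℕₚ.*-monoˡ-≤ (suc l) h) (DivMod.m/n*n≤m (n ∸ (4 + 3 * l)) (suc l))))
  (ℕₚ.≤-reflexive (ℕₚ.m∸n+n≡m (subst (_≤ n) (ℕₚ.+-comm (3 * l) 4) le)))

division-form : ∀ r k m → 0 < k → .{{_ : NonZero (r + k)}} →
  (((r + k) * m + r) / (r + k) ≡ m) × (((r + k) * m + r) % (r + k) ≡ r)
division-form r k m k>0 = quotient , remainder
  where
  r<r+k : r < r + k
  r<r+k = ℕₚ.m<m+n r k>0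
  form : (r + k) * m + r ≡ r + m * (r + k)
  form = trans (ℕₚ.+-comm ((r + k) * m) r) (cong (λ z → r + z) (ℕₚ.*-comm (r + k) m))
  remainder = trans (cong (_% (r + k)) form) (trans (DivMod.[m+kn]%n≡m%n r m (r + k)) (DivMod.m<n⇒m%n≡m r<r+k))
  quotient = trans (cong (_/ (r + k)) form) (trans (DivMod.+-distrib-/-∣ʳ r (Divisibility.n∣m*n m))
    (cong₂ _+_ (DivMod.m<n⇒m/n≡0 r<r+k) (DivMod.m*n/n≡m m (r + k))))

applyUpTo-two-values : ∀ m r k →
  Data.List.applyUpTo (λ j → m + (if j <ᵇ r then 1 else 0)) (r + k) ≡ replicate r (suc m) ++ replicate k m
applyUpTo-two-values m zero zero = refl
applyUpTo-two-values m zero (suc k) = cong₂ _∷_ (ℕₚ.+-identityʳ m) (applyUpTo-two-values m zero k)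
applyUpTo-two-values m (suc r) k = cong₂ _∷_ (ℕₚ.+-comm m 1) (applyUpTo-two-values m r k)

armLengths-two-values : ∀ m r k → 0 < k → armLengths ((r + k) * m + r) (r + k) ≡ replicate r (suc m) ++ replicate k m
armLengths-two-values m r (suc k) k>0 rewrite ℕₚ.+-suc r k = begin
  map (λ j → total / suc (r + k) + (if j <ᵇ total % suc (r + k) then 1 else 0)) (upTo (suc (r + k)))
    ≡⟨ cong₂ (λ a b → map (λ j → a + (if j <ᵇ b then 1 else 0)) (upTo (suc (r + k)))) (proj₁ form) (proj₂ form) ⟩
  map (λ j → m + (if j <ᵇ r then 1 else 0)) (upTo (suc (r + k)))
    ≡⟨ Lₚ.map-upTo (λ j → m + (if j <ᵇ r then 1 else 0)) (suc (r + k)) ⟩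
  Data.List.applyUpTo (λ j → m + (if j <ᵇ r then 1 else 0)) (suc (r + k))
    ≡⟨ cong (Data.List.applyUpTo (λ j → m + (if j <ᵇ r then 1 else 0))) (sym (ℕₚ.+-suc r k)) ⟩
  Data.List.applyUpTo (λ j → m + (if j <ᵇ r then 1 else 0)) (r + suc k)
    ≡⟨ applyUpTo-two-values m r (suc k) ⟩
  replicate r (suc m) ++ replicate (suc k) m ∎
  where
  open ≡-Reasoning
  total = suc (r + k) * m + r
  form : (total / suc (r + k) ≡ m) × (total % suc (r + k) ≡ r)
  form = subst (λ s → .{{_ : NonZero s}} → ((s * m + r) / s ≡ m) × ((s * m + r) % s ≡ r)) (ℕₚ.+-suc r k) (division-form r (suc k) m k>0)

-- With k = 0 the number of long arms equals the divisor, so division returns quotient m + 1 and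
-- remainder 0 instead. The resulting list is the same, and `armLengths-form` can cover every k.
armLengths-full : ∀ m r → armLengths ((r + 0) * m + r) (r + 0) ≡ replicate r (suc m) ++ []
armLengths-full m zero = refl
armLengths-full m (suc r) = trans (cong₂ armLengths (solve 2 (λ r m → (con 1 :+ r :+ con 0) :* m :+ (con 1 :+ r) := (con 1 :+ r) :* (con 1 :+ m) :+ con 0) refl r m) (ℕₚ.+-identityʳ (suc r)))
  (trans (armLengths-two-values (suc m) 0 (suc r) (s≤s z≤n)) (sym (Lₚ.++-identityʳ (replicate (suc r) (suc m)))))
  where open +-*-Solver

armLengths-form : ∀ m r k → armLengths ((r + k) * m + r) (r + k) ≡ replicate r (suc m) ++ replicate k m
armLengths-form m r zero = armLengths-full m r
armLengths-form m r (suc k) = armLengths-two-values m r (suc k) (s≤s z≤n)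

replicate-shift : ∀ r k (a b : A) → replicate r a ++ b ∷ replicate k b ↭ b ∷ (replicate r a ++ replicate k b)
replicate-shift r k a b = ↭ₚ.shift b (replicate r a) (replicate k b)

two-valued : (m : ℕ) (ns : List ℕ) → All (λ n → m ≤ n × n ≤ suc m) ns →
  ∃₂ λ r k → (ns ↭ replicate r (suc m) ++ replicate k m) × r + k ≡ length ns
two-valued m [] [] = 0 , 0 , ↭-refl , refl
two-valued m (n ∷ ns) ((lo , hi) ∷ h) with two-valued m ns h | ℕₚ.m≤n⇒m<n∨m≡n lo
... | r , k , p , len | inj₁ m<n rewrite ℕₚ.≤-antisym hi m<n = suc r , k , ↭-prep (suc m) p , cong suc len
... | r , k , p , len | inj₂ refl = r , suc k , ↭-trans (↭-prep m p) (↭-sym (replicate-shift r k (suc m) m)) , trans (ℕₚ.+-suc r k) (cong suc len)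

sum-two-values : ∀ m r k → sum (replicate r (suc m) ++ replicate k m) ≡ (r + k) * m + r
sum-two-values m r k = trans (Sumₚ.sum-++ (replicate r (suc m)) (replicate k m))
  (trans (cong₂ _+_ (sum-replicate r (suc m)) (sum-replicate k m))
    (solve 3 (λ m r k → r :* (con 1 :+ m) :+ k :* m := (r :+ k) :* m :+ r) refl m r k))
  where
  open +-*-Solver
  sum-replicate : ∀ k m → sum (replicate k m) ≡ k * m
  sum-replicate zero m = refl
  sum-replicate (suc k) m = cong (λ z → m + z) (sum-replicate k m)

-- A list with entries m and m + 1 is determined up to order by its length and its sum.
balanced-↭-armLengths : (m : ℕ) (ns : List ℕ) → All (λ n → m ≤ n × n ≤ suc m) ns → ns ↭ armLengths (sum ns) (length ns)
balanced-↭-armLengths m ns h with two-valued m ns h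
... | r , k , p , len = ↭-trans p (↭.↭-reflexive (trans (sym (armLengths-form m r k))
  (cong₂ armLengths (trans (sym (sum-two-values m r k)) (sym (Sumₚ.sum-↭ p))) len)))

extract-minimum : (f : A → ℕ) (a : A) (as : List A) → ∃₂ λ b bs → (a ∷ as ↭ b ∷ bs) × All (λ d → f b ≤ f d) bs
extract-minimum f a [] = a , [] , ↭-refl , []
extract-minimum f a (a′ ∷ as) with extract-minimum f a′ as
... | b , bs , p , h with ℕₚ.≤-total (f a) (f b)
... | inj₁ le = a , a′ ∷ as , ↭-refl , ↭ₚ.All-resp-↭ (↭-sym p) (le ∷ All.map (ℕₚ.≤-trans le) h)
... | inj₂ le = b , a ∷ bs , ↭-trans (↭-prep a p) (↭-swap a b ↭-refl) , le ∷ h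

extract-large : (f : A → ℕ) (k : ℕ) (as : List A) → All (λ d → f d ≤ k) as ⊎ (∃₂ λ b bs → (as ↭ b ∷ bs) × k < f b)
extract-large f k [] = inj₁ []
extract-large f k (a ∷ as) with f a ℕₚ.≤? k | extract-large f k as
... | no fa>k | _ = inj₂ (a , as , ↭-refl , ℕₚ.≰⇒> fa>k)
... | yes le | inj₁ h = inj₁ (le ∷ h)
... | yes le | inj₂ (b , bs , p , lt) = inj₂ (b , a ∷ bs , ↭-trans (↭-prep a p) (↭-swap a b ↭-refl) , lt)

sum≥ : (m : ℕ) (ns : List ℕ) → All (m ≤_) ns → length ns * m ≤ sum ns
sum≥ m [] [] = z≤n
sum≥ m (n ∷ ns) (le ∷ h) = ℕₚ.+-mono-≤ le (sum≥ m ns h)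

-- `turned` lets the one nontrivial tree hang at any of the four cycle vertices; the legs may come
-- in any order.
data Canonical {A : Set} (n l q : ℕ) : Cyclic A → Set where
  upright : ∀ as v Ls a b d → length as ≡ q → map nodes Ls ↭ armLengths (n ∸ (q + 4)) l →
            Canonical n l q (cyclic (stem as (legs v Ls)) (leaf a) (leaf b) (leaf d))
  turned  : ∀ {X} → Canonical n l q (turn X) → Canonical n l q X

Improvable : Cyclic A → Set
Improvable {A} X = Σ[ X′ ∈ Cyclic A ] (order X′ ≡ order X × leafCount X′ ≡ leafCount X × F X′ ⊑ F X × F X′ 1 < F X 1)

Outcome : (n l : ℕ) → Cyclic A → Set
Outcome n l X = (∃[ q ] (q ≤ bound n l × Canonical n l q X)) ⊎ Improvable X

order-turn : (X : Cyclic A) → order (turn X) ≡ order X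
order-turn (cyclic a b d e) = solve 4 (λ a b d e → con 4 :+ (b :+ d :+ e :+ a) := con 4 :+ (a :+ b :+ d :+ e)) refl (edges a) (edges b) (edges d) (edges e)
  where open +-*-Solver

leafCount-turn : (X : Cyclic A) → leafCount (turn X) ≡ leafCount X
leafCount-turn (cyclic a b d e) = solve 4 (λ a b d e → b :+ d :+ e :+ a := a :+ b :+ d :+ e) refl
  (rootedLeaves a) (rootedLeaves b) (rootedLeaves d) (rootedLeaves e)
  where open +-*-Solver

outcome-turn : ∀ {n l} (X : Cyclic A) → Outcome n l (turn X) → Outcome n l X
outcome-turn X (inj₁ (q , le , can)) = inj₁ (q , le , turned can)
outcome-turn X (inj₂ (X′ , o , lc , le , lt)) = inj₂ (X′ , trans o (order-turn X) , trans lc (leafCount-turn X) ,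
  ⊑-≗ (λ x → refl) (F-turn X) le , subst (F X′ 1 <_) (F-turn X 1) lt)

module _ {A : Set} (b d e : A) where

  hanging : Tree A → Cyclic A
  hanging t = cyclic t (leaf b) (leaf d) (leaf e)

  order-hanging : (t : Tree A) → order (hanging t) ≡ 4 + edges t
  order-hanging t = solve 1 (λ t → con 4 :+ (t :+ con 0 :+ con 0 :+ con 0) := con 4 :+ t) refl (edges t)
    where open +-*-Solver

  leafCount-hanging : (t : Tree A) → leafCount (hanging t) ≡ rootedLeaves t
  leafCount-hanging t = solve 1 (λ t → t :+ con 0 :+ con 0 :+ con 0 := t) refl (rootedLeaves t)
    where open +-*-Solver

  reducible-improvable : {t : Tree A} → Reducible t → Improvable (hanging t)
  reducible-improvable {t} (t′ , r) = hanging t′ ,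
    trans (order-hanging t′) (trans (cong (λ z → 4 + z) (edges≡ r)) (sym (order-hanging t))) ,
    trans (leafCount-hanging t′) (trans (rootedLeaves≡ r) (sym (leafCount-hanging t))) ,
    ⊑-≗ (λ x → sym (F-single t′ b d e x)) (λ x → sym (F-single t b d e x)) (glue-⊑ r) ,
    subst₂ _<_ (sym (F-single t′ b d e 1)) (sym (F-single t b d e 1)) (glue-< r)

  improvable-≅ : {t u : Tree A} → t ≅ u → Improvable (hanging t) → Improvable (hanging u)
  improvable-≅ {t} {u} eq (X′ , o , lc , le , lt) = X′ ,
    trans o (trans (order-hanging t) (trans (cong (λ z → 4 + z) (edges≅ eq)) (sym (order-hanging u)))) ,
    trans lc (trans (leafCount-hanging t) (trans (rootedLeaves≅ eq) (sym (leafCount-hanging u)))) ,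
    ⊑-≗ (λ x → refl) F≗ le , subst (F X′ 1 <_) (F≗ 1) lt
    where
    F≗ : ∀ x → F (hanging t) x ≡ F (hanging u) x
    F≗ x = trans (F-single t b d e x) (trans (glue-≅ QC RC eq x) (sym (F-single u b d e x)))

  glue-stem₀ : (as : List A) (t : Tree A) → ∀ x → F (hanging (stem as t)) x ≡ glue (upQ (length as)) (upR (length as)) t x
  glue-stem₀ as t x = trans (F-single (stem as t) b d e x) (trans (glue-stem 0 as t x)
    (cong (λ k → glue (upQ k) (upR k) t x) (ℕₚ.+-identityʳ (length as))))

  -- One stem vertex passes to the leg, which then has at most as many vertices as the cycle with
  -- the shortened stem, so `up-≽-path` applies. The leg `m` stays at the centre and keeps B Z
  -- positive.
  slide-improvable : (a : A) (as : List A) (v f : A) (fs : List A) (m : Leg A) (Ls : List (Leg A)) →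
    length fs ≤ length as + 2 → Improvable (hanging (stem (a ∷ as) (legs v ((f , fs) ∷ m ∷ Ls))))
  slide-improvable a as v f fs m Ls le = hanging near ,
    trans (order-hanging near) (trans (cong (λ z → 4 + z) edges-eq) (sym (order-hanging far))) ,
    trans (leafCount-hanging near) (trans leaves-eq (sym (leafCount-hanging far))) ,
    ((λ x → B Z x * w x) , is-* (is-B Z) is-w , F-eq) ,
    subst (F (hanging near) 1 <_) (F-eq 1) (ℕₚ.m<m+n (F (hanging near) 1) (*-positive (B-positive (legs v Ls) (path (proj₁ m) (proj₂ m))) w>0))
    where
    open +-*-Solver
    j = length as
    Z y near far : Tree A
    Z = legs v (m ∷ Ls)
    y = path f fs
    near = stem as (legs v ((a , f ∷ fs) ∷ m ∷ Ls))
    far = stem (a ∷ as) (legs v ((f , fs) ∷ m ∷ Ls))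
    dom = up-≽-path j a (f ∷ fs) (ℕₚ.≤-trans (s≤s le) (ℕₚ.≤-reflexive (sym (ℕₚ.+-suc j 2))))
    w : ℕ → ℕ
    w = proj₁ dom
    is-w = proj₁ (proj₂ dom)
    w>0 : 0 < w 1
    w>0 = ℕₚ.+-cancelˡ-< (upQ j 1 * R (path a (f ∷ fs)) 1) 0 _
      (subst₂ _<_ (sym (ℕₚ.+-identityʳ _)) (sym (proj₂ (proj₂ dom) 1)) (up>path j a (f ∷ fs)))
    edges-eq : edges near ≡ edges far
    edges-eq = trans (edges-stem as (legs v ((a , f ∷ fs) ∷ m ∷ Ls))) (trans
      (solve 3 (λ j z y → j :+ (con 1 :+ (z :+ (con 1 :+ y))) := con 1 :+ (j :+ (con 1 :+ (z :+ y)))) refl j (edges Z) (edges y))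
      (cong suc (sym (edges-stem as (legs v ((f , fs) ∷ m ∷ Ls))))))
    leaves-eq : rootedLeaves near ≡ rootedLeaves far
    leaves-eq = trans (rootedLeaves-broom as v (a , f ∷ fs) (m ∷ Ls)) (sym (rootedLeaves-broom (a ∷ as) v (f , fs) (m ∷ Ls)))
    F-eq : ∀ x → F (hanging near) x + B Z x * w x ≡ F (hanging far) x
    F-eq x = ℕₚ.+-cancelʳ-≡ (B Z x * (upQ j x * R (leaf a ⋉ y) x)) _ _ (begin
      F (hanging near) x + B Z x * w x + B Z x * (upQ j x * R (leaf a ⋉ y) x)
        ≡⟨ solve 4 (λ g b w m → g :+ b :* w :+ b :* m := g :+ b :* (m :+ w)) refl (F (hanging near) x) (B Z x) (w x) (upQ j x * R (leaf a ⋉ y) x) ⟩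
      F (hanging near) x + B Z x * (upQ j x * R (leaf a ⋉ y) x + w x)
        ≡⟨ cong₂ (λ g z → g + B Z x * z) (glue-stem₀ as (legs v ((a , f ∷ fs) ∷ m ∷ Ls)) x) (proj₂ (proj₂ dom) x) ⟩
      glue (upQ j) (upR j) (Z ⋉ (leaf a ⋉ y)) x + B Z x * (upR j x * Q (leaf a ⋉ y) x)
        ≡⟨ sym (slide j Z y a x) ⟩
      glue (upQ (suc j)) (upR (suc j)) (Z ⋉ y) x + B Z x * (upQ j x * R (leaf a ⋉ y) x)
        ≡⟨ cong (_+ B Z x * (upQ j x * R (leaf a ⋉ y) x)) (sym (glue-stem₀ (a ∷ as) (Z ⋉ y) x)) ⟩
      F (hanging far) x + B Z x * (upQ j x * R (leaf a ⋉ y) x) ∎)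
      where open ≡-Reasoning

  canonical-broom : ∀ n l as v L Ls → l ≡ length (L ∷ Ls) → 4 + (length as + sum (map nodes (L ∷ Ls))) ≡ n →
    All (λ M → nodes L ≤ nodes M × nodes M ≤ suc (nodes L)) (L ∷ Ls) → (Ms : List (Leg A)) → Ms ↭ L ∷ Ls →
    Canonical n l (length as) (hanging (stem as (legs v Ms)))
  canonical-broom n l as v L Ls refl refl h Ms p = upright as v Ms b d e refl
    (↭-trans (↭ₚ.map⁺ nodes p) (↭-trans
      (balanced-↭-armLengths (nodes L) (map nodes (L ∷ Ls)) (Allₚ.map⁺ h))
      (↭.↭-reflexive (cong₂ armLengths total (Lₚ.length-map nodes (L ∷ Ls))))))
    where
    S = sum (map nodes (L ∷ Ls))
    total : S ≡ 4 + (length as + S) ∸ (length as + 4)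
    total = sym (trans (cong (_∸ (length as + 4)) (solve 2 (λ q s → con 4 :+ (q :+ s) := s :+ (q :+ con 4)) refl (length as) S))
      (ℕₚ.m+n∸n≡m S (length as + 4)))
      where open +-*-Solver

  broom-outcome : ∀ n l as v L₁ L₂ Ls → l ≡ length (L₁ ∷ L₂ ∷ Ls) → 4 + (length as + sum (map nodes (L₁ ∷ L₂ ∷ Ls))) ≡ n →
    3 * l + 4 ≤ n → Outcome n l (hanging (stem as (legs v (L₁ ∷ L₂ ∷ Ls))))
  broom-outcome n l as v L₁ L₂ Ls l≡ n≡ n≥ with extract-minimum nodes L₁ (L₂ ∷ Ls)
  ... | M , [] , p , h = ⊥-elim (ℕₚ.1+n≢0 (ℕₚ.suc-injective (↭ₚ.↭-length p)))
  ... | M , M′ ∷ Ms , p , h with extract-large nodes (suc (nodes M)) (M′ ∷ Ms)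
  ... | inj₂ (N , Ns , p′ , lt) = inj₂ (improvable-≅ (≅-stem as as refl (legs-↭ v (↭-sym perm)))
        (reducible-improvable (proj₁ red , proj₂ red)))
    where
    perm : L₁ ∷ L₂ ∷ Ls ↭ N ∷ M ∷ Ns
    perm = ↭-trans p (↭-trans (↭-prep M p′) (↭-swap M N ↭-refl))
    red : Reducible (stem as (legs v (N ∷ M ∷ Ns)))
    red with unbalanced-reducible v (proj₁ M) (proj₁ N) (proj₂ M) (proj₂ N) Ns (ℕ.s≤s⁻¹ lt)
    ... | t′ , r = stem as t′ , ◁-stem as r
  ... | inj₁ h′ = decide as refl
    where
    balanced : All (λ N → nodes M ≤ nodes N × nodes N ≤ suc (nodes M)) (M ∷ M′ ∷ Ms)
    balanced = (ℕₚ.≤-refl , ℕₚ.n≤1+n _) ∷ All.zip (h , h′)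
    l≡′ : l ≡ length (M ∷ M′ ∷ Ms)
    l≡′ = trans l≡ (↭ₚ.↭-length p)
    n≡′ : 4 + (length as + sum (map nodes (M ∷ M′ ∷ Ms))) ≡ n
    n≡′ = trans (cong (λ z → 4 + (length as + z)) (Sumₚ.sum-↭ (↭ₚ.map⁺ nodes (↭-sym p)))) n≡
    sum≥l*m : l * nodes M ≤ sum (map nodes (M ∷ M′ ∷ Ms))
    sum≥l*m = subst (λ k → k * nodes M ≤ sum (map nodes (M ∷ M′ ∷ Ms))) (trans (Lₚ.length-map nodes (M ∷ M′ ∷ Ms)) (sym l≡′))
      (sum≥ (nodes M) (map nodes (M ∷ M′ ∷ Ms)) (Allₚ.map⁺ (All.map proj₁ balanced)))
    decide : ∀ as′ → as′ ≡ as → Outcome n l (hanging (stem as (legs v (L₁ ∷ L₂ ∷ Ls))))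
    decide [] refl = inj₁ (0 , z≤n , canonical-broom n l [] v M (M′ ∷ Ms) l≡′ n≡′ balanced (L₁ ∷ L₂ ∷ Ls) p)
    -- The list in a leg omits its first vertex, so the test asks whether the shortest leg has at
    -- most q + 2 vertices, where q is `suc (length as′)`.
    decide (a ∷ as′) refl with length (proj₂ M) ℕₚ.≤? length as′ + 2
    ... | yes le = inj₂ (improvable-≅ (≅-stem as as refl (legs-↭ v (↭-sym p)))
                     (slide-improvable a as′ v (proj₁ M) (proj₂ M) M′ Ms le))
    ... | no m≰ = inj₁ (suc (length as′) , bound-intro n l (suc (length as′)) size ,
                     canonical-broom n l as v M (M′ ∷ Ms) l≡′ n≡′ balanced (L₁ ∷ L₂ ∷ Ls) p)
      where
      open +-*-Solver
      q = suc (length as′)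
      q+3≤m : q + 3 ≤ nodes M
      q+3≤m = s≤s (subst (_≤ length (proj₂ M)) (sym (ℕₚ.+-suc (length as′) 2)) (ℕₚ.≰⇒> m≰))
      size : q * suc l + (4 + 3 * l) ≤ n
      size = subst₂ _≤_ (solve 2 (λ q l → con 4 :+ (q :+ l :* (q :+ con 3)) := q :* (con 1 :+ l) :+ (con 4 :+ con 3 :* l)) refl q l) n≡′
        (ℕₚ.+-monoʳ-≤ 4 (ℕₚ.+-monoʳ-≤ q (ℕₚ.≤-trans (ℕₚ.*-monoʳ-≤ l q+3≤m) sum≥l*m)))

  hanging-outcome : ∀ n l (t : Tree A) → 2 ≤ l → 3 * l + 4 ≤ n → order (hanging t) ≡ n → leafCount (hanging t) ≡ l →
    Outcome n l (hanging t)
  hanging-outcome n l t l≥2 n≥ o lc with shape t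
  ... | is-reducible r = inj₂ (reducible-improvable r)
  ... | is-path a as = ⊥-elim (ℕₚ.1+n≰n (ℕₚ.≤-trans l≥2 (subst (_≤ 1) (trans (sym (leafCount-hanging (path a as))) lc) (rootedLeaves-path≤1 a as))))
  ... | is-broom as v L₁ L₂ Ls = broom-outcome n l as v L₁ L₂ Ls
          (trans (sym lc) (trans (leafCount-hanging (stem as (legs v (L₁ ∷ L₂ ∷ Ls)))) (rootedLeaves-broom as v L₁ (L₂ ∷ Ls))))
          (trans (cong (λ z → 4 + z) (sym (trans (edges-stem as (legs v (L₁ ∷ L₂ ∷ Ls))) (cong (λ z → length as + z) (edges-legs v (L₁ ∷ L₂ ∷ Ls))))))
            (trans (sym (order-hanging (stem as (legs v (L₁ ∷ L₂ ∷ Ls))))) o))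
          n≥

trivial? : (t : Tree A) → (∃[ a ] t ≡ leaf a) ⊎ 0 < B t 1
trivial? (leaf a) = inj₁ (a , refl)
trivial? (t ⋉ c) = inj₂ (B-positive t c)

-- Two nontrivial trees on a 4-cycle sit at adjacent or at opposite vertices, and turning brings one
-- of them to the front. With no nontrivial tree there would be no leaf, against l ≥ 2.
outcome : ∀ n l (X : Cyclic A) → 2 ≤ l → 3 * l + 4 ≤ n → order X ≡ n → leafCount X ≡ l → Outcome n l X
outcome n l X@(cyclic s t u v) l≥2 n≥ o lc with trivial? s | trivial? t | trivial? u | trivial? v
... | inj₁ (a , refl) | inj₁ (b , refl) | inj₁ (d , refl) | inj₁ (e , refl) =
  ⊥-elim (ℕₚ.n≮0 (subst (2 ≤_) (sym lc) l≥2))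
... | inj₂ _ | inj₁ (b , refl) | inj₁ (d , refl) | inj₁ (e , refl) = hanging-outcome b d e n l s l≥2 n≥ o lc
... | inj₁ (a , refl) | inj₂ _ | inj₁ (d , refl) | inj₁ (e , refl) = outcome-turn X
  (hanging-outcome d e a n l t l≥2 n≥ (trans (order-turn X) o) (trans (leafCount-turn X) lc))
... | inj₁ (a , refl) | inj₁ (b , refl) | inj₂ _ | inj₁ (e , refl) = outcome-turn X (outcome-turn (turn X)
  (hanging-outcome e a b n l u l≥2 n≥ (trans (order-turn (turn X)) (trans (order-turn X) o)) (trans (leafCount-turn (turn X)) (trans (leafCount-turn X) lc))))
... | inj₁ (a , refl) | inj₁ (b , refl) | inj₁ (d , refl) | inj₂ _ = outcome-turn X (outcome-turn (turn X) (outcome-turn (turn (turn X))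
  (hanging-outcome a b d n l v l≥2 n≥ (trans (order-turn (turn (turn X))) (trans (order-turn (turn X)) (trans (order-turn X) o)))
    (trans (leafCount-turn (turn (turn X))) (trans (leafCount-turn (turn X)) (trans (leafCount-turn X) lc))))))
... | inj₂ p | inj₂ q | _ | _ = inj₂ (merge-adjacent s t u v (root s) p q)
... | inj₂ p | _ | inj₂ q | _ = inj₂ (merge-opposite s t u v (root s) p q)
... | _ | inj₂ p | inj₂ q | _ = outcome-turn X (inj₂ (merge-adjacent t u v s (root s) p q))
... | _ | inj₂ p | _ | inj₂ q = outcome-turn X (inj₂ (merge-opposite t u v s (root s) p q))
... | _ | _ | inj₂ p | inj₂ q = outcome-turn X (outcome-turn (turn X) (inj₂ (merge-adjacent u v s t (root s) p q)))
... | inj₂ q | _ | _ | inj₂ p = outcome-turn X (outcome-turn (turn X) (outcome-turn (turn (turn X)) (inj₂ (merge-adjacent v s t u (root s) p q))))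

target : (n l q : ℕ) → ℕ → ℕ
target n l q = glue QC RC (spider q (armLengths (n ∸ (q + 4)) l))

canonical-target : ∀ {n l q} (X : Cyclic A) → Canonical n l q X → ∀ x → F X x ≡ target n l q x
canonical-target _ (upright as v Ls a b d refl p) x = trans (F-single (stem as (legs v Ls)) a b d x)
  (glue-≅ QC RC (≅-trans (broom-≅-spider as v Ls) (spider-↭ (length as) p)) x)
canonical-target X (turned can) x = trans (sym (F-turn X x)) (canonical-target (turn X) can x)

-- The last component separates a structure that is already canonical from one lying strictly above
-- its target; only the former can come from a minimal graph.
dominated : ∀ n l → 2 ≤ l → 3 * l + 4 ≤ n → (X : Cyclic A) → order X ≡ n → leafCount X ≡ l →
  ∃[ q ] (q ≤ bound n l × (target n l q ⊑ F X) × (Canonical n l q X ⊎ target n l q 1 < F X 1))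
dominated {A} n l l≥2 n≥ X o lc = go X (ℕᵢ.<-wellFounded (F X 1)) o lc
  where
  go : (X : Cyclic A) → ℕᵢ.Acc _<_ (F X 1) → order X ≡ n → leafCount X ≡ l →
    ∃[ q ] (q ≤ bound n l × (target n l q ⊑ F X) × (Canonical n l q X ⊎ target n l q 1 < F X 1))
  go X (ℕᵢ.acc rec) o lc with outcome n l X l≥2 n≥ o lc
  ... | inj₁ (q , le , can) = q , le , ⊑-≗ (canonical-target X can) (λ x → refl) ⊑-refl , inj₁ can
  ... | inj₂ (X′ , o′ , lc′ , le′ , lt) with go X′ (rec lt) (trans o′ o) (trans lc′ lc)
  ...   | q , le , le″ , _ = q , le , ⊑-trans le″ le′ , inj₂ (ℕₚ.≤-<-trans (⊑⇒≤ le″ 1) lt)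

-- Incomparability of the targets

-- Each monomial has four tree factors, of total degree at most the number of tree edges, and a
-- coefficient of degree at most 4; together this is the number of vertices.
F-poly : (X : Cyclic A) → PolyFun (order X) (F X)
F-poly (cyclic a b d e) = poly-+
  (poly-+ (poly-* is-RC (four (Q-poly a) (Q-poly b) (Q-poly d) (Q-poly e)))
    (low 3 (s≤s (s≤s (s≤s z≤n))) is-QC (poly-+ (poly-+ (poly-+
      (four (B-poly a) (Q-poly b) (Q-poly d) (Q-poly e)) (four (Q-poly a) (B-poly b) (Q-poly d) (Q-poly e)))
      (four (Q-poly a) (Q-poly b) (B-poly d) (Q-poly e))) (four (Q-poly a) (Q-poly b) (Q-poly d) (B-poly e)))))
  (poly-+ (poly-+ (poly-+
    (low 2 (s≤s (s≤s z≤n)) (poly-* (x+ 1) (x+ 3)) (poly-+ (poly-+ (poly-+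
      (four (B-poly a) (B-poly b) (Q-poly d) (Q-poly e)) (four (Q-poly a) (B-poly b) (B-poly d) (Q-poly e)))
      (four (Q-poly a) (Q-poly b) (B-poly d) (B-poly e))) (four (B-poly a) (Q-poly b) (Q-poly d) (B-poly e))))
    (low 2 (s≤s (s≤s z≤n)) (poly-* (x+ 2) (x+ 2)) (poly-+
      (four (B-poly a) (Q-poly b) (B-poly d) (Q-poly e)) (four (Q-poly a) (B-poly b) (Q-poly d) (B-poly e)))))
    (low 1 (s≤s z≤n) (x+ 2) (poly-+ (poly-+ (poly-+
      (four (B-poly a) (B-poly b) (B-poly d) (Q-poly e)) (four (B-poly a) (B-poly b) (Q-poly d) (B-poly e)))
      (four (B-poly a) (Q-poly b) (B-poly d) (B-poly e))) (four (Q-poly a) (B-poly b) (B-poly d) (B-poly e)))))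
    (poly-≤ (ℕₚ.m≤n+m _ 4) (four (B-poly a) (B-poly b) (B-poly d) (B-poly e))))
  where
  S = edges a + edges b + edges d + edges e
  x+ : ∀ k → PolyFun 1 (λ x → x + k)
  x+ k = poly-+ poly-id (poly-≤ z≤n (poly-const k))
  four : ∀ {f g h k} → PolyFun (edges a) f → PolyFun (edges b) g → PolyFun (edges d) h → PolyFun (edges e) k → PolyFun S (λ x → f x * g x * h x * k x)
  four f g h k = poly-* (poly-* (poly-* f g) h) k
  low : ∀ m {f g} → m ≤ 4 → PolyFun m f → PolyFun S g → PolyFun (4 + S) (λ x → f x * g x)
  low m le f g = poly-≤ (ℕₚ.+-monoˡ-≤ S le) (poly-* f g)

-- R, B and upR vanish at 0; primes denote the quotients by x.
R′ B′ : Tree A → ℕ → ℕ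
R′ (leaf a) x = 1
R′ (t ⋉ c) x = R′ t x * P c x + Q t x * R′ c x
B′ (leaf a) x = 0
B′ (t ⋉ c) x = B′ t x * P c x + Q t x * R′ c x

R-divisible : (t : Tree A) → ∀ x → R t x ≡ x * R′ t x
R-divisible (leaf a) x = sym (ℕₚ.*-identityʳ x)
R-divisible (t ⋉ c) x = trans (cong₂ (λ y z → y * P c x + Q t x * z) (R-divisible t x) (R-divisible c x))
  (solve 5 (λ x r p q s → x :* r :* p :+ q :* (x :* s) := x :* (r :* p :+ q :* s)) refl x (R′ t x) (P c x) (Q t x) (R′ c x))
  where open +-*-Solver

B-divisible : (t : Tree A) → ∀ x → B t x ≡ x * B′ t x
B-divisible (leaf a) x = sym (ℕₚ.*-zeroʳ x)
B-divisible (t ⋉ c) x = trans (cong₂ (λ y z → y * P c x + Q t x * z) (B-divisible t x) (R-divisible c x))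
  (solve 5 (λ x r p q s → x :* r :* p :+ q :* (x :* s) := x :* (r :* p :+ q :* s)) refl x (B′ t x) (P c x) (Q t x) (R′ c x))
  where open +-*-Solver

is-R′ : (t : Tree A) → IsPoly (R′ t)
is-R′ (leaf a) = is-const 1
is-R′ (t ⋉ c) = is-+ (is-* (is-R′ t) (is-P c)) (is-* (is-Q t) (is-R′ c))

is-B′ : (t : Tree A) → IsPoly (B′ t)
is-B′ (leaf a) = is-const 0
is-B′ (t ⋉ c) = is-+ (is-* (is-B′ t) (is-P c)) (is-* (is-Q t) (is-R′ c))

upR′ : ℕ → ℕ → ℕ
upR′ zero x = QC x + (x + 2) * (2 * x + 6)
upR′ (suc j) x = upQ (suc j) x + upR′ j x

upR-divisible : ∀ j x → upR j x ≡ x * upR′ j x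
upR-divisible zero x = solve 2 (λ x c → x :* c :+ x :* (x :+ con 2) :* (con 2 :* x :+ con 6) := x :* (c :+ (x :+ con 2) :* (con 2 :* x :+ con 6))) refl x (QC x)
  where open +-*-Solver
upR-divisible (suc j) x = trans (cong (λ z → x * upQ (suc j) x + z) (upR-divisible j x)) (sym (ℕₚ.*-distribˡ-+ x (upQ (suc j) x) (upR′ j x)))

is-upR′ : ∀ j → IsPoly (upR′ j)
is-upR′ zero = is-+ (_ , is-QC) (is-* (is-+ is-id (is-const 2)) (is-+ (is-* (is-const 2) is-id) (is-const 6)))
is-upR′ (suc j) = is-+ (is-upQ (suc j)) (is-upR′ j)

Q-at-0 : (t : Tree A) → Q t 0 ≡ 1
P-at-0 : (t : Tree A) → P t 0 ≡ 1
Q-at-0 (leaf a) = refl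
Q-at-0 (t ⋉ c) = cong₂ _*_ (Q-at-0 t) (P-at-0 c)
P-at-0 t = cong₂ _+_ (Q-at-0 t) (R-divisible t 0)

-- The linear coefficient of det(xI + L) is the number of spanning trees times the number of
-- vertices.
R′-at-0 : (t : Tree A) → R′ t 0 ≡ suc (edges t)
R′-at-0 (leaf a) = refl
R′-at-0 (t ⋉ c) = trans (cong₂ _+_ (cong₂ _*_ (R′-at-0 t) (P-at-0 c)) (cong₂ _*_ (Q-at-0 t) (R′-at-0 c)))
  (solve 2 (λ t c → (con 1 :+ t) :* con 1 :+ con 1 :* (con 1 :+ c) := con 1 :+ (con 1 :+ (t :+ c))) refl (edges t) (edges c))
  where open +-*-Solver

B′-at-0 : (t : Tree A) → B′ t 0 ≡ edges t
B′-at-0 (leaf a) = refl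
B′-at-0 (t ⋉ c) = trans (cong₂ _+_ (cong₂ _*_ (B′-at-0 t) (P-at-0 c)) (cong₂ _*_ (Q-at-0 t) (R′-at-0 c)))
  (solve 2 (λ t c → t :* con 1 :+ con 1 :* (con 1 :+ c) := con 1 :+ (t :+ c)) refl (edges t) (edges c))
  where open +-*-Solver

-- A 4-cycle with a stem has 4 spanning trees; below, `upR′ j` at 0 is 4 times its j + 4 vertices.
upQ-at-0 : ∀ j → upQ j 0 ≡ 4
upQ-at-0 zero = refl
upQ-at-0 (suc j) = cong₂ _+_ (upQ-at-0 j) (upR-divisible j 0)

upR′-at-0 : ∀ j → upR′ j 0 ≡ j * 4 + 16
upR′-at-0 zero = refl
upR′-at-0 (suc j) = cong₂ _+_ (upQ-at-0 (suc j)) (upR′-at-0 j)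

infix 4 _<₂_

-- When f and g agree modulo x², the coefficient of x² is smaller in f than in g.
_<₂_ : (ℕ → ℕ) → (ℕ → ℕ) → Set
f <₂ g = ∃₂ λ h k → IsPoly h × IsPoly k × (∀ x → f x + x * (x * h x) ≡ g x + x * (x * k x)) × k 0 < h 0

<₂-trans : ∀ {f g h} → f <₂ g → g <₂ h → f <₂ h
<₂-trans {f} {g} {h} (a , b , pa , pb , e , lt) (a′ , b′ , pa′ , pb′ , e′ , lt′) =
  (λ x → a x + a′ x) , (λ x → b x + b′ x) , is-+ pa pa′ , is-+ pb pb′ , (λ x → begin
    f x + x * (x * (a x + a′ x))
      ≡⟨ solve 4 (λ f x a a′ → f :+ x :* (x :* (a :+ a′)) := (f :+ x :* (x :* a)) :+ x :* (x :* a′)) refl (f x) x (a x) (a′ x) ⟩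
    (f x + x * (x * a x)) + x * (x * a′ x) ≡⟨ cong (_+ x * (x * a′ x)) (e x) ⟩
    (g x + x * (x * b x)) + x * (x * a′ x)
      ≡⟨ solve 4 (λ g x b a′ → (g :+ x :* (x :* b)) :+ x :* (x :* a′) := (g :+ x :* (x :* a′)) :+ x :* (x :* b)) refl (g x) x (b x) (a′ x) ⟩
    (g x + x * (x * a′ x)) + x * (x * b x) ≡⟨ cong (_+ x * (x * b x)) (e′ x) ⟩
    (h x + x * (x * b′ x)) + x * (x * b x)
      ≡⟨ solve 4 (λ h x b b′ → (h :+ x :* (x :* b′)) :+ x :* (x :* b) := h :+ x :* (x :* (b :+ b′))) refl (h x) x (b x) (b′ x) ⟩
    h x + x * (x * (b x + b′ x)) ∎) , ℕₚ.+-mono-< lt lt′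
  where
  open ≡-Reasoning
  open +-*-Solver

<₂-≗ : ∀ {f g f′ g′} → (∀ x → f x ≡ f′ x) → (∀ x → g x ≡ g′ x) → f <₂ g → f′ <₂ g′
<₂-≗ ef eg (h , k , ph , pk , eq , lt) = h , k , ph , pk ,
  (λ x → trans (cong (_+ x * (x * h x)) (sym (ef x))) (trans (eq x) (cong (_+ x * (x * k x)) (eg x)))) , lt

<₂⇒coeff : ∀ {d e f g} (pf : PolyFun d f) (pg : PolyFun e g) → f <₂ g → coeffℕ (coeffs pf) 2 < coeffℕ (coeffs pg) 2
<₂⇒coeff {f = f} {g} pf pg (h , k , (_ , ph) , (_ , pk) , eq , lt) = ℕₚ.+-cancelʳ-< (k 0) _ _
  (subst (coeffℕ (coeffs pf) 2 + k 0 <_) second (ℕₚ.+-monoʳ-< (coeffℕ (coeffs pf) 2) lt))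
  where
  shifted : ∀ {d h} → PolyFun d h → List ℕ
  shifted p = 0 ∷ 0 ∷ coeffs p
  constant : ∀ {d h} (p : PolyFun d h) → coeffℕ (coeffs p) 0 ≡ h 0
  constant p = trans (head (coeffs p)) (evaluate p 0)
    where
    head : ∀ as → coeffℕ as 0 ≡ evalℕ as 0
    head [] = refl
    head (a ∷ as) = sym (ℕₚ.+-identityʳ a)
  lists : ∀ x → evalℕ (addℕ (coeffs pf) (shifted ph)) x ≡ evalℕ (addℕ (coeffs pg) (shifted pk)) x
  lists x = trans (eval-addℕ (coeffs pf) (shifted ph) x) (trans
    (cong₂ (λ y z → y + x * (x * z)) (evaluate pf x) (evaluate ph x)) (trans (eq x) (sym (trans
    (eval-addℕ (coeffs pg) (shifted pk) x) (cong₂ (λ y z → y + x * (x * z)) (evaluate pg x) (evaluate pk x))))))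
  second : coeffℕ (coeffs pf) 2 + h 0 ≡ coeffℕ (coeffs pg) 2 + k 0
  second = trans (cong (λ z → coeffℕ (coeffs pf) 2 + z) (sym (constant ph))) (trans
    (sym (coeff-addℕ (coeffs pf) (shifted ph) 2)) (trans
    (coeffℕ-unique (addℕ (coeffs pf) (shifted ph)) (addℕ (coeffs pg) (shifted pk)) lists 2) (trans
    (coeff-addℕ (coeffs pg) (shifted pk) 2) (cong (λ z → coeffℕ (coeffs pg) 2 + z) (constant pk)))))

fan : List ℕ → Tree ⊤
fan ns = foldr (λ k t → addLeg t k) (leaf tt) ns

target-slide : ∀ q m ns x → let h = path tt (replicate (suc m) tt) ; Z = fan ns in
  glue QC RC (spider (suc q) (suc m ∷ ns)) x + B Z x * (upQ q x * R h x)
  ≡ glue QC RC (spider q (suc (suc m) ∷ ns)) x + B Z x * (upR q x * Q h x)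
target-slide q m ns x = trans
  (cong (_+ B (fan ns) x * (upQ q x * R (path tt (replicate (suc m) tt)) x)) (level (suc q) (suc m ∷ ns)))
  (trans (slide q (fan ns) (path tt (replicate m tt)) tt x)
  (cong (_+ B (fan ns) x * (upR q x * Q (path tt (replicate (suc m) tt)) x)) (sym (level q (suc (suc m) ∷ ns)))))
  where
  level : ∀ q ns → glue QC RC (spider q ns) x ≡ glue (upQ q) (upR q) (fan ns) x
  level q ns = trans (glue-stem 0 (replicate q tt) (fan ns) x)
    (cong (λ k → glue (upQ k) (upR k) (fan ns) x) (trans (ℕₚ.+-identityʳ _) (Lₚ.length-replicate q)))

-- Passing from q to q + 1 takes one vertex from one arm and leaves the others alone. A second arm
-- is displayed as nonempty to make B of the remaining arms positive, and `long` says that the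
-- longer arm has more vertices than the cycle with its stem.
record Consecutive (n l q : ℕ) : Set where
  constructor consecutive
  field
    m k : ℕ
    ns : List ℕ
    shorter : armLengths (n ∸ (suc q + 4)) l ↭ suc m ∷ suc k ∷ ns
    longer  : armLengths (n ∸ (q + 4)) l ↭ suc (suc m) ∷ suc k ∷ ns
    long    : q + 4 ≤ suc m

consecutive-legs : ∀ n l q → 2 ≤ l → 3 * l + 4 ≤ n → suc q ≤ bound n l → Consecutive n l q
consecutive-legs n (suc (suc l)) q (s≤s (s≤s z≤n)) n≥ q<p = build r k refl s+k≡
  where
  open +-*-Solver
  L = suc (suc l)
  T′ = n ∸ (suc q + 4)
  r = T′ % L
  -- The arms still short after one more has been lengthened. There are none when the larger total
  -- is a multiple of `L`.
  k = L ∸ suc r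
  s+k≡ : suc r + k ≡ L
  s+k≡ = ℕₚ.m+[n∸m]≡n (DivMod.m%n<n T′ L)
  fits : L * (q + 4) + (suc q + 4) ≤ n
  fits = subst (_≤ n) (solve 2 (λ q l → (con 1 :+ q) :* (con 1 :+ l) :+ (con 4 :+ con 3 :* l) := l :* (q :+ con 4) :+ (con 1 :+ q :+ con 4)) refl q L)
    (bound-elim n L (suc q) n≥ q<p)
  q+4≤ : q + 4 ≤ T′ / L
  q+4≤ = subst (_≤ T′ / L) (trans (cong (_/ L) (ℕₚ.*-comm L (q + 4))) (DivMod.m*n/n≡m (q + 4) L))
    (DivMod./-monoˡ-≤ L (subst (_≤ T′) (ℕₚ.m+n∸n≡m (L * (q + 4)) (suc q + 4)) (ℕₚ.∸-monoˡ-≤ (suc q + 4) fits)))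
  sucT : n ∸ (q + 4) ≡ suc T′
  sucT = ℕₚ.+-∸-assoc 1 (ℕₚ.≤-trans (ℕₚ.m≤n+m (suc q + 4) (L * (q + 4))) fits)
  build : ∀ r k → r ≡ T′ % L → suc r + k ≡ L → Consecutive n L q
  build r k r≡ eq with T′ / L in m≡ | q+4≤
  ... | zero | bad = ⊥-elim (ℕₚ.n≮0 (ℕₚ.≤-trans (s≤s z≤n) (subst (_≤ 0) (ℕₚ.+-comm q 4) bad)))
  ... | suc m | le = finish r k r≡ eq
    where
    T≡ : ∀ r → r ≡ T′ % L → T′ ≡ L * suc m + r
    T≡ r r≡ = trans (DivMod.m≡m%n+[m/n]*n T′ L) (trans (cong₂ (λ a b → a + b * L) (sym r≡) m≡)
      (trans (ℕₚ.+-comm r (suc m * L)) (cong (_+ r) (ℕₚ.*-comm (suc m) L))))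
    form₁ : ∀ r k → r ≡ T′ % L → suc r + k ≡ L → armLengths T′ L ↭ suc m ∷ (replicate r (suc (suc m)) ++ replicate k (suc m))
    form₁ r k r≡ eq = ↭-trans (↭.↭-reflexive (trans
      (cong₂ armLengths (trans (T≡ r r≡) (cong (λ z → z * suc m + r) (sym eq′))) (sym eq′)) (armLengths-form (suc m) r (suc k))))
      (replicate-shift r k (suc (suc m)) (suc m))
      where
      eq′ : r + suc k ≡ L
      eq′ = trans (ℕₚ.+-suc r k) eq
    form₂ : ∀ r k → r ≡ T′ % L → suc r + k ≡ L → armLengths (n ∸ (q + 4)) L ≡ suc (suc m) ∷ (replicate r (suc (suc m)) ++ replicate k (suc m))
    form₂ r k r≡ eq = trans (cong₂ armLengths (trans sucT (trans (cong suc (T≡ r r≡)) (trans (sym (ℕₚ.+-suc (L * suc m) r))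
      (cong (λ z → z * suc m + suc r) (sym eq))))) (sym eq)) (armLengths-form (suc m) (suc r) k)
    finish : ∀ r k → r ≡ T′ % L → suc r + k ≡ L → Consecutive n L q
    -- As `suc r + k` is at least 2, there is a further arm to display, either short or long.
    finish zero (suc k) r≡ eq = consecutive m m _ (form₁ 0 (suc k) r≡ eq) (↭.↭-reflexive (form₂ 0 (suc k) r≡ eq)) le
    finish (suc r) k r≡ eq = consecutive m (suc m) _ (form₁ (suc r) k r≡ eq) (↭.↭-reflexive (form₂ (suc r) k r≡ eq)) le

module _ {n l : ℕ} (l≥2 : 2 ≤ l) (n≥ : 3 * l + 4 ≤ n) where

  private
    module Step {q} (q<p : suc q ≤ bound n l) where
      open Consecutive (consecutive-legs n l q l≥2 n≥ q<p) public
      h Z : Tree ⊤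
      h = path tt (replicate (suc m) tt)
      Z = fan (suc k ∷ ns)
      identity : ∀ x → target n l (suc q) x + B Z x * (upQ q x * R h x) ≡ target n l q x + B Z x * (upR q x * Q h x)
      identity x = trans (cong (_+ B Z x * (upQ q x * R h x)) (glue-≅ QC RC (spider-↭ (suc q) shorter) x))
        (trans (target-slide q m (suc k ∷ ns) x)
          (cong (_+ B Z x * (upR q x * Q h x)) (sym (glue-≅ QC RC (spider-↭ q longer) x))))

  target-1-step : ∀ q → suc q ≤ bound n l → target n l q 1 < target n l (suc q) 1
  target-1-step q q<p = ℕₚ.+-cancelʳ-< (B Z 1 * (upQ q 1 * R h 1)) _ _
    (subst (target n l q 1 + B Z 1 * (upQ q 1 * R h 1) <_) (sym (identity 1))
      (ℕₚ.+-monoʳ-< (target n l q 1) (*-monoʳ-<′ (B Z 1) (B-positive (fan ns) (path tt (replicate k tt))) (up>path q tt (replicate (suc m) tt)))))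
    where open Step q<p

  -- To first order B Z is x times the number of edges of Z, and the cross difference is 4x times q
  -- + 4 minus the number of vertices of h. The coefficient of x² is the product of the two,
  -- negative because h has at least q + 5 vertices.
  target-2-step : ∀ q → suc q ≤ bound n l → target n l (suc q) <₂ target n l q
  target-2-step q q<p = (λ x → B′ Z x * (upQ q x * R′ h x)) , (λ x → B′ Z x * (upR′ q x * Q h x)) ,
    is-* (is-B′ Z) (is-* (is-upQ q) (is-R′ h)) , is-* (is-B′ Z) (is-* (is-upR′ q) (is-Q h)) ,
    (λ x → trans (cong (λ z → target n l (suc q) x + z) (left x)) (trans (identity x) (cong (λ z → target n l q x + z) (right x)))) ,
    subst₂ _<_ (sym (cong₂ (λ y z → B′ Z 0 * (y * z)) (upR′-at-0 q) (Q-at-0 h))) (sym (cong₂ (λ y z → B′ Z 0 * (y * z)) (upQ-at-0 q) (R′-at-0 h)))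
      (*-monoʳ-<′ (B′ Z 0) (subst (0 <_) (sym (B′-at-0 Z)) (s≤s z≤n)) compare)
    where
    open Step q<p
    open +-*-Solver
    left : ∀ x → x * (x * (B′ Z x * (upQ q x * R′ h x))) ≡ B Z x * (upQ q x * R h x)
    left x = trans (solve 4 (λ x b q r → x :* (x :* (b :* (q :* r))) := (x :* b) :* (q :* (x :* r))) refl x (B′ Z x) (upQ q x) (R′ h x))
      (sym (cong₂ (λ b r → b * (upQ q x * r)) (B-divisible Z x) (R-divisible h x)))
    right : ∀ x → B Z x * (upR q x * Q h x) ≡ x * (x * (B′ Z x * (upR′ q x * Q h x)))
    right x = trans (cong₂ (λ b r → b * (r * Q h x)) (B-divisible Z x) (upR-divisible q x))
      (solve 4 (λ x b r q → (x :* b) :* ((x :* r) :* q) := x :* (x :* (b :* (r :* q)))) refl x (B′ Z x) (upR′ q x) (Q h x))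
    edges-h : edges h ≡ suc m
    edges-h = cong suc (go m)
      where
      go : ∀ m → edges (path tt (replicate m tt)) ≡ m
      go zero = refl
      go (suc m) = cong suc (go m)
    compare : (q * 4 + 16) * 1 < 4 * suc (edges h)
    compare = subst₂ _<_ (solve 1 (λ q → con 4 :* (q :+ con 4) := (q :* con 4 :+ con 16) :* con 1) refl q) (cong (λ z → 4 * suc z) (sym edges-h))
      (ℕₚ.*-monoʳ-< 4 (s≤s long))

  target-1-< : ∀ {q r} → q < r → r ≤ bound n l → target n l q 1 < target n l r 1
  target-1-< {q} {suc r} (s≤s q≤r) r≤p with ℕₚ.m≤n⇒m<n∨m≡n q≤r
  ... | inj₁ q<r = ℕₚ.<-trans (target-1-< q<r (ℕₚ.≤-trans (ℕₚ.n≤1+n r) r≤p)) (target-1-step r r≤p)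
  ... | inj₂ refl = target-1-step r r≤p

  target-2-< : ∀ {q r} → q < r → r ≤ bound n l → target n l r <₂ target n l q
  target-2-< {q} {suc r} (s≤s q≤r) r≤p with ℕₚ.m≤n⇒m<n∨m≡n q≤r
  ... | inj₁ q<r = <₂-trans (target-2-step r r≤p) (target-2-< q<r (ℕₚ.≤-trans (ℕₚ.n≤1+n r) r≤p))
  ... | inj₂ refl = target-2-step r r≤p

-- Pruning a graph to its 4-cycle

bit : Bool → ℕ
bit b = if b then 1 else 0

sum-tabulate : ∀ n (f : A → ℕ) (g : Fin n → A) → sum (map f (Data.List.tabulate g)) ≡ ℕΣ.sum (λ i → f (g i))
sum-tabulate zero f g = refl
sum-tabulate (suc n) f g = cong (λ z → f (g zero) + z) (sum-tabulate n f (g ∘ F.suc))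

deg-sum : ∀ {n} (G : Graph n) u → deg G u ≡ ℕΣ.sum (λ w → bit (G u w))
deg-sum {n} G u = sum-tabulate n (λ w → bit (G u w)) id

nth : Cyclic A → Fin 4 → Tree A
nth X zero = t₀ X
nth X (suc zero) = t₁ X
nth X (suc (suc zero)) = t₂ X
nth X (suc (suc (suc zero))) = t₃ X

C₄ : Graph 4
C₄ = fromEdges (cycleEdges 4)

data PunchInView {n : ℕ} (v : Fin (suc n)) : Fin (suc n) → Set where
  hole  : PunchInView v v
  other : ∀ w → PunchInView v (punchIn v w)

punchInView : ∀ {n} (v i : Fin (suc n)) → PunchInView v i
punchInView v i with v F.≟ i
... | yes refl = hole
... | no v≢i = subst (PunchInView v) (Fₚ.punchIn-punchOut v≢i) (other (punchOut v≢i))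

ℕsum-zero : ∀ n (f : Fin n → ℕ) → (∀ i → f i ≡ 0) → ℕΣ.sum f ≡ 0
ℕsum-zero n f h = trans (ℕΣ.sum-cong-≗ h) (ℕΣ.sum-replicate-zero n)

ℕsum-single : ∀ {n} (u : Fin n) (f : Fin n → ℕ) → (∀ j → j ≢ u → f j ≡ 0) → ℕΣ.sum f ≡ f u
ℕsum-single {suc n} u f h = trans (ℕΣ.sum-remove {i = u} f)
  (trans (cong (λ z → f u + z) (ℕsum-zero n _ (λ i → h (punchIn u i) (Fₚ.punchInᵢ≢i u i)))) (ℕₚ.+-identityʳ _))

true≢false : true ≢ false
true≢false ()

record LeafRemoval {n} (G : Graph (suc n)) (v : Fin (suc n)) (u : Fin n) (G′ : Graph n) : Set where
  constructor leafRemoval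
  field
    restrict  : ∀ i j → G′ i j ≡ G (punchIn v i) (punchIn v j)
    loop      : G v v ≡ false
    edge      : G v (punchIn v u) ≡ true
    no-edge   : ∀ w → w ≢ u → G v (punchIn v w) ≡ false
    symmetric : ∀ w → G (punchIn v w) v ≡ G v (punchIn v w)

  neighbour : ∀ w → G v (punchIn v w) ≡ true → w ≡ u
  neighbour w eq with w F.≟ u
  ... | yes w≡u = w≡u
  ... | no w≢u = ⊥-elim (true≢false (trans (sym eq) (no-edge w w≢u)))

  single-edge : ℕΣ.sum (λ w → bit (G v (punchIn v w))) ≡ 1
  single-edge = trans (ℕsum-single u (λ w → bit (G v (punchIn v w))) (λ w w≢u → cong bit (no-edge w w≢u))) (cong bit edge)

  deg-leaf : deg G v ≡ 1
  deg-leaf = trans (deg-sum G v) (trans (ℕΣ.sum-remove {i = v} (λ j → bit (G v j))) (cong₂ _+_ (cong bit loop) single-edge))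

  deg-other : ∀ w → deg G (punchIn v w) ≡ bit (G v (punchIn v w)) + deg G′ w
  deg-other w = begin
    deg G (punchIn v w) ≡⟨ deg-sum G (punchIn v w) ⟩
    ℕΣ.sum (λ j → bit (G (punchIn v w) j)) ≡⟨ ℕΣ.sum-remove {i = v} (λ j → bit (G (punchIn v w) j)) ⟩
    bit (G (punchIn v w) v) + ℕΣ.sum (λ j → bit (G (punchIn v w) (punchIn v j)))
      ≡⟨ cong₂ (λ b s → bit b + s) (symmetric w) (ℕΣ.sum-cong-≗ (λ j → cong bit (sym (restrict w j)))) ⟩
    bit (G v (punchIn v w)) + ℕΣ.sum (λ j → bit (G′ w j)) ≡⟨ cong (λ s → bit (G v (punchIn v w)) + s) (sym (deg-sum G′ w)) ⟩
    bit (G v (punchIn v w)) + deg G′ w ∎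
    where open ≡-Reasoning

  deg-neighbour : deg G (punchIn v u) ≡ suc (deg G′ u)
  deg-neighbour = trans (deg-other u) (cong (λ b → bit b + deg G′ u) edge)

  deg-far : ∀ w → w ≢ u → deg G (punchIn v w) ≡ deg G′ w
  deg-far w w≢u = trans (deg-other w) (cong (λ b → bit b + deg G′ w) (no-edge w w≢u))

  degSum-removal : ℕΣ.sum (deg G) ≡ 2 + ℕΣ.sum (deg G′)
  degSum-removal = trans (ℕΣ.sum-remove {i = v} (deg G)) (cong₂ _+_ deg-leaf
    (trans (trans (ℕΣ.sum-cong-≗ deg-other) (ℕΣ.∑-distrib-+ (λ w → bit (G v (punchIn v w))) (deg G′)))
      (cong (_+ ℕΣ.sum (deg G′)) single-edge)))

record Grafting {A : Set} {n} (lab : Fin (suc n) → Tree A) (v : Fin (suc n)) (u : Fin n) (lab′ : Fin n → Tree A) : Set where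
  constructor grafting
  field
    label-u : lab′ u ≡ lab (punchIn v u) ⋉ lab v
    label-w : ∀ w → w ≢ u → lab′ w ≡ lab (punchIn v w)

-- Repeated removal of a vertex v of degree 1, whose tree is then grafted onto that of its neighbour u,
-- until a 4-cycle remains.
data Pruning {A : Set} : ∀ {n} → Graph n → (Fin n → Tree A) → Cyclic A → Set where
  square : ∀ {G : Graph 4} {lab X} (f g : Fin 4 → Fin 4) → (∀ i → f (g i) ≡ i) → (∀ i → g (f i) ≡ i) →
    (∀ i j → G (f i) (f j) ≡ C₄ i j) → (∀ i → lab (f i) ≡ nth X i) → Pruning G lab X
  prune : ∀ {n} {G : Graph (suc n)} {lab X} (v : Fin (suc n)) (u : Fin n) (G′ : Graph n) (lab′ : Fin n → Tree A) →
    LeafRemoval G v u G′ → Grafting lab v u lab′ → Pruning G′ lab′ X → Pruning G lab X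

-- The matrix xI + L with the x at vertex i replaced by R / Q of its tree, and row i then multiplied
-- by Q to clear the denominator; hence it is not symmetric in general. For trees with a single
-- vertex it is xI + L.
entry : ∀ {n} → Graph n → (Fin n → Tree A) → ℕ → Mat n
entry G lab x i j with i F.≟ j
... | yes _ = int (R (lab i) x + deg G i * Q (lab i) x)
... | no _ = if G i j then ℤ.- int (Q (lab i) x) else 0ℤ

entry-diagonal : ∀ {n} (G : Graph n) (lab : Fin n → Tree A) x i → entry G lab x i i ≡ int (R (lab i) x + deg G i * Q (lab i) x)
entry-diagonal G lab x i with i F.≟ i
... | yes _ = refl
... | no i≢i = ⊥-elim (i≢i refl)

entry-off : ∀ {n} (G : Graph n) (lab : Fin n → Tree A) x i j → i ≢ j → entry G lab x i j ≡ (if G i j then ℤ.- int (Q (lab i) x) else 0ℤ)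
entry-off G lab x i j i≢j with i F.≟ j
... | yes i≡j = ⊥-elim (i≢j i≡j)
... | no _ = refl

module FourByFour where
  open ℤSolver.+-*-Solver

  Σₚ : ∀ {k n} → (Fin n → Polynomial k) → Polynomial k
  Σₚ {n = zero} f = con 0ℤ
  Σₚ {n = suc n} f = f zero :+ Σₚ (λ i → f (suc i))

  -- The recursion of `detℤ` in the syntax of the solver, so that its interpretation is the
  -- determinant by computation.
  detₚ : ∀ {k} m → (Fin m → Fin m → Polynomial k) → Polynomial k
  detₚ zero M = con 1ℤ
  detₚ (suc m) M = Σₚ (λ j → con (sgn (toℕ j)) :* (M zero j :* detₚ m (λ i k → M (suc i) (punchIn j k))))

  cyclicMatrix : (q r : Fin 4 → ℤ) → Mat 4
  cyclicMatrix q r i j = if toℕ i ≡ᵇ toℕ j then r i ℤ.+ int 2 ℤ.* q i else (if C₄ i j then ℤ.- q i else 0ℤ)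

  cyclicMatrixₚ : ∀ {k} (q r : Fin 4 → Polynomial k) → Fin 4 → Fin 4 → Polynomial k
  cyclicMatrixₚ q r i j = if toℕ i ≡ᵇ toℕ j then r i :+ con (int 2) :* q i else (if C₄ i j then :- q i else con 0ℤ)

  vec : ∀ {B : Set} → B → B → B → B → Fin 4 → B
  vec a b d e zero = a
  vec a b d e (suc zero) = b
  vec a b d e (suc (suc zero)) = d
  vec a b d e (suc (suc (suc zero))) = e

  -- One expression is read in three ways: over ℕ it unfolds to `cycleForm`, over ℤ it is the value
  -- of the determinant, and as solver syntax it lets the ring solver prove the identity.
  data Expr (k : ℕ) : Set where
    var : Fin k → Expr k
    lit : ℕ → Expr k
    _⊕_ _⊗_ : Expr k → Expr k → Expr k
  infixl 6 _⊕_
  infixl 7 _⊗_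

  ⟦_⟧ℕ : ∀ {k} → Expr k → (Fin k → ℕ) → ℕ
  ⟦ var i ⟧ℕ ρ = ρ i
  ⟦ lit n ⟧ℕ ρ = n
  ⟦ d ⊕ e ⟧ℕ ρ = ⟦ d ⟧ℕ ρ + ⟦ e ⟧ℕ ρ
  ⟦ d ⊗ e ⟧ℕ ρ = ⟦ d ⟧ℕ ρ * ⟦ e ⟧ℕ ρ

  ⟦_⟧ℤ : ∀ {k} → Expr k → (Fin k → ℤ) → ℤ
  ⟦ var i ⟧ℤ ρ = ρ i
  ⟦ lit n ⟧ℤ ρ = int n
  ⟦ d ⊕ e ⟧ℤ ρ = ⟦ d ⟧ℤ ρ ℤ.+ ⟦ e ⟧ℤ ρ
  ⟦ d ⊗ e ⟧ℤ ρ = ⟦ d ⟧ℤ ρ ℤ.* ⟦ e ⟧ℤ ρ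

  toₚ : ∀ {k n} → Expr k → (Fin k → Polynomial n) → Polynomial n
  toₚ (var i) ρ = ρ i
  toₚ (lit n) ρ = con (int n)
  toₚ (d ⊕ e) ρ = toₚ d ρ :+ toₚ e ρ
  toₚ (d ⊗ e) ρ = toₚ d ρ :* toₚ e ρ

  int-⟦⟧ : ∀ {k} (e : Expr k) ρ → int (⟦ e ⟧ℕ ρ) ≡ ⟦ e ⟧ℤ (λ i → int (ρ i))
  int-⟦⟧ (var i) ρ = refl
  int-⟦⟧ (lit n) ρ = refl
  int-⟦⟧ (d ⊕ e) ρ = trans (ℤₚ.pos-+ (⟦ d ⟧ℕ ρ) (⟦ e ⟧ℕ ρ)) (cong₂ ℤ._+_ (int-⟦⟧ d ρ) (int-⟦⟧ e ρ))
  int-⟦⟧ (d ⊗ e) ρ = trans (ℤₚ.pos-* (⟦ d ⟧ℕ ρ) (⟦ e ⟧ℕ ρ)) (cong₂ ℤ._*_ (int-⟦⟧ d ρ) (int-⟦⟧ e ρ))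

  nine : ∀ {B : Set} → B → B → B → B → B → B → B → B → B → Fin 9 → B
  nine x q₀ q₁ q₂ q₃ b₀ b₁ b₂ b₃ zero = x
  nine x q₀ q₁ q₂ q₃ b₀ b₁ b₂ b₃ (suc zero) = q₀
  nine x q₀ q₁ q₂ q₃ b₀ b₁ b₂ b₃ (suc (suc zero)) = q₁
  nine x q₀ q₁ q₂ q₃ b₀ b₁ b₂ b₃ (suc (suc (suc zero))) = q₂
  nine x q₀ q₁ q₂ q₃ b₀ b₁ b₂ b₃ (suc (suc (suc (suc zero)))) = q₃
  nine x q₀ q₁ q₂ q₃ b₀ b₁ b₂ b₃ (suc (suc (suc (suc (suc zero))))) = b₀
  nine x q₀ q₁ q₂ q₃ b₀ b₁ b₂ b₃ (suc (suc (suc (suc (suc (suc zero)))))) = b₁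
  nine x q₀ q₁ q₂ q₃ b₀ b₁ b₂ b₃ (suc (suc (suc (suc (suc (suc (suc zero))))))) = b₂
  nine x q₀ q₁ q₂ q₃ b₀ b₁ b₂ b₃ (suc (suc (suc (suc (suc (suc (suc (suc zero)))))))) = b₃

  cycleExpr : Expr 9
  cycleExpr = (rc ⊗ (q₀ ⊗ q₁ ⊗ q₂ ⊗ q₃) ⊕ qc ⊗ (b₀ ⊗ q₁ ⊗ q₂ ⊗ q₃ ⊕ q₀ ⊗ b₁ ⊗ q₂ ⊗ q₃ ⊕ q₀ ⊗ q₁ ⊗ b₂ ⊗ q₃ ⊕ q₀ ⊗ q₁ ⊗ q₂ ⊗ b₃))
    ⊕ ((x ⊕ lit 1) ⊗ (x ⊕ lit 3) ⊗ (b₀ ⊗ b₁ ⊗ q₂ ⊗ q₃ ⊕ q₀ ⊗ b₁ ⊗ b₂ ⊗ q₃ ⊕ q₀ ⊗ q₁ ⊗ b₂ ⊗ b₃ ⊕ b₀ ⊗ q₁ ⊗ q₂ ⊗ b₃)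
       ⊕ (x ⊕ lit 2) ⊗ (x ⊕ lit 2) ⊗ (b₀ ⊗ q₁ ⊗ b₂ ⊗ q₃ ⊕ q₀ ⊗ b₁ ⊗ q₂ ⊗ b₃)
       ⊕ (x ⊕ lit 2) ⊗ (b₀ ⊗ b₁ ⊗ b₂ ⊗ q₃ ⊕ b₀ ⊗ b₁ ⊗ q₂ ⊗ b₃ ⊕ b₀ ⊗ q₁ ⊗ b₂ ⊗ b₃ ⊕ q₀ ⊗ b₁ ⊗ b₂ ⊗ b₃)
       ⊕ b₀ ⊗ b₁ ⊗ b₂ ⊗ b₃)
    where
    v : Fin 9 → Expr 9
    v = var
    x q₀ q₁ q₂ q₃ b₀ b₁ b₂ b₃ qc rc : Expr 9
    x = v (F.# 0)
    q₀ = v (F.# 1)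
    q₁ = v (F.# 2)
    q₂ = v (F.# 3)
    q₃ = v (F.# 4)
    b₀ = v (F.# 5)
    b₁ = v (F.# 6)
    b₂ = v (F.# 7)
    b₃ = v (F.# 8)
    qc = (x ⊕ lit 2) ⊗ (x ⊗ x ⊕ lit 4 ⊗ x ⊕ lit 2)
    rc = x ⊗ qc ⊕ x ⊗ (x ⊕ lit 2) ⊗ (lit 2 ⊗ x ⊕ lit 6)

  det-cyclic : ∀ x q₀ q₁ q₂ q₃ b₀ b₁ b₂ b₃ →
    detℤ 4 (cyclicMatrix (vec q₀ q₁ q₂ q₃) (vec (x ℤ.* q₀ ℤ.+ b₀) (x ℤ.* q₁ ℤ.+ b₁) (x ℤ.* q₂ ℤ.+ b₂) (x ℤ.* q₃ ℤ.+ b₃)))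
    ≡ ⟦ cycleExpr ⟧ℤ (nine x q₀ q₁ q₂ q₃ b₀ b₁ b₂ b₃)
  det-cyclic = solve 9 (λ x q₀ q₁ q₂ q₃ b₀ b₁ b₂ b₃ →
    detₚ 4 (cyclicMatrixₚ (vec q₀ q₁ q₂ q₃) (vec (x :* q₀ :+ b₀) (x :* q₁ :+ b₁) (x :* q₂ :+ b₂) (x :* q₃ :+ b₃)))
    := toₚ cycleExpr (nine x q₀ q₁ q₂ q₃ b₀ b₁ b₂ b₃)) refl

C₄-irreflexive : ∀ i → C₄ i i ≡ false
C₄-irreflexive zero = refl
C₄-irreflexive (suc zero) = refl
C₄-irreflexive (suc (suc zero)) = refl
C₄-irreflexive (suc (suc (suc zero))) = refl

C₄-degree : ∀ i → ℕΣ.sum (λ j → bit (C₄ i j)) ≡ 2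
C₄-degree zero = refl
C₄-degree (suc zero) = refl
C₄-degree (suc (suc zero)) = refl
C₄-degree (suc (suc (suc zero))) = refl

sum-reindex : ∀ {n} (f g : Fin n → Fin n) → (∀ i → f (g i) ≡ i) → (∀ i → g (f i) ≡ i) →
  (h : Fin n → ℕ) → ℕΣ.sum (h ∘ f) ≡ ℕΣ.sum h
sum-reindex f g fg gf h = sym (ℕΣ.sum-permute h (Perm.permutation f g fg gf))

module Square {A : Set} {G : Graph 4} {lab : Fin 4 → Tree A} {X : Cyclic A} (f g : Fin 4 → Fin 4)
  (fg : ∀ i → f (g i) ≡ i) (gf : ∀ i → g (f i) ≡ i)
  (edge : ∀ i j → G (f i) (f j) ≡ C₄ i j) (label : ∀ i → lab (f i) ≡ nth X i) where

  f-injective : ∀ {i j} → f i ≡ f j → i ≡ j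
  f-injective {i} {j} eq = trans (sym (gf i)) (trans (cong g eq) (gf j))

  degree : ∀ i → deg G (f i) ≡ 2
  degree i = trans (deg-sum G (f i)) (trans (sym (sum-reindex f g fg gf (λ j → bit (G (f i) j))))
    (trans (ℕΣ.sum-cong-≗ (λ j → cong bit (edge i j))) (C₄-degree i)))

  determinant : ∀ x → detℤ 4 (entry G lab x) ≡ int (F X x)
  determinant x = trans (sym (detℤ-permute 4 f f-injective (entry G lab x))) (trans
    (detℤ-cong 4 entries) (trans (det-cyclic (int x) _ _ _ _ _ _ _ _)
    (sym (trans (int-⟦⟧ cycleExpr values) refl))))
    where
    open FourByFour
    values : Fin 9 → ℕ
    values = nine x (Q (t₀ X) x) (Q (t₁ X) x) (Q (t₂ X) x) (Q (t₃ X) x) (B (t₀ X) x) (B (t₁ X) x) (B (t₂ X) x) (B (t₃ X) x)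
    q r : Fin 4 → ℤ
    q = vec (int (Q (t₀ X) x)) (int (Q (t₁ X) x)) (int (Q (t₂ X) x)) (int (Q (t₃ X) x))
    r = vec (int x ℤ.* int (Q (t₀ X) x) ℤ.+ int (B (t₀ X) x)) (int x ℤ.* int (Q (t₁ X) x) ℤ.+ int (B (t₁ X) x))
            (int x ℤ.* int (Q (t₂ X) x) ℤ.+ int (B (t₂ X) x)) (int x ℤ.* int (Q (t₃ X) x) ℤ.+ int (B (t₃ X) x))
    q-nth : ∀ i → int (Q (nth X i) x) ≡ q i
    q-nth zero = refl
    q-nth (suc zero) = refl
    q-nth (suc (suc zero)) = refl
    q-nth (suc (suc (suc zero))) = refl
    r-tree : ∀ (t : Tree A) → int (R t x) ≡ int x ℤ.* int (Q t x) ℤ.+ int (B t x)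
    r-tree t = trans (cong int (R-split t x)) (trans (ℤₚ.pos-+ (x * Q t x) (B t x)) (cong (λ z → z ℤ.+ int (B t x)) (ℤₚ.pos-* x (Q t x))))
    r-nth : ∀ i → int (R (nth X i) x) ≡ r i
    r-nth zero = r-tree (t₀ X)
    r-nth (suc zero) = r-tree (t₁ X)
    r-nth (suc (suc zero)) = r-tree (t₂ X)
    r-nth (suc (suc (suc zero))) = r-tree (t₃ X)
    diagonal : ∀ i → entry G lab x (f i) (f i) ≡ r i ℤ.+ int 2 ℤ.* q i
    diagonal i = trans (entry-diagonal G lab x (f i)) (trans
      (cong₂ (λ t d → int (R t x + d * Q t x)) (label i) (degree i)) (trans
      (ℤₚ.pos-+ (R (nth X i) x) (2 * Q (nth X i) x))
      (cong₂ ℤ._+_ (r-nth i) (trans (ℤₚ.pos-* 2 (Q (nth X i) x)) (cong (λ z → int 2 ℤ.* z) (q-nth i))))))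
    off-diagonal : ∀ i j → i ≢ j → entry G lab x (f i) (f j) ≡ (if C₄ i j then ℤ.- q i else 0ℤ)
    off-diagonal i j i≢j = trans (entry-off G lab x (f i) (f j) (λ eq → i≢j (f-injective eq)))
      (cong₂ (λ b z → if b then z else 0ℤ) (edge i j) (trans (cong (λ t → ℤ.- int (Q t x)) (label i)) (cong ℤ.-_ (q-nth i))))
    entries : ∀ i j → entry G lab x (f i) (f j) ≡ cyclicMatrix q r i j
    entries i j with i F.≟ j
    ... | yes refl = trans (diagonal i) (same i)
      where
      same : ∀ i → r i ℤ.+ int 2 ℤ.* q i ≡ cyclicMatrix q r i i
      same zero = refl
      same (suc zero) = refl
      same (suc (suc zero)) = refl
      same (suc (suc (suc zero))) = refl
    ... | no i≢j = trans (off-diagonal i j i≢j) (cong (λ b → if b then r i ℤ.+ int 2 ℤ.* q i else (if C₄ i j then ℤ.- q i else 0ℤ)) (sym (different i j i≢j)))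
      where
      different : ∀ {m} (i j : Fin m) → i ≢ j → (toℕ i ≡ᵇ toℕ j) ≡ false
      different zero zero h = ⊥-elim (h refl)
      different zero (suc j) h = refl
      different (suc i) zero h = refl
      different (suc i) (suc j) h = different i j (λ eq → h (cong F.suc eq))

-- Removing a leaf is Gaussian elimination at v. The pivot is P of its tree, since degree 1 adds Q
-- to R. Row u is multiplied by it, which is the rule for Q of the grafted tree, and the product of
-- the two off-diagonal entries accounts for the degree of u dropping by one.
pruning-det : ∀ {n} {G : Graph n} {lab : Fin n → Tree A} {X} → Pruning G lab X → ∀ x → detℤ n (entry G lab x) ≡ int (F X x)
pruning-det (square {G} {lab} {X} f g fg gf edge label) = Square.determinant {G = G} {lab = lab} {X = X} f g fg gf edge label
pruning-det (prune {suc n} {G} {lab} {X} v u G′ lab′ L K p) x =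
  trans (pivot n (entry G lab x) v u (entry G′ lab′ x) row column rest off diagonal) (pruning-det p x)
  where
  open LeafRemoval L
  open Grafting K
  distinct : ∀ {i j} → i ≢ j → punchIn v i ≢ punchIn v j
  distinct i≢j eq = i≢j (Fₚ.punchIn-injective v _ _ eq)
  pu = punchIn v u
  row : ∀ w → w ≢ u → entry G lab x v (punchIn v w) ≡ 0ℤ
  row w w≢u = trans (entry-off G lab x v (punchIn v w) (λ eq → Fₚ.punchInᵢ≢i v w (sym eq)))
    (cong (λ b → if b then ℤ.- int (Q (lab v) x) else 0ℤ) (no-edge w w≢u))
  column : ∀ w → w ≢ u → entry G lab x (punchIn v w) v ≡ 0ℤ
  column w w≢u = trans (entry-off G lab x (punchIn v w) v (Fₚ.punchInᵢ≢i v w))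
    (cong (λ b → if b then ℤ.- int (Q (lab (punchIn v w)) x) else 0ℤ) (trans (symmetric w) (no-edge w w≢u)))
  rest : ∀ i j → i ≢ u → entry G′ lab′ x i j ≡ entry G lab x (punchIn v i) (punchIn v j)
  rest i j i≢u with i F.≟ j
  ... | yes refl = sym (trans (entry-diagonal G lab x (punchIn v i))
          (cong₂ (λ t d → int (R t x + d * Q t x)) (sym (label-w i i≢u)) (deg-far i i≢u)))
  ... | no i≢j = sym (trans (entry-off G lab x (punchIn v i) (punchIn v j) (distinct i≢j))
          (cong₂ (λ b t → if b then ℤ.- int (Q t x) else 0ℤ) (sym (restrict i j)) (sym (label-w i i≢u))))
  pivot-entry : entry G lab x v v ≡ int (P (lab v) x)
  pivot-entry = trans (entry-diagonal G lab x v) (cong int (trans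
    (cong (λ d → R (lab v) x + d * Q (lab v) x) deg-leaf)
    (trans (cong (λ z → R (lab v) x + z) (ℕₚ.*-identityˡ _)) (ℕₚ.+-comm (R (lab v) x) (Q (lab v) x)))))
  off : ∀ j → j ≢ u → entry G′ lab′ x u j ≡ entry G lab x v v ℤ.* entry G lab x pu (punchIn v j)
  off j j≢u = begin
    entry G′ lab′ x u j ≡⟨ entry-off G′ lab′ x u j (λ eq → j≢u (sym eq)) ⟩
    (if G′ u j then ℤ.- int (Q (lab′ u) x) else 0ℤ)
      ≡⟨ cong₂ (λ b t → if b then ℤ.- int (Q t x) else 0ℤ) (restrict u j) label-u ⟩
    (if G pu (punchIn v j) then ℤ.- int (Q (lab pu) x * P (lab v) x) else 0ℤ)
      ≡⟨ scale (G pu (punchIn v j)) ⟩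
    int (P (lab v) x) ℤ.* (if G pu (punchIn v j) then ℤ.- int (Q (lab pu) x) else 0ℤ)
      ≡⟨ sym (cong₂ ℤ._*_ pivot-entry (entry-off G lab x pu (punchIn v j) (distinct (λ eq → j≢u (sym eq))))) ⟩
    entry G lab x v v ℤ.* entry G lab x pu (punchIn v j) ∎
    where
    open ≡-Reasoning
    open ℤSolver.+-*-Solver
    scale : ∀ b → (if b then ℤ.- int (Q (lab pu) x * P (lab v) x) else 0ℤ) ≡ int (P (lab v) x) ℤ.* (if b then ℤ.- int (Q (lab pu) x) else 0ℤ)
    scale false = sym (ℤₚ.*-zeroʳ (int (P (lab v) x)))
    scale true = trans (cong ℤ.-_ (ℤₚ.pos-* (Q (lab pu) x) (P (lab v) x)))
      (solve 2 (λ q p → :- (q :* p) := p :* (:- q)) refl (int (Q (lab pu) x)) (int (P (lab v) x)))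
  diagonal : entry G′ lab′ x u u ≡ entry G lab x v v ℤ.* entry G lab x pu pu ℤ.- entry G lab x pu v ℤ.* entry G lab x v pu
  diagonal = begin
    entry G′ lab′ x u u ≡⟨ entry-diagonal G′ lab′ x u ⟩
    int (R (lab′ u) x + d * Q (lab′ u) x) ≡⟨ cong (λ t → int (R t x + d * Q t x)) label-u ⟩
    int E ≡⟨ solve 2 (λ e m → e := (e :+ m) :- m) refl (int E) (int M) ⟩
    (int E ℤ.+ int M) ℤ.- int M ≡⟨ cong (λ z → z ℤ.- int M) (sym (ℤₚ.pos-+ E M)) ⟩
    int (E + M) ℤ.- int M ≡⟨ cong (λ z → int z ℤ.- int M) arithmetic ⟩
    int (P (lab v) x * (R (lab pu) x + suc d * Q (lab pu) x)) ℤ.- int M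
      ≡⟨ cong₂ ℤ._-_ (trans (ℤₚ.pos-* (P (lab v) x) _) (cong₂ ℤ._*_ (sym pivot-entry)
           (trans (cong (λ k → int (R (lab pu) x + k * Q (lab pu) x)) (sym deg-neighbour)) (sym (entry-diagonal G lab x pu)))))
         (trans (trans (ℤₚ.pos-* (Q (lab pu) x) (Q (lab v) x))
           (solve 2 (λ a b → a :* b := (:- a) :* (:- b)) refl (int (Q (lab pu) x)) (int (Q (lab v) x))))
           (sym (cong₂ ℤ._*_ (trans (entry-off G lab x pu v (Fₚ.punchInᵢ≢i v u)) (cong (λ b → if b then ℤ.- int (Q (lab pu) x) else 0ℤ) (trans (symmetric u) edge)))
             (trans (entry-off G lab x v pu (λ eq → Fₚ.punchInᵢ≢i v u (sym eq))) (cong (λ b → if b then ℤ.- int (Q (lab v) x) else 0ℤ) edge))))) ⟩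
    entry G lab x v v ℤ.* entry G lab x pu pu ℤ.- entry G lab x pu v ℤ.* entry G lab x v pu ∎
    where
    open ≡-Reasoning
    open ℤSolver.+-*-Solver
    module S = +-*-Solver
    d E M : ℕ
    d = deg G′ u
    E = R (lab pu ⋉ lab v) x + d * Q (lab pu ⋉ lab v) x
    M = Q (lab pu) x * Q (lab v) x
    arithmetic : E + M ≡ P (lab v) x * (R (lab pu) x + suc d * Q (lab pu) x)
    arithmetic = S.solve 5 (λ d qu ru qv rv →
      ((ru S.:* (qv S.:+ rv) S.:+ qu S.:* rv) S.:+ d S.:* (qu S.:* (qv S.:+ rv))) S.:+ qu S.:* qv
      S.:= (qv S.:+ rv) S.:* (ru S.:+ (S.con 1 S.:+ d) S.:* qu)) refl d (Q (lab pu) x) (R (lab pu) x) (Q (lab v) x) (R (lab v) x)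

Σorder : ∀ {n} → (Fin n → Tree A) → ℕ
Σorder lab = ℕΣ.sum (λ u → suc (edges (lab u)))

pruning-order : ∀ {n} {G : Graph n} {lab : Fin n → Tree A} {X} → Pruning G lab X → Σorder lab ≡ order X
pruning-order (square {G} {lab} {X} f g fg gf edge label) = trans (sym (sum-reindex f g fg gf (λ u → suc (edges (lab u)))))
  (trans (ℕΣ.sum-cong-≗ (λ i → cong (λ t → suc (edges t)) (label i)))
    (solve 4 (λ a b d e → con 1 :+ a :+ (con 1 :+ b :+ (con 1 :+ d :+ (con 1 :+ e :+ con 0))) := con 4 :+ (a :+ b :+ d :+ e)) refl
      (edges (t₀ X)) (edges (t₁ X)) (edges (t₂ X)) (edges (t₃ X))))
  where open +-*-Solver
pruning-order (prune {suc n} {G} {lab} v u G′ lab′ L K p) = trans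
  (trans (ℕΣ.sum-remove {i = v} (λ u → suc (edges (lab u)))) (trans
    (cong (λ z → suc (edges (lab v)) + z) (ℕΣ.sum-remove {i = u} (λ w → suc (edges (lab (punchIn v w)))))) (trans
    (solve 3 (λ a b s → con 1 :+ a :+ (con 1 :+ b :+ s) := con 1 :+ (con 1 :+ (b :+ a)) :+ s) refl (edges (lab v)) (edges (lab (punchIn v u))) _) (trans
    (cong₂ (λ t s → suc (edges t) + s) (sym label-u)
      (ℕΣ.sum-cong-≗ (λ w → cong (λ t → suc (edges t)) (sym (label-w (punchIn u w) (Fₚ.punchInᵢ≢i u w))))))
    (sym (ℕΣ.sum-remove {i = u} (λ w → suc (edges (lab′ w)))))))))
  (pruning-order p)
  where
  open +-*-Solver
  open Grafting K

pruning-degree : ∀ {n} {G : Graph n} {lab : Fin n → Tree A} {X} → Pruning G lab X → ∀ i → 1 ≤ deg G i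
pruning-degree (square {G} {lab} {X} f g fg gf edge label) i = subst (λ j → 1 ≤ deg G j) (fg i)
  (subst (1 ≤_) (sym (Square.degree {G = G} {lab = lab} {X = X} f g fg gf edge label (g i))) (s≤s z≤n))
pruning-degree (prune {n} {G} v u G′ lab′ L K p) i with punchInView v i
... | hole = ℕₚ.≤-reflexive (sym (LeafRemoval.deg-leaf L))
... | other w = subst (1 ≤_) (sym (LeafRemoval.deg-other L w)) (ℕₚ.≤-trans (pruning-degree p w) (ℕₚ.m≤n+m _ _))

-- Leaves of the original graph inside the tree at a vertex of current degree d. The root can be one
-- of them only while its tree is a single vertex and d = 1, so the sum over all vertices is
-- unchanged by pruning.
vertexLeaves : ℕ → Tree A → ℕ
vertexLeaves d (leaf a) = bit (d ≡ᵇ 1)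
vertexLeaves d (t ⋉ c) = rootedLeaves (t ⋉ c)

vertexLeaves-1 : (t : Tree A) → vertexLeaves 1 t ≡ hungLeaves t
vertexLeaves-1 (leaf a) = refl
vertexLeaves-1 (t ⋉ c) = refl

vertexLeaves-2+ : ∀ d (t : Tree A) → vertexLeaves (suc (suc d)) t ≡ rootedLeaves t
vertexLeaves-2+ d (leaf a) = refl
vertexLeaves-2+ d (t ⋉ c) = refl

pruning-leaves : ∀ {n} {G : Graph n} {lab : Fin n → Tree A} {X} → Pruning G lab X →
  ℕΣ.sum (λ u → vertexLeaves (deg G u) (lab u)) ≡ leafCount X
pruning-leaves (square {G} {lab} {X} f g fg gf edge label) = trans
  (sym (sum-reindex f g fg gf (λ u → vertexLeaves (deg G u) (lab u))))
  (trans (ℕΣ.sum-cong-≗ (λ i → trans (cong₂ vertexLeaves (Square.degree {G = G} {lab = lab} {X = X} f g fg gf edge label i) (label i)) (vertexLeaves-2+ 0 (nth X i))))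
    (solve 4 (λ a b d e → a :+ (b :+ (d :+ (e :+ con 0))) := a :+ b :+ d :+ e) refl
      (rootedLeaves (t₀ X)) (rootedLeaves (t₁ X)) (rootedLeaves (t₂ X)) (rootedLeaves (t₃ X))))
  where open +-*-Solver
pruning-leaves (prune {suc n} {G} {lab} v u G′ lab′ L K p) = trans
  (trans (ℕΣ.sum-remove {i = v} (λ u → vertexLeaves (deg G u) (lab u))) (trans
    (cong₂ _+_ (trans (cong (λ d → vertexLeaves d (lab v)) deg-leaf) (vertexLeaves-1 (lab v)))
      (trans (ℕΣ.sum-remove {i = u} (λ w → vertexLeaves (deg G (punchIn v w)) (lab (punchIn v w))))
        (cong (_+ ℕΣ.sum (λ w → vertexLeaves (deg G (punchIn v (punchIn u w))) (lab (punchIn v (punchIn u w))))) at-u))) (trans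
    (solve 3 (λ a b s → a :+ (b :+ s) := (b :+ a) :+ s) refl (hungLeaves (lab v)) (rootedLeaves (lab (punchIn v u))) _) (trans
    (cong₂ _+_ (sym (cong (vertexLeaves (deg G′ u)) label-u))
      (ℕΣ.sum-cong-≗ (λ w → cong₂ vertexLeaves (deg-far (punchIn u w) (Fₚ.punchInᵢ≢i u w)) (sym (label-w (punchIn u w) (Fₚ.punchInᵢ≢i u w))))))
    (sym (ℕΣ.sum-remove {i = u} (λ w → vertexLeaves (deg G′ w) (lab′ w))))))))
  (pruning-leaves p)
  where
  open +-*-Solver
  open LeafRemoval L
  open Grafting K
  at-u : vertexLeaves (deg G (punchIn v u)) (lab (punchIn v u)) ≡ rootedLeaves (lab (punchIn v u))
  -- After the removal `u` still has a neighbour, so its degree before was at least 2 and it was not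
  -- a leaf.
  at-u with deg G′ u in eq | pruning-degree p u
  ... | suc d | _ = trans (cong (λ k → vertexLeaves k (lab (punchIn v u))) (trans deg-neighbour (cong suc eq))) (vertexLeaves-2+ d (lab (punchIn v u)))

pruning-degSum : ∀ {n} {G : Graph n} {lab : Fin n → Tree A} {X} → Pruning G lab X → ℕΣ.sum (deg G) ≡ 2 * n
pruning-degSum (square {G} {lab} {X} f g fg gf edge label) = trans (sym (sum-reindex f g fg gf (deg G)))
  (ℕΣ.sum-cong-≗ (Square.degree {G = G} {lab = lab} {X = X} f g fg gf edge label))
pruning-degSum (prune {n} {G} v u G′ lab′ L K p) =
  trans (LeafRemoval.degSum-removal L)
    (trans (cong (λ z → 2 + z) (pruning-degSum p)) (sym (ℕₚ.*-suc 2 n)))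

-- Properties of a graph read off a pruning

C₄-symmetric : ∀ i j → C₄ i j ≡ C₄ j i
C₄-symmetric = toWitness {a? = Fₚ.all? (λ i → Fₚ.all? (λ j → C₄ i j Boolₚ.≟ C₄ j i))} tt

C₄-triangle-free : ∀ i j k → C₄ i j ∧ C₄ j k ∧ C₄ k i ≡ false
C₄-triangle-free = toWitness {a? = Fₚ.all? (λ i → Fₚ.all? (λ j → Fₚ.all? (λ k → (C₄ i j ∧ C₄ j k ∧ C₄ k i) Boolₚ.≟ false)))} tt

pruning-symmetric : ∀ {n} {G : Graph n} {lab : Fin n → Tree A} {X} → Pruning G lab X → Symmetric G
pruning-symmetric (square {G} f g fg gf edge label) i j = subst₂ (λ i j → G i j ≡ G j i) (fg i) (fg j)
  (trans (edge (g i) (g j)) (trans (C₄-symmetric (g i) (g j)) (sym (edge (g j) (g i)))))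
pruning-symmetric (prune {n} {G} v u G′ lab′ (leafRemoval restrict loop edge no-edge symmetric) K p) i j with punchInView v i | punchInView v j
... | hole | hole = refl
... | hole | other w = sym (symmetric w)
... | other w | hole = symmetric w
... | other w | other w′ = trans (sym (restrict w w′)) (trans (pruning-symmetric p w w′) (restrict w′ w))

pruning-irreflexive : ∀ {n} {G : Graph n} {lab : Fin n → Tree A} {X} → Pruning G lab X → Irreflexive G
pruning-irreflexive (square {G} f g fg gf edge label) i = subst (λ i → G i i ≡ false) (fg i) (trans (edge (g i) (g i)) (C₄-irreflexive (g i)))
pruning-irreflexive (prune {n} {G} v u G′ lab′ (leafRemoval restrict loop edge no-edge symmetric) K p) i with punchInView v i
... | hole = loop
... | other w = trans (sym (restrict w w)) (pruning-irreflexive p w)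

T⇒≡ : ∀ {b} → T b → b ≡ true
T⇒≡ {true} _ = refl

≡⇒T : ∀ {b} → b ≡ true → T b
≡⇒T refl = tt

-- If a removed vertex were a corner of a triangle, the other two corners would both be its only
-- neighbour, giving a loop.
pruning-triangle-free : ∀ {n} {G : Graph n} {lab : Fin n → Tree A} {X} → Pruning G lab X →
  ∀ a b d → G a b ≡ true → G b d ≡ true → G d a ≡ true → ⊥
pruning-triangle-free (square {G} f g fg gf edge label) a b d ab bd da = true≢false (trans (sym (cong₂ _∧_ (at a b ab) (cong₂ _∧_ (at b d bd) (at d a da))))
  (C₄-triangle-free (g a) (g b) (g d)))
  where
  at : ∀ i j → G i j ≡ true → C₄ (g i) (g j) ≡ true
  at i j eq = trans (sym (edge (g i) (g j))) (trans (cong₂ G (fg i) (fg j)) eq)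
pruning-triangle-free P@(prune {n} {G} v u G′ lab′ L K p) = go
  where
  open LeafRemoval L
  corner : ∀ b d → G v b ≡ true → G b d ≡ true → G d v ≡ true → ⊥
  corner b d vb bd dv with punchInView v b | punchInView v d
  ... | hole | _ = true≢false (trans (sym vb) loop)
  ... | _ | hole = true≢false (trans (sym dv) loop)
  ... | other b′ | other d′ with neighbour b′ vb | neighbour d′ (trans (sym (symmetric d′)) dv)
  ...   | refl | refl = true≢false (trans (sym bd) (pruning-irreflexive P (punchIn v u)))
  go : ∀ a b d → G a b ≡ true → G b d ≡ true → G d a ≡ true → ⊥
  go a b d ab bd da with punchInView v a | punchInView v b | punchInView v d
  ... | hole | _ | _ = corner b d ab bd da
  ... | other _ | hole | _ = corner d a bd da ab
  ... | other _ | other _ | hole = corner a b da ab bd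
  ... | other a′ | other b′ | other d′ = pruning-triangle-free p a′ b′ d′ (trans (restrict a′ b′) ab) (trans (restrict b′ d′) bd) (trans (restrict d′ a′) da)

pruning-4-cycle : ∀ {n} {G : Graph n} {lab : Fin n → Tree A} {X} → Pruning G lab X → HasCycle G 4
pruning-4-cycle (square {G} f g fg gf edge label) = s≤s (s≤s (s≤s z≤n)) , f ,
  (λ {i} {j} eq → trans (sym (gf i)) (trans (cong g eq) (gf j))) , λ i j h → subst T (sym (edge i j)) (≡⇒T (successive i j h))
  where
  next : Fin 4 → Fin 4 → Bool
  next i j = (suc (toℕ i) ≡ᵇ toℕ j) ∨ ((suc (toℕ i) ≡ᵇ 4) ∧ (toℕ j ≡ᵇ 0))
  table : ∀ i j → (if next i j then C₄ i j else true) ≡ true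
  table = toWitness {a? = Fₚ.all? (λ i → Fₚ.all? (λ j → (if next i j then C₄ i j else true) Boolₚ.≟ true))} tt
  holds : ∀ i j → suc (toℕ i) ≡ toℕ j ⊎ (suc (toℕ i) ≡ 4 × toℕ j ≡ 0) → next i j ≡ true
  holds i j (inj₁ eq) = cong (_∨ ((suc (toℕ i) ≡ᵇ 4) ∧ (toℕ j ≡ᵇ 0))) (T⇒≡ (ℕₚ.≡⇒≡ᵇ (suc (toℕ i)) (toℕ j) eq))
  holds i j (inj₂ (p , q)) = trans (cong ((suc (toℕ i) ≡ᵇ toℕ j) ∨_) (cong₂ _∧_ (T⇒≡ (ℕₚ.≡⇒≡ᵇ (suc (toℕ i)) 4 p)) (T⇒≡ (ℕₚ.≡⇒≡ᵇ (toℕ j) 0 q))))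
    (Boolₚ.∨-zeroʳ (suc (toℕ i) ≡ᵇ toℕ j))
  successive : ∀ i j → suc (toℕ i) ≡ toℕ j ⊎ (suc (toℕ i) ≡ 4 × toℕ j ≡ 0) → C₄ i j ≡ true
  successive i j h = trans (sym (cong (λ b → if b then C₄ i j else true) (holds i j h))) (table i j)
pruning-4-cycle (prune {n} {G} v u G′ lab′ (leafRemoval restrict loop edge no-edge symmetric) K p) with pruning-4-cycle p
... | le , f , inj , adj = le , (λ i → punchIn v (f i)) , (λ eq → inj (Fₚ.punchIn-injective v _ _ eq)) ,
  λ i j h → subst T (restrict (f i) (f j)) (adj i j h)

walk-trans : ∀ {n} {G : Graph n} {a b d} → Walk G a b → Walk G b d → Walk G a d
walk-trans here q = q
walk-trans (step e p) q = step e (walk-trans p q)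

walk-map : ∀ {m n} {G : Graph m} {H : Graph n} (f : Fin m → Fin n) → (∀ {i j} → T (G i j) → T (H (f i) (f j))) →
  ∀ {i j} → Walk G i j → Walk H (f i) (f j)
walk-map f h here = here
walk-map f h (step e p) = step (h e) (walk-map f h p)

pruning-connected : ∀ {n} {G : Graph n} {lab : Fin n → Tree A} {X} → Pruning G lab X → Connected G
pruning-connected (square {G} f g fg gf edge label) i j = subst₂ (Walk G) (fg i) (fg j)
  (walk-map f (λ {i} {j} e → subst T (sym (edge i j)) e) (walk-trans (to₀ (g i)) (from₀ (g j))))
  where
  to₀ : ∀ i → Walk C₄ i zero
  to₀ zero = here
  to₀ (suc zero) = step tt here
  to₀ (suc (suc zero)) = step {v = F.# 1} tt (step tt here)
  to₀ (suc (suc (suc zero))) = step tt here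
  from₀ : ∀ i → Walk C₄ zero i
  from₀ zero = here
  from₀ (suc zero) = step tt here
  from₀ (suc (suc zero)) = step {v = F.# 1} tt (step tt here)
  from₀ (suc (suc (suc zero))) = step tt here
pruning-connected (prune {n} {G} v u G′ lab′ (leafRemoval restrict loop edge no-edge symmetric) K p) i j with punchInView v i | punchInView v j
... | hole | hole = here
... | hole | other w = step (≡⇒T edge) (walk-map (punchIn v) (λ {i} {j} → subst T (restrict i j)) (pruning-connected p u w))
... | other w | hole = walk-trans (walk-map (punchIn v) (λ {i} {j} → subst T (restrict i j)) (pruning-connected p w u))
                         (step (≡⇒T (trans (symmetric u) edge)) here)
... | other w | other w′ = walk-map (punchIn v) (λ {i} {j} → subst T (restrict i j)) (pruning-connected p w w′)

pruning⇒UniSet : ∀ {n l} {G : Graph n} {ι : Fin n → A} {X} → Pruning G (λ i → leaf (ι i)) X → leafCount X ≡ l → UniSet n l 4 G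
pruning⇒UniSet {n = n} {G = G} p lc = pruning-symmetric p , pruning-irreflexive p ,
  (pruning-connected p , trans (sum-tabulate n (deg G) id) (pruning-degSum p)) ,
  trans (trans (sum-tabulate n (λ v → if deg G v ≡ᵇ 1 then 1 else 0) id) (pruning-leaves p)) lc ,
  pruning-4-cycle p , no-shorter
  where
  no-shorter : ∀ k → k < 4 → ¬ HasCycle G k
  no-shorter k k<4 (3≤k , f , inj , adj) with ℕₚ.≤-antisym 3≤k (ℕ.s≤s⁻¹ k<4)
  ... | refl = pruning-triangle-free p (f (F.# 0)) (f (F.# 1)) (f (F.# 2))
    (T⇒≡ (adj (F.# 0) (F.# 1) (inj₁ refl))) (T⇒≡ (adj (F.# 1) (F.# 2) (inj₁ refl))) (T⇒≡ (adj (F.# 2) (F.# 0) (inj₂ (refl , refl))))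

UniSet-leaves : ∀ {n l} {G : Graph n} {ι : Fin n → A} {X} → Pruning G (λ i → leaf (ι i)) X → leaves G ≡ l → leafCount X ≡ l
UniSet-leaves {n = n} {G = G} p eq = trans (sym (pruning-leaves p)) (trans (sym (sum-tabulate n (λ v → if deg G v ≡ᵇ 1 then 1 else 0) id)) eq)

pruning-size : ∀ {n} {G : Graph n} {ι : Fin n → A} {X} → Pruning G (λ i → leaf (ι i)) X → order X ≡ n
pruning-size {n = n} p = trans (sym (pruning-order p)) (ones n)
  where
  ones : ∀ n → ℕΣ.sum {n} (λ _ → 1) ≡ n
  ones zero = refl
  ones (suc n) = cong suc (ones n)

-- From the determinant to the coefficients of the Laplacian polynomial

detℤ-negate : ∀ m (M : Mat m) → detℤ m (λ i j → -1ℤ ℤ.* M i j) ≡ sgn m ℤ.* detℤ m M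
detℤ-negate zero M = refl
detℤ-negate (suc m) M = trans (ℤΣ.sum-cong-≗ (λ j → trans
    (cong (λ z → sgn (toℕ j) ℤ.* ((-1ℤ ℤ.* M zero j) ℤ.* z)) (detℤ-negate m (N j)))
    (solve 4 (λ s a e d → s :* ((con -1ℤ :* a) :* (e :* d)) := (:- e) :* (s :* (a :* d))) refl (sgn (toℕ j)) (M zero j) (sgn m) (detℤ m (N j)))))
  (sym (ℤΣ.*-distribˡ-sum (ℤ.- sgn m) (λ j → sgn (toℕ j) ℤ.* (M zero j ℤ.* detℤ m (N j)))))
  where
  open ℤSolver.+-*-Solver
  N : Fin (suc m) → Mat m
  N j i k = M (suc i) (punchIn j k)

alternate : Poly → Poly
alternate [] = []
alternate (a ∷ p) = a ∷ pscale -1ℤ (alternate p)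

evalℤ-alternate : ∀ p x → evalℤ (alternate p) x ≡ evalℤ p (ℤ.- x)
evalℤ-alternate [] x = refl
evalℤ-alternate (a ∷ p) x = trans
  (cong (λ z → a ℤ.+ x ℤ.* z) (trans (evalℤ-pscale -1ℤ (alternate p) x) (cong (λ z → -1ℤ ℤ.* z) (evalℤ-alternate p x))))
  (solve 3 (λ a x e → a :+ x :* (con -1ℤ :* e) := a :+ (:- x) :* e) refl a x (evalℤ p (ℤ.- x)))
  where open ℤSolver.+-*-Solver

coeff-alternate : ∀ p j → coeff (alternate p) j ≡ sgn j ℤ.* coeff p j
coeff-alternate [] j = sym (ℤₚ.*-zeroʳ (sgn j))
coeff-alternate (a ∷ p) zero = sym (ℤₚ.*-identityˡ a)
coeff-alternate (a ∷ p) (suc j) = trans (coeff-pscale -1ℤ (alternate p) j) (trans (cong (λ z → -1ℤ ℤ.* z) (coeff-alternate p j))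
  (solve 2 (λ s e → con -1ℤ :* (s :* e) := (:- s) :* e) refl (sgn j) (coeff p j)))
  where open ℤSolver.+-*-Solver

sgn-+ : ∀ a b → sgn (a + b) ≡ sgn a ℤ.* sgn b
sgn-+ zero b = sym (ℤₚ.*-identityˡ (sgn b))
sgn-+ (suc a) b = trans (cong ℤ.-_ (sgn-+ a b)) (ℤₚ.neg-distribˡ-* (sgn a) (sgn b))

module _ {n} (G : Graph n) where

  laplacianEntry : ℤ → Mat n
  laplacianEntry x i j = evalℤ (if toℕ i ≡ᵇ toℕ j then (ℤ.- int (deg G i)) ∷ 1ℤ ∷ [] else (if G i j then 1ℤ ∷ [] else 0ℤ ∷ [])) x

  toℕ-≡ᵇ-refl : ∀ (i : Fin n) → (toℕ i ≡ᵇ toℕ i) ≡ true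
  toℕ-≡ᵇ-refl i = T⇒≡ (ℕₚ.≡⇒≡ᵇ (toℕ i) (toℕ i) refl)

  toℕ-≡ᵇ-false : ∀ {i j : Fin n} → i ≢ j → (toℕ i ≡ᵇ toℕ j) ≡ false
  toℕ-≡ᵇ-false {i} {j} i≢j with toℕ i ≡ᵇ toℕ j in eq
  ... | false = refl
  ... | true = ⊥-elim (i≢j (Fₚ.toℕ-injective (ℕₚ.≡ᵇ⇒≡ (toℕ i) (toℕ j) (≡⇒T eq))))

  laplacianEntry-entry : (ι : Fin n → A) → ∀ x i j → laplacianEntry (ℤ.- int x) i j ≡ -1ℤ ℤ.* entry G (λ i → leaf (ι i)) x i j
  laplacianEntry-entry ι x i j with i F.≟ j
  ... | yes refl rewrite toℕ-≡ᵇ-refl i = trans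
    (solve 2 (λ d x → (:- d) :+ (:- x) :* (con 1ℤ :+ (:- x) :* con 0ℤ) := con -1ℤ :* (x :+ d :* con 1ℤ)) refl (int (deg G i)) (int x))
    (cong (λ z → -1ℤ ℤ.* z) (sym (trans (ℤₚ.pos-+ x (deg G i * 1)) (cong (λ z → int x ℤ.+ z) (ℤₚ.pos-* (deg G i) 1)))))
    where open ℤSolver.+-*-Solver
  ... | no i≢j rewrite toℕ-≡ᵇ-false i≢j with G i j
  ...   | true = solve 1 (λ x → con 1ℤ :+ (:- x) :* con 0ℤ := con -1ℤ :* (:- con 1ℤ)) refl (int x)
    where open ℤSolver.+-*-Solver
  ...   | false = solve 1 (λ x → con 0ℤ :+ (:- x) :* con 0ℤ := con -1ℤ :* con 0ℤ) refl (int x)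
    where open ℤSolver.+-*-Solver

-- At λ = -x the characteristic polynomial is (-1)^n det(xI + L). The sign of (-x)^(n-k) combines
-- with (-1)^n to (-1)^k, which is the sign in the definition of `c`.
c-formula : ∀ {n} {G : Graph n} {ι : Fin n → A} {X} → Pruning G (λ i → leaf (ι i)) X →
  ∀ k → k ≤ n → c G k ≡ int (coeffℕ (coeffs (F-poly X)) (n ∸ k))
c-formula {n = n} {G} {ι} {X} p k k≤n = begin
  sgn k ℤ.* coeff (charPoly G) j ≡⟨ cong (λ z → z ℤ.* coeff (charPoly G) j) sgn-k ⟩
  (sgn n ℤ.* sgn j) ℤ.* coeff (charPoly G) j ≡⟨ ℤₚ.*-assoc (sgn n) (sgn j) (coeff (charPoly G) j) ⟩
  sgn n ℤ.* (sgn j ℤ.* coeff (charPoly G) j) ≡⟨ cong (λ z → sgn n ℤ.* z) (sym (coeff-alternate (charPoly G) j)) ⟩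
  sgn n ℤ.* coeff (alternate (charPoly G)) j ≡⟨ sym (coeff-pscale (sgn n) (alternate (charPoly G)) j) ⟩
  coeff (pscale (sgn n) (alternate (charPoly G))) j
    ≡⟨ coeff-unique (pscale (sgn n) (alternate (charPoly G))) (map int (coeffs (F-poly X))) (λ x → values (suc x)) j ⟩
  coeff (map int (coeffs (F-poly X))) j ≡⟨ coeff-embed (coeffs (F-poly X)) j ⟩
  int (coeffℕ (coeffs (F-poly X)) j) ∎
  where
  open ≡-Reasoning
  j = n ∸ k
  sgn-k : sgn k ≡ sgn n ℤ.* sgn j
  sgn-k = sym (begin
    sgn n ℤ.* sgn j ≡⟨ cong (λ m → sgn m ℤ.* sgn j) (sym (ℕₚ.m∸n+n≡m k≤n)) ⟩
    sgn (j + k) ℤ.* sgn j ≡⟨ cong (λ z → z ℤ.* sgn j) (sgn-+ j k) ⟩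
    (sgn j ℤ.* sgn k) ℤ.* sgn j ≡⟨ trans (ℤₚ.*-comm (sgn j ℤ.* sgn k) (sgn j)) (cancel-sign (sgn j) (sgn-square j) (sgn k)) ⟩
    sgn k ∎)
  values : ∀ x → evalℤ (pscale (sgn n) (alternate (charPoly G))) (int x) ≡ evalℤ (map int (coeffs (F-poly X))) (int x)
  values x = begin
    evalℤ (pscale (sgn n) (alternate (charPoly G))) (int x) ≡⟨ evalℤ-pscale (sgn n) (alternate (charPoly G)) (int x) ⟩
    sgn n ℤ.* evalℤ (alternate (charPoly G)) (int x) ≡⟨ cong (λ z → sgn n ℤ.* z) (evalℤ-alternate (charPoly G) (int x)) ⟩
    sgn n ℤ.* evalℤ (charPoly G) (ℤ.- int x) ≡⟨ cong (λ z → sgn n ℤ.* z) (evalℤ-det n _ (ℤ.- int x)) ⟩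
    sgn n ℤ.* detℤ n (laplacianEntry G (ℤ.- int x)) ≡⟨ cong (λ z → sgn n ℤ.* z) (detℤ-cong n (laplacianEntry-entry G ι x)) ⟩
    sgn n ℤ.* detℤ n (λ i j → -1ℤ ℤ.* entry G (λ i → leaf (ι i)) x i j) ≡⟨ cong (λ z → sgn n ℤ.* z) (detℤ-negate n (entry G (λ i → leaf (ι i)) x)) ⟩
    sgn n ℤ.* (sgn n ℤ.* detℤ n (entry G (λ i → leaf (ι i)) x)) ≡⟨ cancel-sign (sgn n) (sgn-square n) _ ⟩
    detℤ n (entry G (λ i → leaf (ι i)) x) ≡⟨ pruning-det p x ⟩
    int (F X x) ≡⟨ cong int (sym (evaluate (F-poly X) x)) ⟩
    int (evalℕ (coeffs (F-poly X)) x) ≡⟨ sym (evalℤ-embed (coeffs (F-poly X)) x) ⟩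
    evalℤ (map int (coeffs (F-poly X))) (int x) ∎

-- Every graph of the class can be pruned

unique-neighbour : ∀ n (f : Fin n → Bool) → ℕΣ.sum (λ i → bit (f i)) ≡ 1 → ∃[ u ] (f u ≡ true × (∀ w → w ≢ u → f w ≡ false))
unique-neighbour (suc n) f eq with f zero in f₀
... | true = zero , f₀ , others
  where
  zeros : ∀ n (g : Fin n → Bool) → ℕΣ.sum (λ i → bit (g i)) ≡ 0 → ∀ i → g i ≡ false
  zeros (suc n) g h i with g zero in g₀
  zeros (suc n) g h zero | false = g₀
  zeros (suc n) g h (suc i) | false = zeros n (g ∘ F.suc) h i
  others : ∀ w → w ≢ zero → f w ≡ false
  others zero w≢0 = ⊥-elim (w≢0 refl)
  others (suc w) _ = zeros n (f ∘ F.suc) (ℕₚ.suc-injective eq) w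
... | false with unique-neighbour n (f ∘ F.suc) eq
...   | u , fu , h = suc u , fu , others
  where
  others : ∀ w → w ≢ suc u → f w ≡ false
  others zero _ = f₀
  others (suc w) w≢u = h w (λ w≡u → w≢u (cong F.suc w≡u))

-- Only opposite corners are required to differ; adjacent ones differ by irreflexivity.
FourCycle : ∀ {n} → Graph n → Set
FourCycle {n} G = Σ[ a ∈ Fin n ] Σ[ b ∈ Fin n ] Σ[ d ∈ Fin n ] Σ[ e ∈ Fin n ]
  (G a b ≡ true × G b d ≡ true × G d e ≡ true × G e a ≡ true × a ≢ d × b ≢ e)

HasCycle⇒FourCycle : ∀ {n} {G : Graph n} → HasCycle G 4 → FourCycle G
HasCycle⇒FourCycle (_ , f , inj , adj) = f (F.# 0) , f (F.# 1) , f (F.# 2) , f (F.# 3) ,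
  T⇒≡ (adj _ _ (inj₁ refl)) , T⇒≡ (adj _ _ (inj₁ refl)) , T⇒≡ (adj _ _ (inj₁ refl)) , T⇒≡ (adj _ _ (inj₂ (refl , refl))) ,
  (λ eq → 0≢2 (inj eq)) , (λ eq → 1≢3 (inj eq))
  where
  0≢2 : _≢_ {A = Fin 4} (F.# 0) (F.# 2)
  0≢2 ()
  1≢3 : _≢_ {A = Fin 4} (F.# 1) (F.# 3)
  1≢3 ()

module RemoveLeaf {n} (G : Graph (suc n)) (symm : Symmetric G) (irr : Irreflexive G)
  (v : Fin (suc n)) (u : Fin n) (edge : G v (punchIn v u) ≡ true) (no-edge : ∀ w → w ≢ u → G v (punchIn v w) ≡ false) where

  G⁻ : Graph n
  G⁻ i j = G (punchIn v i) (punchIn v j)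

  removal : LeafRemoval G v u G⁻
  removal = leafRemoval (λ i j → refl) (irr v) edge no-edge (λ w → symm (punchIn v w) v)

  only-neighbour : ∀ x → G v x ≡ true → x ≡ punchIn v u
  only-neighbour x vx with punchInView v x
  ... | hole = ⊥-elim (true≢false (trans (sym vx) (irr v)))
  ... | other w = cong (punchIn v) (LeafRemoval.neighbour removal w vx)

  connected⁻ : Connected G → Connected G⁻
  connected⁻ conn a b = proj₁ (avoid (conn (punchIn v a) (punchIn v b)) refl) a refl
    where
    -- A visit to `v` enters and leaves through `u` and can be cut out. The second component turns a
    -- walk starting at `v` into one starting at `u`.
    avoid : ∀ {x y b} → Walk G x y → y ≡ punchIn v b → (∀ a → x ≡ punchIn v a → Walk G⁻ a b) × (x ≡ v → Walk G⁻ u b)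
    avoid {b = b} here y≡ = (λ a x≡ → subst (λ z → Walk G⁻ z b) (Fₚ.punchIn-injective v b a (trans (sym y≡) x≡)) here) ,
      (λ x≡v → ⊥-elim (Fₚ.punchInᵢ≢i v b (trans (sym y≡) x≡v)))
    avoid {b = b} (step {v = z} e p) y≡ with avoid {b = b} p y≡
    ... | from-other , from-v = at-other , at-v
      where
      at-v : _ ≡ v → Walk G⁻ u b
      at-v refl = from-other u (only-neighbour z (T⇒≡ e))
      at-other : ∀ a → _ ≡ punchIn v a → Walk G⁻ a b
      at-other a refl with punchInView v z
      ... | other w = step e (from-other w refl)
      ... | hole = subst (λ z → Walk G⁻ z b) (Fₚ.punchIn-injective v u a (sym (only-neighbour (punchIn v a) (trans (symm v (punchIn v a)) (T⇒≡ e))))) (from-v refl)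

  -- If `v` were a corner, both corners next to it would be its only neighbour, although they are
  -- opposite and hence distinct.
  fourCycle⁻ : FourCycle G → FourCycle G⁻
  fourCycle⁻ (a , b , d , e , ab , bd , de , ea , a≢d , b≢e) with punchInView v a | punchInView v b | punchInView v d | punchInView v e
  ... | hole | _ | _ | _ = ⊥-elim (b≢e (trans (only-neighbour b ab) (sym (only-neighbour e (trans (symm v e) ea)))))
  ... | other _ | hole | _ | _ = ⊥-elim (a≢d (trans (only-neighbour a (trans (symm v a) ab)) (sym (only-neighbour d bd))))
  ... | other _ | other _ | hole | _ = ⊥-elim (b≢e (trans (only-neighbour b (trans (symm v b) bd)) (sym (only-neighbour e de))))
  ... | other _ | other _ | other _ | hole = ⊥-elim (a≢d (trans (only-neighbour a ea) (sym (only-neighbour d (trans (symm v d) de)))))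
  ... | other a′ | other b′ | other d′ | other e′ = a′ , b′ , d′ , e′ , ab , bd , de , ea ,
    (λ eq → a≢d (cong (punchIn v) eq)) , (λ eq → b≢e (cong (punchIn v) eq))

graft : ∀ {n} → Fin n → Tree A → (Fin n → Tree A) → Fin n → Tree A
graft u t lab w with w F.≟ u
... | yes _ = lab w ⋉ t
... | no _ = lab w

graft-at : ∀ {n} (u : Fin n) (t : Tree A) lab → graft u t lab u ≡ lab u ⋉ t
graft-at u t lab with u F.≟ u
... | yes _ = refl
... | no u≢u = ⊥-elim (u≢u refl)

graft-other : ∀ {n} (u : Fin n) (t : Tree A) lab w → w ≢ u → graft u t lab w ≡ lab w
graft-other u t lab w w≢u with w F.≟ u
... | yes w≡u = ⊥-elim (w≢u w≡u)
... | no _ = refl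

all-equal-2 : ∀ n (f : Fin n → ℕ) → (∀ i → 2 ≤ f i) → ℕΣ.sum f ≡ 2 * n → ∀ i → f i ≡ 2
all-equal-2 (suc n) f h eq = λ { zero → f₀≡2 ; (suc i) → all-equal-2 n (f ∘ F.suc) (h ∘ F.suc) tail≡ i }
  where
  lower : ∀ n (f : Fin n → ℕ) → (∀ i → 2 ≤ f i) → 2 * n ≤ ℕΣ.sum f
  lower zero f h = z≤n
  lower (suc n) f h = subst (_≤ ℕΣ.sum f) (sym (ℕₚ.*-suc 2 n)) (ℕₚ.+-mono-≤ (h zero) (lower n (f ∘ F.suc) (h ∘ F.suc)))
  total : f zero + ℕΣ.sum (f ∘ F.suc) ≡ 2 + 2 * n
  total = trans eq (ℕₚ.*-suc 2 n)
  f₀≡2 : f zero ≡ 2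
  f₀≡2 = ℕₚ.≤-antisym (ℕₚ.+-cancelʳ-≤ (2 * n) (f zero) 2
    (ℕₚ.≤-trans (ℕₚ.+-monoʳ-≤ (f zero) (lower n (f ∘ F.suc) (h ∘ F.suc))) (ℕₚ.≤-reflexive total))) (h zero)
  tail≡ : ℕΣ.sum (f ∘ F.suc) ≡ 2 * n
  tail≡ = ℕₚ.+-cancelˡ-≡ 2 _ _ (trans (cong (_+ ℕΣ.sum (f ∘ F.suc)) (sym f₀≡2)) total)

edge⇒degree : ∀ {n} (G : Graph n) u w → G u w ≡ true → 1 ≤ deg G u
edge⇒degree {suc n} G u w uw = subst (1 ≤_) (sym (trans (deg-sum G u) (ℕΣ.sum-remove {i = w} (λ j → bit (G u j)))))
  (subst (λ b → 1 ≤ bit b + ℕΣ.sum (λ j → bit (G u (punchIn w j)))) (sym uw) (s≤s z≤n))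

degree-2-neighbours : ∀ {n} (G : Graph n) x p q y → deg G x ≡ 2 → G x p ≡ true → G x q ≡ true → p ≢ q → G x y ≡ true → y ≡ p ⊎ y ≡ q
degree-2-neighbours {suc n} G x p q y d xp xq p≢q xy
  with unique-neighbour n (λ w → G x (punchIn p w)) rest | punchInView p q | punchInView p y
  where
  rest : ℕΣ.sum (λ w → bit (G x (punchIn p w))) ≡ 1
  rest = ℕₚ.suc-injective (trans (sym (trans (ℕΣ.sum-remove {i = p} (λ j → bit (G x j)))
    (cong (λ b → bit b + ℕΣ.sum (λ w → bit (G x (punchIn p w)))) xp))) (trans (sym (deg-sum G x)) d))
... | _ | hole | _ = ⊥-elim (p≢q refl)
... | _ | _ | hole = inj₁ refl
... | u , _ , only | other q′ | other y′ = inj₂ (cong (punchIn p) (trans (is-u y′ xy) (sym (is-u q′ xq))))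
  where
  is-u : ∀ w → G x (punchIn p w) ≡ true → w ≡ u
  is-u w eq with w F.≟ u
  ... | yes w≡u = w≡u
  ... | no w≢u = ⊥-elim (true≢false (trans (sym eq) (only w w≢u)))

-- Each corner already has its two neighbours among the corners. Hence there is no diagonal, and by
-- connectedness no further vertex.
module TwoRegular {n} (G : Graph n) (symm : Symmetric G) (irr : Irreflexive G) (conn : Connected G) (regular : ∀ i → deg G i ≡ 2)
  (a b d e : Fin n) (ab : G a b ≡ true) (bd : G b d ≡ true) (de : G d e ≡ true) (ea : G e a ≡ true) (a≢d : a ≢ d) (b≢e : b ≢ e) where

  adjacent⇒≢ : ∀ {x y} → G x y ≡ true → x ≢ y
  adjacent⇒≢ {x} xy refl = true≢false (trans (sym xy) (irr x))

  flip : ∀ {x y} → G x y ≡ true → G y x ≡ true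
  flip {x} {y} xy = trans (symm y x) xy

  corner : Fin 4 → Fin n
  corner = FourByFour.vec a b d e

  data OnCycle : Fin n → Set where
    at : ∀ i → OnCycle (corner i)

  closed : ∀ {x y} → OnCycle x → G x y ≡ true → OnCycle y
  closed {y = y} (at zero) xy with degree-2-neighbours G a b e y (regular a) ab (flip ea) b≢e xy
  ... | inj₁ refl = at (F.# 1)
  ... | inj₂ refl = at (F.# 3)
  closed {y = y} (at (suc zero)) xy with degree-2-neighbours G b a d y (regular b) (flip ab) bd a≢d xy
  ... | inj₁ refl = at (F.# 0)
  ... | inj₂ refl = at (F.# 2)
  closed {y = y} (at (suc (suc zero))) xy with degree-2-neighbours G d b e y (regular d) (flip bd) de b≢e xy
  ... | inj₁ refl = at (F.# 1)
  ... | inj₂ refl = at (F.# 3)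
  closed {y = y} (at (suc (suc (suc zero)))) xy with degree-2-neighbours G e a d y (regular e) ea (flip de) a≢d xy
  ... | inj₁ refl = at (F.# 0)
  ... | inj₂ refl = at (F.# 2)

  reach : ∀ {x y} → Walk G x y → OnCycle x → OnCycle y
  reach here on = on
  reach (step xz p) on = reach p (closed on (T⇒≡ xz))

  on-cycle : ∀ x → OnCycle x
  on-cycle x = reach (conn a x) (at (F.# 0))

  index : ∀ {x} → OnCycle x → Fin 4
  index (at i) = i

  corner-index : ∀ {x} (on : OnCycle x) → corner (index on) ≡ x
  corner-index (at i) = refl

  ¬ad : G a d ≡ false
  ¬ad with G a d in eq
  ... | false = refl
  ... | true with degree-2-neighbours G a b e d (regular a) ab (flip ea) b≢e eq
  ...   | inj₁ d≡b = ⊥-elim (adjacent⇒≢ bd (sym d≡b))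
  ...   | inj₂ d≡e = ⊥-elim (adjacent⇒≢ de d≡e)

  ¬be : G b e ≡ false
  ¬be with G b e in eq
  ... | false = refl
  ... | true with degree-2-neighbours G b a d e (regular b) (flip ab) bd a≢d eq
  ...   | inj₁ e≡a = ⊥-elim (adjacent⇒≢ ea e≡a)
  ...   | inj₂ e≡d = ⊥-elim (adjacent⇒≢ de (sym e≡d))

  corner-adjacency : ∀ i j → G (corner i) (corner j) ≡ C₄ i j
  corner-adjacency zero zero = irr a
  corner-adjacency zero (suc zero) = ab
  corner-adjacency zero (suc (suc zero)) = ¬ad
  corner-adjacency zero (suc (suc (suc zero))) = flip ea
  corner-adjacency (suc zero) zero = flip ab
  corner-adjacency (suc zero) (suc zero) = irr b
  corner-adjacency (suc zero) (suc (suc zero)) = bd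
  corner-adjacency (suc zero) (suc (suc (suc zero))) = ¬be
  corner-adjacency (suc (suc zero)) zero = trans (symm d a) ¬ad
  corner-adjacency (suc (suc zero)) (suc zero) = flip bd
  corner-adjacency (suc (suc zero)) (suc (suc zero)) = irr d
  corner-adjacency (suc (suc zero)) (suc (suc (suc zero))) = de
  corner-adjacency (suc (suc (suc zero))) zero = ea
  corner-adjacency (suc (suc (suc zero))) (suc zero) = trans (symm e b) ¬be
  corner-adjacency (suc (suc (suc zero))) (suc (suc zero)) = flip de
  corner-adjacency (suc (suc (suc zero))) (suc (suc (suc zero))) = irr e

  corner-injective : ∀ i j → corner i ≡ corner j → i ≡ j
  corner-injective i j eq with i F.≟ j
  ... | yes i≡j = i≡j
  ... | no i≢j = ⊥-elim (distinct i j i≢j eq)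
    where
    distinct : ∀ i j → i ≢ j → corner i ≢ corner j
    distinct zero zero h = λ _ → h refl
    distinct zero (suc zero) h = adjacent⇒≢ ab
    distinct zero (suc (suc zero)) h = a≢d
    distinct zero (suc (suc (suc zero))) h = adjacent⇒≢ (flip ea)
    distinct (suc zero) zero h = adjacent⇒≢ (flip ab)
    distinct (suc zero) (suc zero) h = λ _ → h refl
    distinct (suc zero) (suc (suc zero)) h = adjacent⇒≢ bd
    distinct (suc zero) (suc (suc (suc zero))) h = b≢e
    distinct (suc (suc zero)) zero h = λ eq → a≢d (sym eq)
    distinct (suc (suc zero)) (suc zero) h = adjacent⇒≢ (flip bd)
    distinct (suc (suc zero)) (suc (suc zero)) h = λ _ → h refl
    distinct (suc (suc zero)) (suc (suc (suc zero))) h = adjacent⇒≢ de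
    distinct (suc (suc (suc zero))) zero h = adjacent⇒≢ ea
    distinct (suc (suc (suc zero))) (suc zero) h = λ eq → b≢e (sym eq)
    distinct (suc (suc (suc zero))) (suc (suc zero)) h = adjacent⇒≢ (flip de)
    distinct (suc (suc (suc zero))) (suc (suc (suc zero))) h = λ _ → h refl

  fg : ∀ x → corner (index (on-cycle x)) ≡ x
  fg x = corner-index (on-cycle x)

  gf : ∀ i → index (on-cycle (corner i)) ≡ i
  gf i = corner-injective _ i (fg (corner i))

  order≡4 : 4 ≡ n
  order≡4 = Fₚ.cantor-schröder-bernstein {f = corner} {g = λ x → index (on-cycle x)} (λ {i} {j} → corner-injective i j)
    (λ {x} {y} eq → trans (sym (fg x)) (trans (cong corner eq) (fg y)))

-- The size enters as an equation on a variable n, so that matching replaces n by 4, as `square`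
-- demands.
square-pruning : ∀ {n} (G : Graph n) (lab : Fin n → Tree A) → 4 ≡ n → (f : Fin 4 → Fin n) (g : Fin n → Fin 4) → (∀ i → f (g i) ≡ i) → (∀ i → g (f i) ≡ i) →
  (∀ i j → G (f i) (f j) ≡ C₄ i j) → ∃[ X ] Pruning G lab X
square-pruning G lab refl f g fg gf adj = X , square f g fg gf adj label
  where
  X = cyclic (lab (f (F.# 0))) (lab (f (F.# 1))) (lab (f (F.# 2))) (lab (f (F.# 3)))
  label : ∀ i → lab (f i) ≡ nth X i
  label zero = refl
  label (suc zero) = refl
  label (suc (suc zero)) = refl
  label (suc (suc (suc zero))) = refl

-- Removing a leaf keeps the degree sum at twice the order. When no leaf is left, all degrees are at
-- least 2 with average 2, so the graph is 2-regular and equals its 4-cycle.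
pruning-exists : ∀ n (G : Graph n) (lab : Fin n → Tree A) → Symmetric G → Irreflexive G → Connected G →
  ℕΣ.sum (deg G) ≡ 2 * n → FourCycle G → ∃[ X ] Pruning G lab X
pruning-exists zero G lab symm irr conn degs (() , _)
pruning-exists (suc n) G lab symm irr conn degs cyc with Fₚ.any? (λ v → deg G v ℕₚ.≟ 1)
... | yes (v , deg≡1) with unique-neighbour n (λ w → G v (punchIn v w)) (trans (sym (trans (deg-sum G v) (trans (ℕΣ.sum-remove {i = v} (λ j → bit (G v j))) (cong (λ b → bit b + ℕΣ.sum (λ w → bit (G v (punchIn v w)))) (irr v))))) deg≡1)
...   | u , edge , no-edge = proj₁ rec , prune v u G⁻ (graft u (lab v) (λ w → lab (punchIn v w))) removal
        (grafting (graft-at u (lab v) _) (graft-other u (lab v) _)) (proj₂ rec)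
  where
  open RemoveLeaf G symm irr v u edge no-edge
  rec = pruning-exists n G⁻ (graft u (lab v) (λ w → lab (punchIn v w))) (λ i j → symm _ _) (λ i → irr _) (connected⁻ conn)
    (ℕₚ.+-cancelˡ-≡ 2 _ _ (trans (sym (LeafRemoval.degSum-removal removal))
      (trans degs (ℕₚ.*-suc 2 n))))
    (fourCycle⁻ cyc)
pruning-exists (suc n) G lab symm irr conn degs (a , b , d , e , ab , bd , de , ea , a≢d , b≢e) | no no-leaf =
  square-pruning G lab order≡4 corner (λ x → index (on-cycle x)) fg gf corner-adjacency
  where
  nonisolated : ∀ u → 1 ≤ deg G u
  nonisolated u with conn u a
  ... | here = edge⇒degree G u b ab
  ... | step {v = w} e p = edge⇒degree G u w (T⇒≡ e)
  at-least-2 : ∀ u → 2 ≤ deg G u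
  at-least-2 u with ℕₚ.m≤n⇒m<n∨m≡n (nonisolated u)
  ... | inj₁ lt = lt
  ... | inj₂ eq = ⊥-elim (no-leaf (u , sym eq))
  open TwoRegular G symm irr conn (all-equal-2 (suc n) (deg G) at-least-2 degs) a b d e ab bd de ea a≢d b≢e

UniSet⇒pruning : ∀ {n l} (G : Graph n) (ι : Fin n → A) → UniSet n l 4 G → ∃[ X ] Pruning G (λ i → leaf (ι i)) X
UniSet⇒pruning {n = n} G ι (symm , irr , (conn , degs) , _ , cyc , _) =
  pruning-exists n G (λ i → leaf (ι i)) symm irr conn (trans (sym (sum-tabulate n (deg G) id)) degs) (HasCycle⇒FourCycle {G = G} cyc)

-- Pruning U n l 4 q

edgeᵇ : ℕ → ℕ → ℕ → ℕ → Bool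
edgeᵇ a b i j = ((a ≡ᵇ i) ∧ (b ≡ᵇ j)) ∨ ((b ≡ᵇ i) ∧ (a ≡ᵇ j))

adjacentᵇ : Edges → ℕ → ℕ → Bool
adjacentᵇ [] i j = false
adjacentᵇ ((a , b) ∷ es) i j = edgeᵇ a b i j ∨ adjacentᵇ es i j

fromEdges-adjacentᵇ : ∀ {n} es (i j : Fin n) → fromEdges es i j ≡ adjacentᵇ es (toℕ i) (toℕ j)
fromEdges-adjacentᵇ [] i j = refl
fromEdges-adjacentᵇ ((a , b) ∷ es) i j = cong (edgeᵇ a b (toℕ i) (toℕ j) ∨_) (fromEdges-adjacentᵇ es i j)

adjacentᵇ-++ : ∀ es fs i j → adjacentᵇ (es ++ fs) i j ≡ adjacentᵇ es i j ∨ adjacentᵇ fs i j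
adjacentᵇ-++ [] fs i j = refl
adjacentᵇ-++ ((a , b) ∷ es) fs i j = trans (cong (edgeᵇ a b i j ∨_) (adjacentᵇ-++ es fs i j))
  (sym (Boolₚ.∨-assoc (edgeᵇ a b i j) (adjacentᵇ es i j) (adjacentᵇ fs i j)))

≡ᵇ-refl : ∀ i → (i ≡ᵇ i) ≡ true
≡ᵇ-refl i = T⇒≡ (ℕₚ.≡⇒≡ᵇ i i refl)

≡ᵇ-false : ∀ {i j} → i ≢ j → (i ≡ᵇ j) ≡ false
≡ᵇ-false {i} {j} i≢j with i ≡ᵇ j in eq
... | false = refl
... | true = ⊥-elim (i≢j (ℕₚ.≡ᵇ⇒≡ i j (≡⇒T eq)))

edgeᵇ-symmetric : ∀ a b i j → edgeᵇ a b i j ≡ edgeᵇ a b j i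
edgeᵇ-symmetric a b i j = trans (Boolₚ.∨-comm ((a ≡ᵇ i) ∧ (b ≡ᵇ j)) ((b ≡ᵇ i) ∧ (a ≡ᵇ j)))
  (cong₂ _∨_ (Boolₚ.∧-comm (b ≡ᵇ i) (a ≡ᵇ j)) (Boolₚ.∧-comm (a ≡ᵇ i) (b ≡ᵇ j)))

adjacentᵇ-symmetric : ∀ es i j → adjacentᵇ es i j ≡ adjacentᵇ es j i
adjacentᵇ-symmetric [] i j = refl
adjacentᵇ-symmetric ((a , b) ∷ es) i j = cong₂ _∨_ (edgeᵇ-symmetric a b i j) (adjacentᵇ-symmetric es i j)

Below : ℕ → Edges → Set
Below m = All (λ e → proj₁ e < m × proj₂ e < m)

adjacentᵇ-above : ∀ {m} es j → Below m es → adjacentᵇ es m j ≡ false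
adjacentᵇ-above [] j [] = refl
adjacentᵇ-above {m} ((a , b) ∷ es) j ((a<m , b<m) ∷ h) = cong₂ _∨_
  (cong₂ (λ x y → (x ∧ (b ≡ᵇ j)) ∨ (y ∧ (a ≡ᵇ j))) (≡ᵇ-false (ℕₚ.<⇒≢ a<m)) (≡ᵇ-false (ℕₚ.<⇒≢ b<m)))
  (adjacentᵇ-above es j h)

data Grown : ℕ → Edges → ℕ → Set where
  done : ∀ {m} → Grown m [] m
  grow : ∀ {p m es m′} → p < m → Grown (suc m) es m′ → Grown m ((p , m) ∷ es) m′

graftℕ : ℕ → Tree A → (ℕ → Tree A) → ℕ → Tree A
graftℕ p t lab i with i ℕₚ.≟ p
... | yes _ = lab i ⋉ t
... | no _ = lab i

graftℕ-at : ∀ p (t : Tree A) lab → graftℕ p t lab p ≡ lab p ⋉ t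
graftℕ-at p t lab with p ℕₚ.≟ p
... | yes _ = refl
... | no p≢p = ⊥-elim (p≢p refl)

graftℕ-other : ∀ p (t : Tree A) lab i → i ≢ p → graftℕ p t lab i ≡ lab i
graftℕ-other p t lab i i≢p with i ℕₚ.≟ p
... | yes i≡p = ⊥-elim (i≢p i≡p)
... | no _ = refl

-- The trees present once all edges of the list have been pruned, the last one first; what is
-- grafted at `p` is therefore the finished tree at `m`.
absorb : Edges → (ℕ → Tree A) → ℕ → Tree A
absorb [] lab = lab
absorb ((p , m) ∷ es) lab = graftℕ p (absorb es lab m) (absorb es lab)

toℕ-punchIn-last : ∀ m (i : Fin m) → toℕ (punchIn (F.fromℕ m) i) ≡ toℕ i
toℕ-punchIn-last (suc m) zero = refl
toℕ-punchIn-last (suc m) (suc i) = cong suc (toℕ-punchIn-last m i)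

prune-last : ∀ {p m} (lab lab′ : ℕ → Tree A) {X} (base : Edges) → Below m base → p < m →
  lab′ p ≡ lab p ⋉ lab m → (∀ i → i ≢ p → lab′ i ≡ lab i) →
  Pruning {n = m} (fromEdges base) (λ i → lab′ (toℕ i)) X →
  Pruning {n = suc m} (fromEdges (base ++ (p , m) ∷ [])) (λ i → lab (toℕ i)) X
prune-last {p = p} {m} lab lab′ base below p<m at-p elsewhere P = prune v u (fromEdges base) (λ i → lab′ (toℕ i))
  (leafRemoval restrict loop edge no-edge symmetric) (grafting label-u label-w) P
  where
  v = F.fromℕ m
  u = F.fromℕ< p<m
  p≢m : p ≢ m
  p≢m = ℕₚ.<⇒≢ p<m
  toℕ-v : toℕ v ≡ m
  toℕ-v = Fₚ.toℕ-fromℕ m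
  toℕ-other : ∀ w → toℕ (punchIn v w) ≡ toℕ w
  toℕ-other = toℕ-punchIn-last m
  toℕ-u : toℕ (punchIn v u) ≡ p
  toℕ-u = trans (toℕ-other u) (Fₚ.toℕ-fromℕ< p<m)
  G = fromEdges {n = suc m} (base ++ (p , m) ∷ [])
  adjacency : ∀ i j {x y} → toℕ i ≡ x → toℕ j ≡ y → G i j ≡ adjacentᵇ base x y ∨ (edgeᵇ p m x y ∨ false)
  adjacency i j refl refl = trans (fromEdges-adjacentᵇ (base ++ (p , m) ∷ []) i j) (adjacentᵇ-++ base ((p , m) ∷ []) (toℕ i) (toℕ j))
  fresh : ∀ i → (m ≡ᵇ toℕ {n = m} i) ≡ false
  fresh i = ≡ᵇ-false (λ eq → ℕₚ.<⇒≢ (Fₚ.toℕ<n i) (sym eq))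
  restrict : ∀ i j → fromEdges base i j ≡ G (punchIn v i) (punchIn v j)
  restrict i j = trans (fromEdges-adjacentᵇ base i j) (sym (trans (adjacency (punchIn v i) (punchIn v j) (toℕ-other i) (toℕ-other j))
    (trans (cong (λ z → adjacentᵇ base (toℕ i) (toℕ j) ∨ (z ∨ false)) (cong₂ _∨_
      (trans (cong ((p ≡ᵇ toℕ i) ∧_) (fresh j)) (Boolₚ.∧-zeroʳ (p ≡ᵇ toℕ i))) (cong (_∧ (p ≡ᵇ toℕ j)) (fresh i))))
      (Boolₚ.∨-identityʳ (adjacentᵇ base (toℕ i) (toℕ j))))))
  last-row : ∀ j → adjacentᵇ base m j ∨ (edgeᵇ p m m j ∨ false) ≡ (p ≡ᵇ j)
  last-row j = trans (cong₂ (λ x y → x ∨ (y ∨ false)) (adjacentᵇ-above base j below)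
    (cong₂ (λ x y → (x ∧ (m ≡ᵇ j)) ∨ (y ∧ (p ≡ᵇ j))) (≡ᵇ-false p≢m) (≡ᵇ-refl m))) (Boolₚ.∨-identityʳ (p ≡ᵇ j))
  loop : G v v ≡ false
  loop = trans (adjacency v v toℕ-v toℕ-v) (trans (last-row m) (≡ᵇ-false p≢m))
  edge : G v (punchIn v u) ≡ true
  edge = trans (adjacency v (punchIn v u) toℕ-v toℕ-u) (trans (last-row p) (≡ᵇ-refl p))
  no-edge : ∀ w → w ≢ u → G v (punchIn v w) ≡ false
  no-edge w w≢u = trans (adjacency v (punchIn v w) toℕ-v (toℕ-other w)) (trans (last-row (toℕ w))
    (≡ᵇ-false (λ eq → w≢u (Fₚ.toℕ-injective (trans (sym eq) (sym (Fₚ.toℕ-fromℕ< p<m)))))))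
  symmetric : ∀ w → G (punchIn v w) v ≡ G v (punchIn v w)
  symmetric w = trans (fromEdges-adjacentᵇ es (punchIn v w) v) (trans (adjacentᵇ-symmetric es (toℕ (punchIn v w)) (toℕ v))
    (sym (fromEdges-adjacentᵇ es v (punchIn v w))))
    where es = base ++ (p , m) ∷ []
  label-u : lab′ (toℕ u) ≡ lab (toℕ (punchIn v u)) ⋉ lab (toℕ v)
  label-u = trans (cong lab′ (Fₚ.toℕ-fromℕ< p<m)) (trans at-p (sym (cong₂ (λ x y → lab x ⋉ lab y) toℕ-u toℕ-v)))
  label-w : ∀ w → w ≢ u → lab′ (toℕ w) ≡ lab (toℕ (punchIn v w))
  label-w w w≢u = trans (elsewhere (toℕ w) (λ eq → w≢u (Fₚ.toℕ-injective (trans eq (sym (Fₚ.toℕ-fromℕ< p<m)))))) (cong lab (sym (toℕ-other w)))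

grown-pruning : ∀ {m m′ es} → Grown m es m′ → (base : Edges) → Below m base → (lab : ℕ → Tree A) {X : Cyclic A} →
  Pruning {n = m} (fromEdges base) (λ i → absorb es lab (toℕ i)) X →
  Pruning {n = m′} (fromEdges (base ++ es)) (λ i → lab (toℕ i)) X
grown-pruning {m = m} done base below lab {X} P = subst (λ es → Pruning {n = m} (fromEdges es) (λ i → lab (toℕ i)) X) (sym (Lₚ.++-identityʳ base)) P
grown-pruning {m′ = m′} {es = (p , m) ∷ es} (grow p<m g) base below lab {X} P =
  subst (λ es → Pruning {n = m′} (fromEdges es) (λ i → lab (toℕ i)) X) (Lₚ.++-assoc base ((p , m) ∷ []) es)
    (grown-pruning g (base ++ (p , m) ∷ []) (Allₚ.++⁺ (All.map (λ (h , k) → ℕₚ.m≤n⇒m≤1+n h , ℕₚ.m≤n⇒m≤1+n k) below) ((ℕₚ.m≤n⇒m≤1+n p<m , ℕₚ.n<1+n m) ∷ [])) lab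
      (prune-last (absorb es lab) (absorb ((p , m) ∷ es) lab) base below p<m (graftℕ-at p _ _) (graftℕ-other p _ _) P))

grown-++ : ∀ {a b d es fs} → Grown a es b → Grown b fs d → Grown a (es ++ fs) d
grown-++ done h = h
grown-++ (grow lt g) h = grow lt (grown-++ g h)

grown-chain : ∀ v k → Grown (suc v) (chain v k) (suc v + k)
grown-chain v zero = subst (Grown (suc v) []) (sym (ℕₚ.+-identityʳ (suc v))) done
grown-chain v (suc k) = grow (ℕₚ.n<1+n v) (subst (Grown (suc (suc v)) (chain (suc v) k)) (sym (ℕₚ.+-suc (suc v) k)) (grown-chain (suc v) k))

grown-arm : ∀ ct s k → ct < s → Grown s (armEdges ct s k) (s + k)
grown-arm ct s zero lt = subst (Grown s []) (sym (ℕₚ.+-identityʳ s)) done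
grown-arm ct s (suc k) lt = grow lt (subst (Grown (suc s) (chain s k)) (sym (ℕₚ.+-suc s k)) (grown-chain s k))

grown-arms : ∀ ct s ks → ct < s → Grown s (arms ct s ks) (s + sum ks)
grown-arms ct s [] lt = subst (Grown s []) (sym (ℕₚ.+-identityʳ s)) done
grown-arms ct s (k ∷ ks) lt = grown-++ (grown-arm ct s k lt)
  (subst (Grown (s + k) (arms ct (s + k) ks)) (ℕₚ.+-assoc s k (sum ks)) (grown-arms ct (s + k) ks (ℕₚ.≤-trans lt (ℕₚ.m≤m+n s k))))

grown-path : ∀ q → Grown 4 (pathEdges 4 q) (4 + q)
grown-path zero = done
grown-path (suc k) = grow (s≤s z≤n) (subst (Grown 5 (chain 4 k)) (sym (ℕₚ.+-suc 4 k)) (grown-chain 4 k))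

absorb-++ : ∀ es fs (lab : ℕ → Tree A) → absorb (es ++ fs) lab ≡ absorb es (absorb fs lab)
absorb-++ [] fs lab = refl
absorb-++ ((p , m) ∷ es) fs lab = cong (λ f → graftℕ p (f m) f) (absorb-++ es fs lab)

absorb-untouched : ∀ es (lab : ℕ → Tree A) i → All (λ e → i ≢ proj₁ e) es → absorb es lab i ≡ lab i
absorb-untouched [] lab i [] = refl
absorb-untouched ((p , m) ∷ es) lab i (i≢p ∷ h) = trans (graftℕ-other p _ _ i i≢p) (absorb-untouched es lab i h)

chain-parents : ∀ {i} v k → i < v → All (λ e → i ≢ proj₁ e) (chain v k)
chain-parents v zero lt = []
chain-parents v (suc k) lt = ℕₚ.<⇒≢ lt ∷ chain-parents (suc v) k (ℕₚ.m≤n⇒m≤1+n lt)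

arm-parents : ∀ {i} ct s k → i ≢ ct → i < s → All (λ e → i ≢ proj₁ e) (armEdges ct s k)
arm-parents ct s zero i≢ lt = []
arm-parents ct s (suc k) i≢ lt = i≢ ∷ chain-parents s k lt

arms-parents : ∀ {i} ct s ks → i ≢ ct → i < s → All (λ e → i ≢ proj₁ e) (arms ct s ks)
arms-parents ct s [] i≢ lt = []
arms-parents ct s (k ∷ ks) i≢ lt = Allₚ.++⁺ (arm-parents ct s k i≢ lt) (arms-parents ct (s + k) ks i≢ (ℕₚ.≤-trans lt (ℕₚ.m≤m+n s k)))

consecutiveFrom : ℕ → ℕ → List ℕ
consecutiveFrom s zero = []
consecutiveFrom s (suc k) = s ∷ consecutiveFrom (suc s) k

length-consecutiveFrom : ∀ s k → length (consecutiveFrom s k) ≡ k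
length-consecutiveFrom s zero = refl
length-consecutiveFrom s (suc k) = cong suc (length-consecutiveFrom (suc s) k)

absorb-chain : ∀ v k (lab : ℕ → Tree ℕ) → (∀ i → v ≤ i → i < v + k → lab i ≡ leaf i) →
  absorb (chain v k) lab v ≡ stem (consecutiveFrom v k) (lab (v + k))
absorb-chain v zero lab h = cong lab (sym (ℕₚ.+-identityʳ v))
absorb-chain v (suc k) lab h = trans (graftℕ-at v _ _) (cong₂ _⋉_
  (trans (absorb-untouched (chain (suc v) k) lab v (chain-parents (suc v) k (ℕₚ.n<1+n v))) (h v ℕₚ.≤-refl (ℕₚ.m<m+n v (s≤s z≤n))))
  (trans (absorb-chain (suc v) k lab (λ i v≤i i< → h i (ℕₚ.<⇒≤ v≤i) (subst (i <_) (sym (ℕₚ.+-suc v k)) i<)))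
    (cong (λ z → stem (consecutiveFrom (suc v) k) (lab z)) (sym (ℕₚ.+-suc v k)))))

stem-path : ∀ v k → stem (consecutiveFrom v k) (leaf (v + k)) ≡ path v (consecutiveFrom (suc v) k)
stem-path v zero = cong leaf (ℕₚ.+-identityʳ v)
stem-path v (suc k) = cong (leaf v ⋉_) (trans (cong (λ z → stem (consecutiveFrom (suc v) k) (leaf z)) (ℕₚ.+-suc v k)) (stem-path (suc v) k))

-- An arm of length 0 yields no leg; `s + 0` matches the recursion of `arms`.
armLegs : ℕ → List ℕ → List (Leg ℕ)
armLegs s [] = []
armLegs s (zero ∷ ks) = armLegs (s + 0) ks
armLegs s (suc k ∷ ks) = (s , consecutiveFrom (suc s) k) ∷ armLegs (s + suc k) ks

nodes-armLegs : ∀ s ks → All (0 <_) ks → map nodes (armLegs s ks) ≡ ks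
nodes-armLegs s [] [] = refl
nodes-armLegs s (suc k ∷ ks) (_ ∷ h) = cong₂ _∷_ (cong suc (length-consecutiveFrom (suc s) k)) (nodes-armLegs (s + suc k) ks h)

absorb-arms : ∀ ct s ks → ct < s → absorb (arms ct s ks) leaf ct ≡ legs ct (armLegs s ks)
absorb-arms ct s [] lt = refl
absorb-arms ct s (zero ∷ ks) lt = absorb-arms ct (s + 0) ks (ℕₚ.≤-trans lt (ℕₚ.m≤m+n s 0))
absorb-arms ct s (suc k ∷ ks) lt = trans (cong (λ f → f ct) (absorb-++ (armEdges ct s (suc k)) rest leaf))
  (trans (graftℕ-at ct _ _) (cong₂ _⋉_
    (trans (absorb-untouched (chain s k) lab ct (chain-parents s k lt)) (absorb-arms ct (s + suc k) ks (ℕₚ.≤-trans lt (ℕₚ.m≤m+n s (suc k)))))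
    (trans (absorb-chain s k lab (λ i s≤i i< → fresh i s≤i (ℕₚ.<⇒≤ (subst (suc i ≤_) refl i<))))
      (trans (cong (stem (consecutiveFrom s k)) (fresh (s + k) (ℕₚ.m≤m+n s k) ℕₚ.≤-refl)) (stem-path s k)))))
  where
  rest = arms ct (s + suc k) ks
  lab = absorb rest leaf
  fresh : ∀ i → s ≤ i → i ≤ s + k → lab i ≡ leaf i
  fresh i s≤i i≤ = absorb-untouched rest leaf i
    (arms-parents ct (s + suc k) ks (λ eq → ℕₚ.<⇒≢ (ℕₚ.<-≤-trans lt s≤i) (sym eq)) (ℕₚ.≤-trans (s≤s i≤) (ℕₚ.≤-reflexive (sym (ℕₚ.+-suc s k)))))

centre< : ∀ q → centre 4 q < 4 + q
centre< zero = s≤s z≤n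
centre< (suc k) = ℕₚ.≤-reflexive (sym (ℕₚ.+-suc 4 k))

module UPruning (q : ℕ) (ks : List ℕ) where

  tail : Edges
  tail = pathEdges 4 q ++ arms (centre 4 q) (4 + q) ks

  stemLabels : ℕ → List ℕ
  stemLabels zero = []
  stemLabels (suc k) = 0 ∷ consecutiveFrom 4 k

  length-stemLabels : ∀ q → length (stemLabels q) ≡ q
  length-stemLabels zero = refl
  length-stemLabels (suc k) = cong suc (length-consecutiveFrom 4 k)

  uStructure : Cyclic ℕ
  uStructure = cyclic (stem (stemLabels q) (legs (centre 4 q) (armLegs (4 + q) ks))) (leaf 1) (leaf 2) (leaf 3)

  path-parents : ∀ {i} q → i ≢ 0 → i < 4 → All (λ e → i ≢ proj₁ e) (pathEdges 4 q)
  path-parents zero i≢ lt = []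
  path-parents (suc k) i≢ lt = i≢ ∷ chain-parents 4 k lt

  absorb-root : ∀ q → absorb (pathEdges 4 q ++ arms (centre 4 q) (4 + q) ks) leaf 0 ≡ stem (stemLabels q) (legs (centre 4 q) (armLegs (4 + q) ks))
  absorb-root zero = absorb-arms 0 4 ks (s≤s z≤n)
  absorb-root (suc k) = trans (cong (λ f → f 0) (absorb-++ (pathEdges 4 (suc k)) rest leaf)) (trans (graftℕ-at 0 (absorb (chain 4 k) lab 4) (absorb (chain 4 k) lab)) (cong₂ _⋉_
    (trans (absorb-untouched (chain 4 k) lab 0 (chain-parents 4 k (s≤s z≤n))) (untouched 0 (s≤s z≤n)))
    (trans (absorb-chain 4 k lab (λ i _ i< → untouched i i<)) (cong (stem (consecutiveFrom 4 k)) (absorb-arms (4 + k) (4 + suc k) ks (centre< (suc k)))))))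
    where
    rest = arms (4 + k) (4 + suc k) ks
    lab = absorb rest leaf
    untouched : ∀ i → i < 4 + k → lab i ≡ leaf i
    untouched i lt = absorb-untouched rest leaf i (arms-parents (4 + k) (4 + suc k) ks (ℕₚ.<⇒≢ lt) (ℕₚ.<-≤-trans lt (ℕₚ.+-monoʳ-≤ 4 (ℕₚ.n≤1+n k))))

  absorb-corner : ∀ i → i ≢ 0 → i < 4 → absorb tail leaf i ≡ leaf i
  absorb-corner i i≢0 lt = absorb-untouched tail leaf i (Allₚ.++⁺ (path-parents q i≢0 lt)
    (arms-parents (centre 4 q) (4 + q) ks (centre≢ q) (ℕₚ.≤-trans lt (ℕₚ.m≤m+n 4 q))))
    where
    centre≢ : ∀ q → i ≢ centre 4 q
    centre≢ zero = i≢0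
    centre≢ (suc k) = ℕₚ.<⇒≢ (ℕₚ.≤-trans lt (ℕₚ.m≤m+n 4 k))

  u-pruning : Pruning {n = 4 + q + sum ks} (fromEdges (cycleEdges 4 ++ tail)) (λ i → leaf (toℕ i)) uStructure
  u-pruning = grown-pruning (grown-++ (grown-path q) (grown-arms (centre 4 q) (4 + q) ks (centre< q))) (cycleEdges 4) below leaf
    -- What remains is the cycle on the vertices 0 to 3, where only vertex 0 can have absorbed
    -- anything.
    (square id id (λ _ → refl) (λ _ → refl) (λ _ _ → refl) label)
    where
    below : Below 4 (cycleEdges 4)
    below = (ℕₚ.m≤m+n 4 0 , s≤s z≤n) ∷ (s≤s z≤n , s≤s (s≤s z≤n)) ∷ (s≤s (s≤s z≤n) , s≤s (s≤s (s≤s z≤n))) ∷ (s≤s (s≤s (s≤s z≤n)) , ℕₚ.m≤m+n 4 0) ∷ []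
    label : ∀ i → absorb tail leaf (toℕ i) ≡ nth uStructure i
    label zero = absorb-root q
    label (suc zero) = absorb-corner 1 (λ ()) (s≤s (s≤s z≤n))
    label (suc (suc zero)) = absorb-corner 2 (λ ()) (s≤s (s≤s (s≤s z≤n)))
    label (suc (suc (suc zero))) = absorb-corner 3 (λ ()) (ℕₚ.m≤m+n 4 0)

-- Isomorphisms from equal shapes

data EdgeIn {A : Set} : Tree A → A → A → Set where
  down     : ∀ {t c x y} → x ≡ root t → y ≡ root c → EdgeIn (t ⋉ c) x y
  up       : ∀ {t c x y} → x ≡ root c → y ≡ root t → EdgeIn (t ⋉ c) x y
  inHost   : ∀ {t c x y} → EdgeIn t x y → EdgeIn (t ⋉ c) x y
  inBranch : ∀ {t c x y} → EdgeIn c x y → EdgeIn (t ⋉ c) x y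

data LabelIn {A : Set} : Tree A → A → Set where
  atLeaf   : ∀ {a} → LabelIn (leaf a) a
  inHost   : ∀ {t c x} → LabelIn t x → LabelIn (t ⋉ c) x
  inBranch : ∀ {t c x} → LabelIn c x → LabelIn (t ⋉ c) x

-- Adjacency in the original graph as seen midway through a pruning: an edge lies inside one of the
-- trees or still joins two roots. The relation is the same at every stage.
data Link {A : Set} {n : ℕ} (G : Graph n) (lab : Fin n → Tree A) (x y : A) : Set where
  within : ∀ u → EdgeIn (lab u) x y → Link G lab x y
  across : ∀ u w → G u w ≡ true → x ≡ root (lab u) → y ≡ root (lab w) → Link G lab x y

module _ {A : Set} {n} {G : Graph (suc n)} {lab : Fin (suc n) → Tree A} {v : Fin (suc n)} {u : Fin n} {G′ : Graph n} {lab′ : Fin n → Tree A}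
  (L : LeafRemoval G v u G′) (K : Grafting lab v u lab′) where

  open LeafRemoval L
  open Grafting K

  root-preserved : ∀ w → root (lab′ w) ≡ root (lab (punchIn v w))
  root-preserved w with w F.≟ u
  ... | yes refl = cong root label-u
  ... | no w≢u = cong root (label-w w w≢u)

  link-prune : ∀ {x y} → Link G lab x y → Link G′ lab′ x y
  link-prune {x} {y} (within i e) with punchInView v i
  ... | hole = within u (subst (λ t → EdgeIn t x y) (sym label-u) (inBranch e))
  ... | other w with w F.≟ u
  ...   | yes refl = within u (subst (λ t → EdgeIn t x y) (sym label-u) (inHost e))
  ...   | no w≢u = within w (subst (λ t → EdgeIn t x y) (sym (label-w w w≢u)) e)
  link-prune {x} {y} (across i j ij x≡ y≡) with punchInView v i | punchInView v j
  ... | hole | hole = ⊥-elim (true≢false (trans (sym ij) loop))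
  ... | other w | other w′ = across w w′ (trans (restrict w w′) ij) (trans x≡ (sym (root-preserved w))) (trans y≡ (sym (root-preserved w′)))
  ... | hole | other w with neighbour w ij
  ...   | refl = within u (subst (λ t → EdgeIn t x y) (sym label-u) (up x≡ y≡))
  link-prune {x} {y} (across i j ij x≡ y≡) | other w | hole with neighbour w (trans (sym (symmetric w)) ij)
  ...   | refl = within u (subst (λ t → EdgeIn t x y) (sym label-u) (down x≡ y≡))

  link-unprune : ∀ {x y} → Link G′ lab′ x y → Link G lab x y
  link-unprune (across w w′ ww′ x≡ y≡) = across (punchIn v w) (punchIn v w′) (trans (sym (restrict w w′)) ww′)
    (trans x≡ (root-preserved w)) (trans y≡ (root-preserved w′))
  link-unprune {x} {y} (within w e) with w F.≟ u
  ... | no w≢u = within (punchIn v w) (subst (λ t → EdgeIn t x y) (label-w w w≢u) e)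
  ... | yes refl with subst (λ t → EdgeIn t x y) label-u e
  ...   | down x≡ y≡ = across (punchIn v u) v (trans (symmetric u) edge) x≡ y≡
  ...   | up x≡ y≡ = across v (punchIn v u) edge x≡ y≡
  ...   | inHost e′ = within (punchIn v u) e′
  ...   | inBranch e′ = within v e′

  label-prune : ∀ i {x} → LabelIn (lab i) x → ∃[ w ] LabelIn (lab′ w) x
  label-prune i {x} h with punchInView v i
  ... | hole = u , subst (λ t → LabelIn t x) (sym label-u) (inBranch h)
  ... | other w with w F.≟ u
  ...   | yes refl = u , subst (λ t → LabelIn t x) (sym label-u) (inHost h)
  ...   | no w≢u = w , subst (λ t → LabelIn t x) (sym (label-w w w≢u)) h

pruning-link : ∀ {n} {G : Graph n} {lab : Fin n → Tree A} {X} → Pruning G lab X → ∀ {x y} → Link G lab x y → Link C₄ (nth X) x y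
pruning-link {X = X} (square {G} {lab} f g fg gf edge label) {x} {y} (within u e) =
  within (g u) (subst (λ t → EdgeIn t x y) (trans (cong lab (sym (fg u))) (label (g u))) e)
pruning-link {X = X} (square {G} {lab} f g fg gf edge label) {x} {y} (across u w uw x≡ y≡) =
  across (g u) (g w) (trans (sym (edge (g u) (g w))) (trans (cong₂ G (fg u) (fg w)) uw)) (trans x≡ (at u)) (trans y≡ (at w))
  where
  at : ∀ u → root (lab u) ≡ root (nth X (g u))
  at u = cong root (trans (cong lab (sym (fg u))) (label (g u)))
pruning-link (prune v u G′ lab′ L K p) h =
  pruning-link p (link-prune L K h)

pruning-unlink : ∀ {n} {G : Graph n} {lab : Fin n → Tree A} {X} → Pruning G lab X → ∀ {x y} → Link C₄ (nth X) x y → Link G lab x y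
pruning-unlink (square {G} {lab} f g fg gf edge label) {x} {y} (within i e) = within (f i) (subst (λ t → EdgeIn t x y) (sym (label i)) e)
pruning-unlink (square {G} {lab} f g fg gf edge label) (across i j ij x≡ y≡) =
  across (f i) (f j) (trans (edge i j) ij) (trans x≡ (cong root (sym (label i)))) (trans y≡ (cong root (sym (label j))))
pruning-unlink (prune v u G′ lab′ L K p) h =
  link-unprune L K (pruning-unlink p h)

pruning-label : ∀ {n} {G : Graph n} {lab : Fin n → Tree A} {X} → Pruning G lab X → ∀ u {x} → LabelIn (lab u) x → ∃[ i ] LabelIn (nth X i) x
pruning-label (square {G} {lab} f g fg gf edge label) u {x} h = g u , subst (λ t → LabelIn t x) (trans (cong lab (sym (fg u))) (label (g u))) h
pruning-label (prune v u G′ lab′ L K p) i h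
  with label-prune L K i h
... | w , h′ = pruning-label p w h′

rotate rotate⁻¹ : Fin 4 → Fin 4
rotate zero = F.# 1
rotate (suc zero) = F.# 2
rotate (suc (suc zero)) = F.# 3
rotate (suc (suc (suc zero))) = F.# 0
rotate⁻¹ zero = F.# 3
rotate⁻¹ (suc i) = F.inject₁ i

-- Only the final square is renumbered, so a `turned` structure becomes upright while the graph
-- stays the same.
pruning-turn : ∀ {n} {G : Graph n} {lab : Fin n → Tree A} {X} → Pruning G lab X → Pruning G lab (turn X)
pruning-turn {X = X} (square {G} {lab} f g fg gf edge label) = square (f ∘ rotate) (rotate⁻¹ ∘ g)
  (λ i → trans (cong f (rotate-left (g i))) (fg i)) (λ i → trans (cong rotate⁻¹ (gf (rotate i))) (rotate-right i))
  (λ i j → trans (edge (rotate i) (rotate j)) (rotate-C₄ i j)) (λ i → trans (label (rotate i)) (nth-rotate i))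
  where
  rotate-left : ∀ i → rotate (rotate⁻¹ i) ≡ i
  rotate-left = toWitness {a? = Fₚ.all? (λ i → rotate (rotate⁻¹ i) F.≟ i)} tt
  rotate-right : ∀ i → rotate⁻¹ (rotate i) ≡ i
  rotate-right = toWitness {a? = Fₚ.all? (λ i → rotate⁻¹ (rotate i) F.≟ i)} tt
  rotate-C₄ : ∀ i j → C₄ (rotate i) (rotate j) ≡ C₄ i j
  rotate-C₄ = toWitness {a? = Fₚ.all? (λ i → Fₚ.all? (λ j → C₄ (rotate i) (rotate j) Boolₚ.≟ C₄ i j))} tt
  nth-rotate : ∀ i → nth X (rotate i) ≡ nth (turn X) i
  nth-rotate zero = refl
  nth-rotate (suc zero) = refl
  nth-rotate (suc (suc zero)) = refl
  nth-rotate (suc (suc (suc zero))) = refl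
pruning-turn (prune v u G′ lab′ L K p) =
  prune v u G′ lab′ L K (pruning-turn p)

record Upright {A : Set} {m} (G : Graph m) (lab : Fin m → Tree A) (n l q : ℕ) : Set where
  constructor uprightPruning
  field
    as      : List A
    v       : A
    Ls      : List (Leg A)
    a b d   : A
    height  : length as ≡ q
    lengths : map nodes Ls ↭ armLengths (n ∸ (q + 4)) l
    pruning : Pruning G lab (cyclic (stem as (legs v Ls)) (leaf a) (leaf b) (leaf d))

canonical-upright : ∀ {m n l q} {G : Graph m} {lab : Fin m → Tree A} {X} → Pruning G lab X → Canonical n l q X → Upright G lab n l q
canonical-upright p (upright as v Ls a b d h k) = uprightPruning as v Ls a b d h k p
canonical-upright p (turned can) = canonical-upright (pruning-turn p) can

-- Rearranging, relabelling and matching trees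

infix 4 _⊆ₜ_

-- Used in both directions, it says that two terms describe the same labelled rooted tree, for
-- instance with the legs listed in another order.
record _⊆ₜ_ {A : Set} (t t′ : Tree A) : Set where
  constructor included
  field
    root≡  : root t ≡ root t′
    edges⊆ : ∀ {x y} → EdgeIn t x y → EdgeIn t′ x y
    label⊆ : ∀ {x} → LabelIn t x → LabelIn t′ x
open _⊆ₜ_ public

⊆ₜ-refl : {t : Tree A} → t ⊆ₜ t
⊆ₜ-refl = included refl id id

⊆ₜ-trans : {s t u : Tree A} → s ⊆ₜ t → t ⊆ₜ u → s ⊆ₜ u
⊆ₜ-trans p q = included (trans (root≡ p) (root≡ q)) (edges⊆ q ∘ edges⊆ p) (label⊆ q ∘ label⊆ p)

⊆ₜ-⋉ : {t t′ c c′ : Tree A} → t ⊆ₜ t′ → c ⊆ₜ c′ → t ⋉ c ⊆ₜ t′ ⋉ c′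
⊆ₜ-⋉ p q = included (root≡ p)
  (λ { (down x≡ y≡) → down (trans x≡ (root≡ p)) (trans y≡ (root≡ q)) ; (up x≡ y≡) → up (trans x≡ (root≡ q)) (trans y≡ (root≡ p))
     ; (inHost e) → inHost (edges⊆ p e) ; (inBranch e) → inBranch (edges⊆ q e) })
  (λ { (inHost h) → inHost (label⊆ p h) ; (inBranch h) → inBranch (label⊆ q h) })

⊆ₜ-swap : (t c d : Tree A) → t ⋉ c ⋉ d ⊆ₜ t ⋉ d ⋉ c
⊆ₜ-swap t c d = included refl
  (λ { (down x≡ y≡) → inHost (down x≡ y≡) ; (up x≡ y≡) → inHost (up x≡ y≡) ; (inBranch e) → inHost (inBranch e)
     ; (inHost (down x≡ y≡)) → down x≡ y≡ ; (inHost (up x≡ y≡)) → up x≡ y≡ ; (inHost (inHost e)) → inHost (inHost e) ; (inHost (inBranch e)) → inBranch e })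
  (λ { (inBranch h) → inHost (inBranch h) ; (inHost (inHost h)) → inHost (inHost h) ; (inHost (inBranch h)) → inBranch h })

⊆ₜ-legs : (v : A) {Ls Ms : List (Leg A)} → Ls ↭ Ms → legs v Ls ⊆ₜ legs v Ms
⊆ₜ-legs v ↭.refl = ⊆ₜ-refl
⊆ₜ-legs v (↭.prep l p) = ⊆ₜ-⋉ (⊆ₜ-legs v p) ⊆ₜ-refl
⊆ₜ-legs v (↭.swap {xs = Ls} (a , as) (b , bs) p) =
  ⊆ₜ-trans (⊆ₜ-swap (legs v Ls) (path b bs) (path a as)) (⊆ₜ-⋉ (⊆ₜ-⋉ (⊆ₜ-legs v p) ⊆ₜ-refl) ⊆ₜ-refl)
⊆ₜ-legs v (↭.trans p q) = ⊆ₜ-trans (⊆ₜ-legs v p) (⊆ₜ-legs v q)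

⊆ₜ-stem : (as : List A) {t t′ : Tree A} → t ⊆ₜ t′ → stem as t ⊆ₜ stem as t′
⊆ₜ-stem [] p = p
⊆ₜ-stem (a ∷ as) p = ⊆ₜ-⋉ ⊆ₜ-refl (⊆ₜ-stem as p)

relabel : (A → A′) → Tree A → Tree A′
relabel f (leaf a) = leaf (f a)
relabel f (t ⋉ c) = relabel f t ⋉ relabel f c

relabelᶜ : (A → A′) → Cyclic A → Cyclic A′
relabelᶜ f (cyclic a b d e) = cyclic (relabel f a) (relabel f b) (relabel f d) (relabel f e)

nth-relabel : (f : A → A′) (X : Cyclic A) → ∀ i → nth (relabelᶜ f X) i ≡ relabel f (nth X i)
nth-relabel f X zero = refl
nth-relabel f X (suc zero) = refl
nth-relabel f X (suc (suc zero)) = refl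
nth-relabel f X (suc (suc (suc zero))) = refl

root-relabel : (f : A → A′) (t : Tree A) → root (relabel f t) ≡ f (root t)
root-relabel f (leaf a) = refl
root-relabel f (t ⋉ c) = root-relabel f t

edges-relabel : (f : A → A′) (t : Tree A) → edges (relabel f t) ≡ edges t
edges-relabel f (leaf a) = refl
edges-relabel f (t ⋉ c) = cong₂ (λ x y → suc (x + y)) (edges-relabel f t) (edges-relabel f c)

edge-relabel : (f : A → A′) {t : Tree A} → ∀ {p q} → EdgeIn t p q → EdgeIn (relabel f t) (f p) (f q)
edge-relabel f {t ⋉ c} (down p≡ q≡) = down (trans (cong f p≡) (sym (root-relabel f t))) (trans (cong f q≡) (sym (root-relabel f c)))
edge-relabel f {t ⋉ c} (up p≡ q≡) = up (trans (cong f p≡) (sym (root-relabel f c))) (trans (cong f q≡) (sym (root-relabel f t)))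
edge-relabel f (inHost e) = inHost (edge-relabel f e)
edge-relabel f (inBranch e) = inBranch (edge-relabel f e)

edge-unrelabel : (f : A → A′) (t : Tree A) → ∀ {x y} → EdgeIn (relabel f t) x y → ∃₂ λ p q → EdgeIn t p q × f p ≡ x × f q ≡ y
edge-unrelabel f (t ⋉ c) (down x≡ y≡) = root t , root c , down refl refl , sym (trans x≡ (root-relabel f t)) , sym (trans y≡ (root-relabel f c))
edge-unrelabel f (t ⋉ c) (up x≡ y≡) = root c , root t , up refl refl , sym (trans x≡ (root-relabel f c)) , sym (trans y≡ (root-relabel f t))
edge-unrelabel f (t ⋉ c) (inHost e) with edge-unrelabel f t e
... | p , q , e′ , p≡ , q≡ = p , q , inHost e′ , p≡ , q≡
edge-unrelabel f (t ⋉ c) (inBranch e) with edge-unrelabel f c e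
... | p , q , e′ , p≡ , q≡ = p , q , inBranch e′ , p≡ , q≡

label-unrelabel : (f : A → A′) (t : Tree A) → ∀ {x} → LabelIn (relabel f t) x → ∃[ p ] (LabelIn t p × f p ≡ x)
label-unrelabel f (leaf a) atLeaf = a , atLeaf , refl
label-unrelabel f (t ⋉ c) (inHost h) with label-unrelabel f t h
... | p , h′ , p≡ = p , inHost h′ , p≡
label-unrelabel f (t ⋉ c) (inBranch h) with label-unrelabel f c h
... | p , h′ , p≡ = p , inBranch h′ , p≡

root-label : (t : Tree A) → LabelIn t (root t)
root-label (leaf a) = atLeaf
root-label (t ⋉ c) = inHost (root-label t)

edge-labels : {t : Tree A} → ∀ {p q} → EdgeIn t p q → LabelIn t p × LabelIn t q
edge-labels {t = t ⋉ c} (down refl refl) = inHost (root-label t) , inBranch (root-label c)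
edge-labels {t = t ⋉ c} (up refl refl) = inBranch (root-label c) , inHost (root-label t)
edge-labels (inHost e) with edge-labels e
... | h , k = inHost h , inHost k
edge-labels (inBranch e) with edge-labels e
... | h , k = inBranch h , inBranch k

labels : Tree A → List A
labels (leaf a) = a ∷ []
labels (t ⋉ c) = labels t ++ labels c

length-labels : (t : Tree A) → length (labels t) ≡ suc (edges t)
length-labels (leaf a) = refl
length-labels (t ⋉ c) = trans (Lₚ.length-++ (labels t)) (trans (cong₂ _+_ (length-labels t) (length-labels c)) (cong suc (ℕₚ.+-suc (edges t) (edges c))))

∈-labels : {t : Tree A} → ∀ {p} → LabelIn t p → p ∈ labels t
∈-labels atLeaf = Any.here refl
∈-labels (inHost h) = Anyₚ.++⁺ˡ (∈-labels h)
∈-labels {t = t ⋉ c} (inBranch h) = Anyₚ.++⁺ʳ (labels t) (∈-labels h)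

labelsᶜ : Cyclic A → List A
labelsᶜ (cyclic a b d e) = labels a ++ labels b ++ labels d ++ labels e

length-labelsᶜ : (X : Cyclic A) → length (labelsᶜ X) ≡ order X
length-labelsᶜ (cyclic a b d e) = trans (Lₚ.length-++ (labels a)) (trans (cong₂ _+_ (length-labels a)
  (trans (Lₚ.length-++ (labels b)) (cong₂ _+_ (length-labels b) (trans (Lₚ.length-++ (labels d)) (cong₂ _+_ (length-labels d) (length-labels e))))))
  (solve 4 (λ a b d e → con 1 :+ a :+ (con 1 :+ b :+ (con 1 :+ d :+ (con 1 :+ e))) := con 4 :+ (a :+ b :+ d :+ e)) refl (edges a) (edges b) (edges d) (edges e)))
  where open +-*-Solver

∈-labelsᶜ : (X : Cyclic A) → ∀ i {p} → LabelIn (nth X i) p → p ∈ labelsᶜ X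
∈-labelsᶜ X zero h = Anyₚ.++⁺ˡ (∈-labels h)
∈-labelsᶜ X (suc zero) h = Anyₚ.++⁺ʳ (labels (t₀ X)) (Anyₚ.++⁺ˡ (∈-labels h))
∈-labelsᶜ X (suc (suc zero)) h = Anyₚ.++⁺ʳ (labels (t₀ X)) (Anyₚ.++⁺ʳ (labels (t₁ X)) (Anyₚ.++⁺ˡ (∈-labels h)))
∈-labelsᶜ X (suc (suc (suc zero))) h = Anyₚ.++⁺ʳ (labels (t₀ X)) (Anyₚ.++⁺ʳ (labels (t₁ X)) (Anyₚ.++⁺ʳ (labels (t₂ X)) (∈-labels h)))

order-relabel : (f : A → A′) (X : Cyclic A) → order (relabelᶜ f X) ≡ order X
order-relabel f (cyclic a b d e) = cong (λ z → 4 + z) (cong₂ _+_ (cong₂ _+_ (cong₂ _+_ (edges-relabel f a) (edges-relabel f b)) (edges-relabel f d)) (edges-relabel f e))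

link-relabel : (f : A → A′) (X : Cyclic A) → ∀ {p q} → Link C₄ (nth X) p q → Link C₄ (nth (relabelᶜ f X)) (f p) (f q)
link-relabel f X (within i e) = within i (subst (λ t → EdgeIn t _ _) (sym (nth-relabel f X i)) (edge-relabel f e))
link-relabel f X (across i j ij p≡ q≡) = across i j ij (at i p≡) (at j q≡)
  where
  at : ∀ i {p} → p ≡ root (nth X i) → f p ≡ root (nth (relabelᶜ f X) i)
  at i p≡ = trans (cong f p≡) (sym (trans (cong root (nth-relabel f X i)) (root-relabel f (nth X i))))

link-unrelabel : (f : A → A′) (X : Cyclic A) → ∀ {x y} → Link C₄ (nth (relabelᶜ f X)) x y →
  ∃₂ λ p q → Link C₄ (nth X) p q × f p ≡ x × f q ≡ y
link-unrelabel f X (within i e) with edge-unrelabel f (nth X i) (subst (λ t → EdgeIn t _ _) (nth-relabel f X i) e)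
... | p , q , e′ , p≡ , q≡ = p , q , within i e′ , p≡ , q≡
link-unrelabel f X (across i j ij x≡ y≡) = root (nth X i) , root (nth X j) , across i j ij refl refl , at i x≡ , at j y≡
  where
  at : ∀ i {x} → x ≡ root (nth (relabelᶜ f X) i) → f (root (nth X i)) ≡ x
  at i x≡ = sym (trans x≡ (trans (cong root (nth-relabel f X i)) (root-relabel f (nth X i))))

link-members : (X : Cyclic A) → ∀ {p q} → Link C₄ (nth X) p q → p ∈ labelsᶜ X × q ∈ labelsᶜ X
link-members X (within i e) with edge-labels e
... | h , k = ∈-labelsᶜ X i h , ∈-labelsᶜ X i k
link-members X (across i j ij refl refl) = ∈-labelsᶜ X i (root-label (nth X i)) , ∈-labelsᶜ X j (root-label (nth X j))

Represents : ∀ {n} → Graph n → (Fin n → A) → Cyclic A → Set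
Represents {n = n} G ι X = (∀ u w → G u w ≡ true → Link C₄ (nth X) (ι u) (ι w)) × (∀ u w → Link C₄ (nth X) (ι u) (ι w) → G u w ≡ true) ×
  (∀ u → ∃[ i ] LabelIn (nth X i) (ι u))

pruning-represents : ∀ {n} {G : Graph n} {ι : Fin n → A} {X} → (∀ {i j} → ι i ≡ ι j → i ≡ j) →
  Pruning G (λ i → leaf (ι i)) X → Represents G ι X
pruning-represents {n = n} {G} {ι} inj p = (λ u w uw → pruning-link p (across u w uw refl refl)) , (λ u w h → back (pruning-unlink p h)) ,
  (λ u → pruning-label p u atLeaf)
  where
  back : ∀ {u w} → Link G (λ i → leaf (ι i)) (ι u) (ι w) → G u w ≡ true
  back (within i ())
  back (across u′ w′ uw u≡ w≡) with inj u≡ | inj w≡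
  ... | refl | refl = uw

injective⇒surjective : ∀ n (f : Fin n → Fin n) → (∀ {i j} → f i ≡ f j → i ≡ j) → ∀ i → ∃[ j ] f j ≡ i
injective⇒surjective (suc n) f inj i with Fₚ.any? (λ j → f j F.≟ i)
... | yes found = found
... | no missing = ⊥-elim (ℕₚ.1+n≰n (Fₚ.injective⇒≤ {f = λ j → punchOut (avoid j)} (λ {j} {k} eq → inj (Fₚ.punchOut-injective (avoid j) (avoid k) eq))))
  where
  avoid : ∀ j → i ≢ f j
  avoid j eq = missing (j , sym eq)

-- The label list of Z has n slots, and each of the n distinct labels `ι u` occurs in one. By
-- counting, every slot belongs to exactly one vertex, which takes the place of a proof that no
-- label is repeated.
module Positions {C A : Set} {n} (Z : Cyclic C) (f : C → A) (ι : Fin n → A) (ι-injective : ∀ {i j} → ι i ≡ ι j → i ≡ j)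
  (covered : ∀ u → ∃[ i ] LabelIn (nth (relabelᶜ f Z) i) (ι u)) (size : length (labelsᶜ Z) ≡ n) where

  slot : Fin n → C
  slot i = Data.List.lookup (labelsᶜ Z) (F.cast (sym size) i)

  slot-of : ∀ {p} → p ∈ labelsᶜ Z → ∃[ i ] slot i ≡ p
  slot-of p∈ = F.cast size (Any.index p∈) ,
    trans (cong (Data.List.lookup (labelsᶜ Z)) (trans (Fₚ.cast-trans size (sym size) (Any.index p∈)) (Fₚ.cast-is-id refl (Any.index p∈)))) (sym (Anyₚ.lookup-index p∈))

  private
    found : ∀ u → ∃[ i ] f (slot i) ≡ ι u
    found u with covered u
    ... | i , h with label-unrelabel f (nth Z i) (subst (λ t → LabelIn t (ι u)) (nth-relabel f Z i) h)
    ...   | p , h′ , p≡ with slot-of (∈-labelsᶜ Z i h′)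
    ...     | k , refl = k , p≡

  position : Fin n → Fin n
  position u = proj₁ (found u)

  slot-position : ∀ u → f (slot (position u)) ≡ ι u
  slot-position u = proj₂ (found u)

  position-injective : ∀ {u w} → position u ≡ position w → u ≡ w
  position-injective {u} {w} eq = ι-injective (trans (sym (slot-position u)) (trans (cong (λ i → f (slot i)) eq) (slot-position w)))

  position⁻¹ : ∀ i → ∃[ u ] position u ≡ i
  position⁻¹ = injective⇒surjective n position position-injective

  determined : ∀ {p u} → p ∈ labelsᶜ Z → f p ≡ ι u → p ≡ slot (position u)
  determined {p} {u} p∈ p≡ with slot-of p∈
  ... | k , refl with position⁻¹ k
  ...   | w , refl = cong (λ u → slot (position u)) (ι-injective (trans (sym (slot-position w)) p≡))

≡-from-⇔ : ∀ {b b′} → (b ≡ true → b′ ≡ true) → (b′ ≡ true → b ≡ true) → b ≡ b′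
≡-from-⇔ {true} h k = sym (h refl)
≡-from-⇔ {false} {true} h k = k refl
≡-from-⇔ {false} {false} h k = refl

adjacency-transfer : ∀ {C A A′ : Set} {n} (Z : Cyclic C) (f : C → A) (f′ : C → A′) (G H : Graph n) (ι : Fin n → A) (κ : Fin n → A′) →
  (∀ u w → G u w ≡ true → Link C₄ (nth (relabelᶜ f Z)) (ι u) (ι w)) → (∀ u w → Link C₄ (nth (relabelᶜ f′ Z)) (κ u) (κ w) → H u w ≡ true) →
  (s t : Fin n → Fin n) → (∀ u {p} → p ∈ labelsᶜ Z → f p ≡ ι (s u) → f′ p ≡ κ (t u)) →
  ∀ u w → G (s u) (s w) ≡ true → H (t u) (t w) ≡ true
adjacency-transfer Z f f′ G H ι κ G→ →H s t label u w h =
  let (p , q , l , p≡ , q≡) = link-unrelabel f Z (G→ (s u) (s w) h)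
      (p∈ , q∈) = link-members Z l
  in →H (t u) (t w) (subst₂ (Link C₄ (nth (relabelᶜ f′ Z))) (label u p∈ p≡) (label w q∈ q≡) (link-relabel f′ Z l))

-- Two structures of equal shape are two relabellings of a common one; vertices occupying the same
-- slot correspond to each other.
zip-iso : ∀ {C A A′ : Set} {n} (Z : Cyclic C) (f : C → A) (f′ : C → A′) {G H : Graph n} (ι : Fin n → A) (κ : Fin n → A′) →
  (∀ {i j} → ι i ≡ ι j → i ≡ j) → (∀ {i j} → κ i ≡ κ j → i ≡ j) →
  Represents G ι (relabelᶜ f Z) → Represents H κ (relabelᶜ f′ Z) → length (labelsᶜ Z) ≡ n → Iso G H
zip-iso {n = n} Z f f′ {G} {H} ι κ ι-inj κ-inj (G→ , →G , G-cover) (H→ , →H , H-cover) size =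
  Perm.permutation σ τ στ τσ , λ u w → ≡-from-⇔
    (adjacency-transfer Z f f′ G H ι κ G→ →H σ id (λ u p∈ p≡ → trans (cong f′ (trans (P.determined p∈ p≡) (cong P.slot (σ-position u)))) (P′.slot-position u)) u w)
    (adjacency-transfer Z f′ f H G κ ι H→ →G id σ (λ u p∈ p≡ → trans (cong f (trans (P′.determined p∈ p≡) (cong P.slot (sym (σ-position u))))) (P.slot-position (σ u))) u w)
  where
  module P = Positions Z f ι ι-inj G-cover size
  module P′ = Positions Z f′ κ κ-inj H-cover size
  σ τ : Fin n → Fin n
  σ u = proj₁ (P.position⁻¹ (P′.position u))
  τ u = proj₁ (P′.position⁻¹ (P.position u))
  σ-position : ∀ u → P.position (σ u) ≡ P′.position u
  σ-position u = proj₂ (P.position⁻¹ (P′.position u))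
  τ-position : ∀ u → P′.position (τ u) ≡ P.position u
  τ-position u = proj₂ (P′.position⁻¹ (P.position u))
  στ : ∀ u → σ (τ u) ≡ u
  στ u = P.position-injective (trans (σ-position (τ u)) (τ-position u))
  τσ : ∀ u → τ (σ u) ≡ u
  τσ u = P′.position-injective (trans (τ-position (σ u)) (σ-position u))

Zipped : Tree A → Tree A′ → Set
Zipped {A} {A′} t t′ = Σ[ Z ∈ Tree (A × A′) ] (relabel proj₁ Z ≡ t × relabel proj₂ Z ≡ t′)

zip-leaf : (a : A) (b : A′) → Zipped (leaf a) (leaf b)
zip-leaf a b = leaf (a , b) , refl , refl

zip-⋉ : {t c : Tree A} {t′ c′ : Tree A′} → Zipped t t′ → Zipped c c′ → Zipped (t ⋉ c) (t′ ⋉ c′)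
zip-⋉ (Z , p , q) (W , r , s) = Z ⋉ W , cong₂ _⋉_ p r , cong₂ _⋉_ q s

zip-path : (a : A) (as : List A) (b : A′) (bs : List A′) → length as ≡ length bs → Zipped (path a as) (path b bs)
zip-path a [] b [] eq = zip-leaf a b
zip-path a (a′ ∷ as) b (b′ ∷ bs) eq = zip-⋉ (zip-leaf a b) (zip-path a′ as b′ bs (ℕₚ.suc-injective eq))

zip-legs : (v : A) (w : A′) (Ls : List (Leg A)) (Ms : List (Leg A′)) → map nodes Ls ≡ map nodes Ms → Zipped (legs v Ls) (legs w Ms)
zip-legs v w [] [] eq = zip-leaf v w
zip-legs v w ((a , as) ∷ Ls) ((b , bs) ∷ Ms) eq = zip-⋉ (zip-legs v w Ls Ms (Lₚ.∷-injectiveʳ eq)) (zip-path a as b bs (ℕₚ.suc-injective (Lₚ.∷-injectiveˡ eq)))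

zip-stem : (as : List A) (bs : List A′) {t : Tree A} {t′ : Tree A′} → length as ≡ length bs → Zipped t t′ → Zipped (stem as t) (stem bs t′)
zip-stem [] [] eq z = z
zip-stem (a ∷ as) (b ∷ bs) eq z = zip-⋉ (zip-leaf a b) (zip-stem as bs (ℕₚ.suc-injective eq) z)

represents-⊆ₜ : ∀ {n} {G : Graph n} {ι : Fin n → A} {t t′ b d e} → t ⊆ₜ t′ → t′ ⊆ₜ t → Represents G ι (cyclic t b d e) → Represents G ι (cyclic t′ b d e)
represents-⊆ₜ {A = A} {t = t} {t′} {b} {d} {e} p q (G→ , →G , cover) = (λ u w h → transfer p (G→ u w h)) , (λ u w h → →G u w (transfer q h)) ,
  (λ u → proj₁ (cover u) , relabeled p (proj₁ (cover u)) (proj₂ (cover u)))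
  where
  nth-root : ∀ {t t′ : Tree A} → t ⊆ₜ t′ → ∀ i → root (nth (cyclic t b d e) i) ≡ root (nth (cyclic t′ b d e) i)
  nth-root p zero = root≡ p
  nth-root p (suc zero) = refl
  nth-root p (suc (suc zero)) = refl
  nth-root p (suc (suc (suc zero))) = refl
  relabeled : ∀ {t t′ : Tree A} → t ⊆ₜ t′ → ∀ i {x} → LabelIn (nth (cyclic t b d e) i) x → LabelIn (nth (cyclic t′ b d e) i) x
  relabeled p zero h = label⊆ p h
  relabeled p (suc zero) h = h
  relabeled p (suc (suc zero)) h = h
  relabeled p (suc (suc (suc zero))) h = h
  transfer : ∀ {t t′ : Tree A} → t ⊆ₜ t′ → ∀ {x y} → Link C₄ (nth (cyclic t b d e)) x y → Link C₄ (nth (cyclic t′ b d e)) x y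
  transfer p (within zero h) = within zero (edges⊆ p h)
  transfer p (within (suc zero) h) = within (suc zero) h
  transfer p (within (suc (suc zero)) h) = within (suc (suc zero)) h
  transfer p (within (suc (suc (suc zero))) h) = within (suc (suc (suc zero))) h
  transfer p (across i j ij x≡ y≡) = across i j ij (trans x≡ (nth-root p i)) (trans y≡ (nth-root p j))

-- The legs of one broom are first put in the order of the other's lengths; after that the two terms
-- have the same shape and can be zipped.
broom-iso : ∀ {n} {G H : Graph n} (ι : Fin n → A) (κ : Fin n → A′) → (∀ {i j} → ι i ≡ ι j → i ≡ j) → (∀ {i j} → κ i ≡ κ j → i ≡ j) →
  (as : List A) (v : A) (Ls : List (Leg A)) (a b d : A) (as′ : List A′) (v′ : A′) (Ls′ : List (Leg A′)) (a′ b′ d′ : A′) →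
  length as ≡ length as′ → map nodes Ls ↭ map nodes Ls′ →
  Pruning G (λ i → leaf (ι i)) (cyclic (stem as (legs v Ls)) (leaf a) (leaf b) (leaf d)) →
  Pruning H (λ i → leaf (κ i)) (cyclic (stem as′ (legs v′ Ls′)) (leaf a′) (leaf b′) (leaf d′)) → Iso G H
broom-iso {A} {A′} {n = n} {G} {H} ι κ ι-inj κ-inj as v Ls a b d as′ v′ Ls′ a′ b′ d′ len lens pG pH
  with ↭ₚ.↭-map-inv nodes lens
... | Ms , Ms≡ , Ls↭Ms with zip-stem as as′ len (zip-legs v v′ Ms Ls′ (sym Ms≡))
...   | Z , Z₁ , Z₂ = zip-iso Zᶜ proj₁ proj₂ ι κ ι-inj κ-inj
        (subst (λ t → Represents G ι (cyclic t (leaf a) (leaf b) (leaf d))) (sym Z₁)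
          (represents-⊆ₜ (⊆ₜ-stem as (⊆ₜ-legs v Ls↭Ms)) (⊆ₜ-stem as (⊆ₜ-legs v (↭-sym Ls↭Ms))) (pruning-represents ι-inj pG)))
        (subst (λ t → Represents H κ (cyclic t (leaf a′) (leaf b′) (leaf d′))) (sym Z₂) (pruning-represents κ-inj pH))
        (trans (length-labelsᶜ Zᶜ) (trans (sym (order-relabel proj₂ Zᶜ))
          (trans (cong (λ t → order (cyclic t (leaf a′) (leaf b′) (leaf d′))) Z₂) (pruning-size pH))))
  where
  Zᶜ : Cyclic (A × A′)
  Zᶜ = cyclic Z (leaf (a , a′)) (leaf (b , b′)) (leaf (d , d′))

-- Comparison of graphs

iso-c : ∀ {n} (G H : Graph n) → Iso G H → ∀ k → c G k ≡ c H k
iso-c {n} G H (σ , adj) k = cong (λ z → sgn k ℤ.* z) (coeff-unique (charPoly G) (charPoly H) (λ x → values (int (suc x))) (n ∸ k))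
  where
  s : Fin n → Fin n
  s = Inverse.to σ
  s-injective : ∀ {i j} → s i ≡ s j → i ≡ j
  s-injective {i} {j} eq = trans (sym (Inverse.strictlyInverseʳ σ i)) (trans (cong (Inverse.from σ) eq) (Inverse.strictlyInverseʳ σ j))
  degree : ∀ i → deg G (s i) ≡ deg H i
  degree i = trans (deg-sum G (s i)) (trans (ℕΣ.sum-permute (λ j → bit (G (s i) j)) σ)
    (trans (ℕΣ.sum-cong-≗ (λ j → cong bit (adj i j))) (sym (deg-sum H i))))
  diagonal : ∀ i j → (toℕ (s i) ≡ᵇ toℕ (s j)) ≡ (toℕ i ≡ᵇ toℕ j)
  diagonal i j with i F.≟ j
  ... | yes refl = trans (toℕ-≡ᵇ-refl G (s i)) (sym (toℕ-≡ᵇ-refl G i))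
  ... | no i≢j = trans (toℕ-≡ᵇ-false G (λ eq → i≢j (s-injective eq))) (sym (toℕ-≡ᵇ-false G i≢j))
  entries : ∀ x i j → laplacianEntry G x (s i) (s j) ≡ laplacianEntry H x i j
  entries x i j = trans
    (cong₂ (λ b d → evalℤ (if b then (ℤ.- int d) ∷ 1ℤ ∷ [] else (if G (s i) (s j) then 1ℤ ∷ [] else 0ℤ ∷ [])) x) (diagonal i j) (degree i))
    (cong (λ g → evalℤ (if toℕ i ≡ᵇ toℕ j then (ℤ.- int (deg H i)) ∷ 1ℤ ∷ [] else (if g then 1ℤ ∷ [] else 0ℤ ∷ [])) x) (adj i j))
  values : ∀ x → evalℤ (charPoly G) x ≡ evalℤ (charPoly H) x
  values x = begin
    evalℤ (charPoly G) x ≡⟨ evalℤ-det n _ x ⟩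
    detℤ n (laplacianEntry G x) ≡⟨ sym (detℤ-permute n s s-injective (laplacianEntry G x)) ⟩
    detℤ n (λ i j → laplacianEntry G x (s i) (s j)) ≡⟨ detℤ-cong n (entries x) ⟩
    detℤ n (laplacianEntry H x) ≡⟨ sym (evalℤ-det n _ x) ⟩
    evalℤ (charPoly H) x ∎
    where open ≡-Reasoning

module Compare {A A′ : Set} {n} {G H : Graph n} {ι : Fin n → A} {κ : Fin n → A′} {X : Cyclic A} {Y : Cyclic A′}
  (p : Pruning G (λ i → leaf (ι i)) X) (q : Pruning H (λ i → leaf (κ i)) Y) where

  private
    x y : ℕ → ℕ
    x = coeffℕ (coeffs (F-poly X))
    y = coeffℕ (coeffs (F-poly Y))

  ⊑⇒≼ : F X ⊑ F Y → G ≼ H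
  ⊑⇒≼ le k k≤n = subst₂ ℤ._≤_ (sym (c-formula p k k≤n)) (sym (c-formula q k k≤n))
    (ℤ.+≤+ (subst (x (n ∸ k) ≤_) (⊑⇒coeffs (F-poly X) (F-poly Y) le (n ∸ k)) (ℕₚ.m≤m+n (x (n ∸ k)) _)))

  ≼⇒coeffs : G ≼ H → ∀ j → j ≤ n → x j ≤ y j
  ≼⇒coeffs le j j≤n = subst (λ i → x i ≤ y i) (ℕₚ.m∸[m∸n]≡n j≤n)
    (ℤₚ.drop‿+≤+ (subst₂ ℤ._≤_ (c-formula p (n ∸ j) (ℕₚ.m∸n≤m n j)) (c-formula q (n ∸ j) (ℕₚ.m∸n≤m n j)) (le (n ∸ j) (ℕₚ.m∸n≤m n j))))

  -- The value at 1 sums all coefficients, while `≼` covers the indices up to n; beyond them the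
  -- smaller side is 0 by its degree.
  ≼⇒≤-at-1 : G ≼ H → F X 1 ≤ F Y 1
  ≼⇒≤-at-1 le = subst₂ _≤_ (evaluate (F-poly X) 1) (evaluate (F-poly Y) 1)
    (eval-1-monotone (coeffs (F-poly X)) (coeffs (F-poly Y)) all-coeffs)
    where
    all-coeffs : ∀ j → x j ≤ y j
    all-coeffs j with j ℕₚ.≤? n
    ... | yes j≤n = ≼⇒coeffs le j j≤n
    ... | no j≰n = subst (_≤ y j) (sym (coeffℕ-beyond (coeffs (F-poly X)) j
            (ℕₚ.≤-trans (degree≤ (F-poly X)) (subst (λ m → suc m ≤ j) (sym (pruning-size p)) (ℕₚ.≰⇒> j≰n))))) z≤n

  -- A difference positive at 1 has a positive coefficient, and the degree of `F Y` keeps its index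
  -- within n.
  ⊑⇒≺ : F X ⊑ F Y → F X 1 < F Y 1 → G ≺ H
  ⊑⇒≺ le lt with positive-coefficient (coeffs h) (subst (0 <_) (sym (evaluate h 1)) (ℕₚ.+-cancelˡ-< (F X 1) 0 _
      (subst₂ _<_ (sym (ℕₚ.+-identityʳ (F X 1))) (sym (proj₂ (proj₂ le) 1)) lt)))
    where h = proj₂ (proj₁ (proj₂ le))
  ... | j , pos = ⊑⇒≼ le , n ∸ j , ℕₚ.m∸n≤m n j , subst₂ ℤ._<_ (sym (c-formula p (n ∸ j) (ℕₚ.m∸n≤m n j))) (sym (c-formula q (n ∸ j) (ℕₚ.m∸n≤m n j)))
      (ℤ.+<+ (subst (λ i → x i < y i) (sym (ℕₚ.m∸[m∸n]≡n j≤n)) xj<yj))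
    where
    xj<yj : x j < y j
    xj<yj = subst (x j <_) (⊑⇒coeffs (F-poly X) (F-poly Y) le j) (ℕₚ.m<m+n (x j) pos)
    j≤n : j ≤ n
    j≤n with j ℕₚ.≤? n
    ... | yes h = h
    ... | no j≰n = ⊥-elim (ℕₚ.n≮0 (subst (x j <_) (coeffℕ-beyond (coeffs (F-poly Y)) j
            (ℕₚ.≤-trans (degree≤ (F-poly Y)) (subst (λ m → suc m ≤ j) (sym (pruning-size q)) (ℕₚ.≰⇒> j≰n)))) xj<yj))

-- With at least l vertices to distribute the quotient is positive, so no arm is empty and the graph
-- has all its l leaves.
armLengths-facts : ∀ T′ l → 0 < l → l ≤ T′ → sum (armLengths T′ l) ≡ T′ × All (0 <_) (armLengths T′ l)
armLengths-facts T′ (suc l) _ l≤T = trans (cong sum form) (trans (sum-two-values m r k) (sym T≡)) , subst (All (0 <_)) (sym form)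
  (Allₚ.++⁺ (Allₚ.replicate⁺ r (s≤s z≤n)) (Allₚ.replicate⁺ k (DivMod.m≥n⇒m/n>0 l≤T)))
  where
  L = suc l
  m = T′ / L
  r = T′ % L
  k = L ∸ r
  r+k≡L : r + k ≡ L
  r+k≡L = ℕₚ.m+[n∸m]≡n (ℕₚ.<⇒≤ (DivMod.m%n<n T′ L))
  T≡ : T′ ≡ (r + k) * m + r
  T≡ = trans (DivMod.m≡m%n+[m/n]*n T′ L) (trans (ℕₚ.+-comm r (m * L)) (cong (_+ r) (trans (ℕₚ.*-comm m L) (cong (_* m) (sym r+k≡L)))))
  form : armLengths T′ L ≡ replicate r (suc m) ++ replicate k m
  form = trans (cong₂ armLengths T≡ (sym r+k≡L)) (armLengths-form m r k)

length-armLengths : ∀ T′ l → length (armLengths T′ l) ≡ l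
length-armLengths T′ zero = refl
length-armLengths T′ (suc l) = trans (Lₚ.length-map _ (upTo (suc l))) (Lₚ.length-upTo (suc l))

module _ (n l : ℕ) (l≥2 : 2 ≤ l) (n≥ : 3 * l + 4 ≤ n) where

  private
    n′ : ℕ → ℕ
    n′ q = n ∸ (q + 4)

  module Representative (q : ℕ) (q≤p : q ≤ bound n l) where

    private
      fits : l * (q + 3) + (q + 4) ≤ n
      fits = subst (_≤ n) (solve 2 (λ q l → q :* (con 1 :+ l) :+ (con 4 :+ con 3 :* l) := l :* (q :+ con 3) :+ (q :+ con 4)) refl q l)
        (bound-elim n l q n≥ q≤p)
        where open +-*-Solver
      enough : l ≤ n′ q
      enough = ℕₚ.≤-trans (ℕₚ.≤-trans (ℕₚ.≤-reflexive (sym (ℕₚ.*-identityʳ l))) (ℕₚ.*-monoʳ-≤ l (ℕₚ.≤-trans (s≤s z≤n) (ℕₚ.m≤n+m 3 q))))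
        (subst (_≤ n′ q) (ℕₚ.m+n∸n≡m (l * (q + 3)) (q + 4)) (ℕₚ.∸-monoˡ-≤ (q + 4) fits))
      facts = armLengths-facts (n′ q) l (ℕₚ.≤-trans (s≤s z≤n) l≥2) enough

    ks : List ℕ
    ks = armLengths (n′ q) l

    open UPruning q ks public

    size : 4 + q + sum ks ≡ n
    size = trans (cong (λ z → 4 + q + z) (proj₁ facts)) (trans (cong (_+ n′ q) (ℕₚ.+-comm 4 q))
      (ℕₚ.m+[n∸m]≡n (ℕₚ.≤-trans (ℕₚ.m≤n+m (q + 4) (l * (q + 3))) fits)))

    pruning : Pruning (U n l 4 q) (λ i → leaf (toℕ i)) uStructure
    pruning = subst (λ m → Pruning {n = m} (fromEdges (cycleEdges 4 ++ tail)) (λ i → leaf (toℕ i)) uStructure) size u-pruning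

    lengths : map nodes (armLegs (4 + q) ks) ≡ ks
    lengths = nodes-armLegs (4 + q) ks (proj₂ facts)

    F-target : ∀ x → F uStructure x ≡ target n l q x
    F-target = canonical-target {n = n} {l} {q} uStructure (upright (stemLabels q) (centre 4 q) (armLegs (4 + q) ks) 1 2 3 (length-stemLabels q) (↭.↭-reflexive lengths))

    leafCount≡ : leafCount uStructure ≡ l
    leafCount≡ = trans (leafCount-hanging 1 2 3 (stem (stemLabels q) (legs (centre 4 q) (armLegs (4 + q) ks))))
      (count (armLegs (4 + q) ks) (trans (sym (Lₚ.length-map nodes (armLegs (4 + q) ks))) (trans (cong length lengths) (length-armLengths (n′ q) l))))
      where
      count : ∀ Ls → length Ls ≡ l → rootedLeaves (stem (stemLabels q) (legs (centre 4 q) Ls)) ≡ l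
      count [] eq = ⊥-elim (ℕₚ.n≮0 (subst (2 ≤_) (sym eq) l≥2))
      count (L ∷ Ls) eq = trans (rootedLeaves-broom (stemLabels q) (centre 4 q) L Ls) eq

    uniSet : UniSet n l 4 (U n l 4 q)
    uniSet = pruning⇒UniSet pruning leafCount≡

  -- For q < r the value at 1 is larger at r; for r < q the coefficient of x² is larger at r. Either
  -- excludes the relation.
  U-incomparable : ∀ {q r} (q≤p : q ≤ bound n l) (r≤p : r ≤ bound n l) → q ≢ r → ¬ (U n l 4 r ≼ U n l 4 q)
  U-incomparable {q} {r} q≤p r≤p q≢r le = compare (ℕₚ.<-cmp q r)
    where
    module Rq = Representative q q≤p
    module Rr = Representative r r≤p
    compare : Tri.Tri (q < r) (q ≡ r) (r < q) → ⊥
    compare (Tri.tri≈ _ q≡r _) = q≢r q≡r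
    compare (Tri.tri< q<r _ _) = ℕₚ.<⇒≱ (target-1-< l≥2 n≥ q<r r≤p)
      (subst₂ _≤_ (Rr.F-target 1) (Rq.F-target 1) (Compare.≼⇒≤-at-1 Rr.pruning Rq.pruning le))
    compare (Tri.tri> _ _ r<q) = ℕₚ.<⇒≱
      (<₂⇒coeff (F-poly Rq.uStructure) (F-poly Rr.uStructure) structures)
      (Compare.≼⇒coeffs Rr.pruning Rq.pruning le 2 (ℕₚ.≤-trans (ℕₚ.≤-trans (s≤s (s≤s z≤n)) (ℕₚ.m≤n+m 4 (3 * l))) n≥))
      where
      structures : F Rq.uStructure <₂ F Rr.uStructure
      structures = <₂-≗ (λ x → sym (Rq.F-target x)) (λ x → sym (Rr.F-target x)) (target-2-< l≥2 n≥ r<q q≤p)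

  record Dominated (G : Graph n) : Set where
    field
      X         : Cyclic (Fin n)
      pruned    : Pruning G leaf X
      q         : ℕ
      q≤p       : q ≤ bound n l
      target⊑   : target n l q ⊑ F X
      certainty : Canonical n l q X ⊎ target n l q 1 < F X 1

  dominate : (G : Graph n) → UniSet n l 4 G → Dominated G
  dominate G G∈ = collect (UniSet⇒pruning G id G∈)
    where
    collect : ∃[ X ] Pruning G leaf X → Dominated G
    collect (X , p) = choose (dominated n l l≥2 n≥ X (pruning-size p) (UniSet-leaves p (proj₁ (proj₂ (proj₂ (proj₂ G∈))))))
      where
      choose : ∃[ q ] (q ≤ bound n l × (target n l q ⊑ F X) × (Canonical n l q X ⊎ target n l q 1 < F X 1)) → Dominated G
      choose (q , q≤p , le , alt) = record { X = X ; pruned = p ; q = q ; q≤p = q≤p ; target⊑ = le ; certainty = alt }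

  module _ {G : Graph n} (D : Dominated G) where
    open Dominated D
    private module Rep = Representative q q≤p

    structure⊑ : F Rep.uStructure ⊑ F X
    structure⊑ = ⊑-≗ (λ x → sym (Rep.F-target x)) (λ x → refl) target⊑

    representative≼ : U n l 4 q ≼ G
    representative≼ = Compare.⊑⇒≼ Rep.pruning pruned structure⊑

    representative≺ : target n l q 1 < F X 1 → U n l 4 q ≺ G
    representative≺ lt = Compare.⊑⇒≺ Rep.pruning pruned structure⊑ (subst (_< F X 1) (sym (Rep.F-target 1)) lt)

    representative-iso : Canonical n l q X → Iso G (U n l 4 q)
    representative-iso can = broom-iso id toℕ id Fₚ.toℕ-injective as v Ls a b d
      (Rep.stemLabels q) (centre 4 q) (armLegs (4 + q) Rep.ks) 1 2 3
      (trans height (sym (Rep.length-stemLabels q))) (↭-trans lengths (↭.↭-reflexive (sym Rep.lengths))) pruning Rep.pruning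
      where open Upright (canonical-upright pruned can)

  -- A graph H below `U n l 4 q` lies above some `U n l 4 r`. Incomparability forces r = q, and then
  -- no coefficient of H can be strictly smaller.
  U-minimal : ∀ q → q ≤ bound n l → Minimal (UniSet n l 4) (U n l 4 q)
  U-minimal q q≤p = Representative.uniSet q q≤p , λ (H , H∈ , H≺U) → below H H≺U (dominate H H∈)
    where
    below : ∀ H → H ≺ U n l 4 q → Dominated H → ⊥
    below H (H≼U , k , k≤n , lt) D = same-or-not (q ℕₚ.≟ Dominated.q D)
      where
      r≼q : U n l 4 (Dominated.q D) ≼ U n l 4 q
      r≼q k k≤n = ℤₚ.≤-trans (representative≼ D k k≤n) (H≼U k k≤n)
      same-or-not : Dec (q ≡ Dominated.q D) → ⊥
      same-or-not (no q≢r) = U-incomparable q≤p (Dominated.q≤p D) q≢r r≼q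
      same-or-not (yes q≡r) = ℤₚ.<-irrefl refl (ℤₚ.<-≤-trans lt
        (subst (λ r → c (U n l 4 r) k ℤ.≤ c H k) (sym q≡r) (representative≼ D k k≤n)))

  U-distinct : ∀ q r → q ≤ bound n l → r ≤ bound n l → Iso (U n l 4 q) (U n l 4 r) → q ≡ r
  U-distinct q r q≤p r≤p iso = same-or-not (q ℕₚ.≟ r)
    where
    same-or-not : Dec (q ≡ r) → q ≡ r
    same-or-not (yes q≡r) = q≡r
    same-or-not (no q≢r) = ⊥-elim (U-incomparable q≤p r≤p q≢r (λ k _ → ℤₚ.≤-reflexive (sym (iso-c (U n l 4 q) (U n l 4 r) iso k))))

  -- A minimal graph cannot lie strictly above its representative, so its structure is canonical,
  -- and equal shapes give the isomorphism.
  minimal-U : ∀ G → Minimal (UniSet n l 4) G → ∃[ q ] (q ≤ bound n l × Iso G (U n l 4 q))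
  minimal-U G (G∈ , minimal) = decide (dominate G G∈)
    where
    decide : Dominated G → ∃[ q ] (q ≤ bound n l × Iso G (U n l 4 q))
    decide D = Dominated.q D , Dominated.q≤p D , alternatives (Dominated.certainty D)
      where
      alternatives : Canonical n l (Dominated.q D) (Dominated.X D) ⊎ target n l (Dominated.q D) 1 < F (Dominated.X D) 1 → Iso G (U n l 4 (Dominated.q D))
      alternatives (inj₁ can) = representative-iso D can
      alternatives (inj₂ lt) = ⊥-elim (minimal (U n l 4 (Dominated.q D) , Representative.uniSet (Dominated.q D) (Dominated.q≤p D) , representative≺ D lt))

theorem4p6 : (n l : ℕ) → 2 ≤ l → 3 * l + 4 ≤ n →
    (∀ q → q ≤ (n ∸ (4 + 3 * l)) / suc l → Minimal (UniSet n l 4) (U n l 4 q)) ×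
    (∀ q r → q ≤ (n ∸ (4 + 3 * l)) / suc l → r ≤ (n ∸ (4 + 3 * l)) / suc l →
    Iso (U n l 4 q) (U n l 4 r) → q ≡ r) ×
    (∀ G → Minimal (UniSet n l 4) G →
    ∃[ q ] (q ≤ (n ∸ (4 + 3 * l)) / suc l × Iso G (U n l 4 q)))
theorem4p6 n l l≥2 n≥ = U-minimal n l l≥2 n≥ , U-distinct n l l≥2 n≥ , minimal-U n l l≥2 n≥
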